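{- For every $\eta>0$ and every sufficiently large integer constant $b$ (depending on $\eta$) there is a constant $C$ such that for every $k\ge 2$ the following holds. If $k$ stations execute the protocol SublinearDecrease$(b)$ and are activated by any adaptive adversary, then with probability at least $1-1/k^{\eta}$ the total number of broadcast attempts (transmissions, successful or not, by all stations together) during the execution is at most $C k\log^2 k$.
   Context: Model. $k$ anonymous identical stations share a channel. Time is divided into discrete synchronous rounds; there is no global clock available to the stations and no collision detection. Initially all stations are asleep. Each station holds one packet and is activated once, at a time chosen by an adversary. The activation round is round $0$ of the station's local clock, and the station may transmit from its local round $1$ on. In each round every active station either transmits or listens. A transmission is successful if and only if exactly one active station transmits in that round; the transmitter then receives an acknowledgement and switches off permanently. In all other cases nothing is received. The stations do not know $k$. An adaptive adversary decides online which station to activate and when, knowing the algorithm's code and the history of the computation but not future randomness; in total it activates $k$ stations. Protocol SublinearDecrease$(b)$ (executed by each station from its activation until it switches off): for $j=3,4,5,\ldots$: for $b$ rounds, transmit in each round with probability $\frac{\ln j}{j}$, independently over rounds and stations. -}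

module Defs where

open import Data.Bool using (Bool; true; false; if_then_else_; _∧_)
import Data.Bool as Bool
open import Data.Integer using (+[1+_]; -[1+_])
import Data.Integer as ℤ
import Data.Integer.Properties as ℤₚ
open import Data.List using (List; []; _∷_)
open import Data.Nat using (ℕ; zero; suc)
import Data.Nat as ℕ
import Data.Nat.Properties as ℕₚ
open import Data.Product using (Σ; Σ-syntax; _×_; _,_; proj₁; proj₂)
open import Data.Rational using (ℚ; 0ℚ; 1ℚ; ½; mkℚ)
import Data.Rational as ℚ
import Data.Rational.Properties as ℚₚ
open import Data.Rational.Solver using (module +-*-Solver)
import Data.Rational.Unnormalised as ℚᵘ
import Data.Rational.Unnormalised.Properties as ℚᵘₚ
open import Data.Sum using (inj₁; inj₂)
open import Data.Vec using (Vec; []; _∷_; map; zipWith; replicate)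
open import Relation.Binary.PropositionalEquality
  using (_≡_; refl; sym; trans; cong; cong₂; subst)
open import Algebra.Definitions.RawSemiring ℚ.+-*-rawSemiring using (_^_)

ι : ℕ → ℚ
ι n = ℤ.+ n ℚ./ 1

recip : ℕ → ℚ
recip n = ℤ.+ 1 ℚ./ suc n

Cauchy : (ℕ → ℚ) → Set
Cauchy s = (ε : ℚ) → 0ℚ ℚ.< ε →
  Σ[ N ∈ ℕ ] (∀ m n → N ℕ.≤ m → N ℕ.≤ n → ℚ.∣ s m ℚ.- s n ∣ ℚ.≤ ε)

partialSum : (ℕ → ℚ) → ℕ → ℚ
partialSum t zero    = 0ℚ
partialSum t (suc n) = partialSum t n ℚ.+ t n

-- qⁱ / i!
expTerm : ℚ → ℕ → ℚ
expTerm q zero    = 1ℚ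
expTerm q (suc i) = expTerm q i ℚ.* (q ℚ.* recip i)

-- The i-th nonzero term of the series −ln(1 − x) = Σ_{i ≥ 1} xⁱ / i.
logTerm : ℚ → ℕ → ℚ
logTerm x i = x ^ suc i ℚ.* recip i

module RationalLemmas where
  open import Data.Rational hiding (NonZero)
  open import Data.Rational.Properties
  open +-*-Solver

  ι-suc : ∀ n → ι (suc n) ≡ 1ℚ + ι n
  ι-suc n = toℚᵘ-injective (begin-equality
    toℚᵘ (ι (suc n))              ≃⟨ toℚᵘ-fromℚᵘ (ℚᵘ.mkℚᵘ (ℤ.+ suc n) 0) ⟩
    ℚᵘ.mkℚᵘ (ℤ.+ suc n) 0            ≃⟨ ℚᵘ.*≡* (cong (ℤ._* ℤ.+ 1) (sym (cong (λ z → ℤ.+ 1 ℤ.+ z) (ℤₚ.*-identityʳ (ℤ.+ n))))) ⟩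
    ℚᵘ.1ℚᵘ ℚᵘ.+ ℚᵘ.mkℚᵘ (ℤ.+ n) 0    ≃⟨ ℚᵘₚ.+-congʳ ℚᵘ.1ℚᵘ (ℚᵘₚ.≃-sym (toℚᵘ-fromℚᵘ (ℚᵘ.mkℚᵘ (ℤ.+ n) 0))) ⟩
    ℚᵘ.1ℚᵘ ℚᵘ.+ toℚᵘ (ι n)         ≃⟨ ℚᵘₚ.≃-sym (toℚᵘ-homo-+ 1ℚ (ι n)) ⟩
    toℚᵘ (1ℚ + ι n)               ∎)
    where open ℚᵘₚ.≤-Reasoning

  ι-recip : ∀ n → ι (suc n) * recip n ≡ 1ℚ
  ι-recip n = toℚᵘ-injective (begin-equality
    toℚᵘ (ι (suc n) * recip n)                      ≃⟨ toℚᵘ-homo-* (ι (suc n)) (recip n) ⟩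
    toℚᵘ (ι (suc n)) ℚᵘ.* toℚᵘ (recip n)            ≃⟨ ℚᵘₚ.*-cong (toℚᵘ-fromℚᵘ (ℚᵘ.mkℚᵘ (ℤ.+ suc n) 0)) (toℚᵘ-fromℚᵘ (ℚᵘ.mkℚᵘ (ℤ.+ 1) n)) ⟩
    ℚᵘ.mkℚᵘ (ℤ.+ suc n) 0 ℚᵘ.* ℚᵘ.mkℚᵘ (ℤ.+ 1) n         ≃⟨ ℚᵘ.*≡* (trans (ℤₚ.*-identityʳ (ℤ.+ suc n ℤ.* ℤ.+ 1)) (trans (ℤₚ.*-comm (ℤ.+ suc n) (ℤ.+ 1)) (cong (ℤ.+ 1 ℤ.*_) (cong ℤ.+_ (sym (ℕₚ.*-identityˡ (suc n))))))) ⟩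
    ℚᵘ.1ℚᵘ                                          ∎)
    where open ℚᵘₚ.≤-Reasoning

  -- A rational times its denominator is its numerator.
  den* : ∀ q → q * ι (↧ₙ q) ≡ ↥ q ℚ./ 1
  den* q@(mkℚ a d c) = toℚᵘ-injective (begin-equality
    toℚᵘ (q * ι (suc d))                     ≃⟨ toℚᵘ-homo-* q (ι (suc d)) ⟩
    toℚᵘ q ℚᵘ.* toℚᵘ (ι (suc d))             ≃⟨ ℚᵘₚ.*-congˡ {toℚᵘ q} (toℚᵘ-fromℚᵘ (ℚᵘ.mkℚᵘ (ℤ.+ suc d) 0)) ⟩
    ℚᵘ.mkℚᵘ a d ℚᵘ.* ℚᵘ.mkℚᵘ (ℤ.+ suc d) 0      ≃⟨ ℚᵘ.*≡* (trans (ℤₚ.*-identityʳ (a ℤ.* ℤ.+ suc d)) (cong (a ℤ.*_) (cong ℤ.+_ (sym (ℕₚ.*-identityʳ (suc d)))))) ⟩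
    ℚᵘ.mkℚᵘ a 0                              ≃⟨ ℚᵘₚ.≃-sym (toℚᵘ-fromℚᵘ (ℚᵘ.mkℚᵘ a 0)) ⟩
    toℚᵘ (a ℚ./ 1)                           ∎)
    where open ℚᵘₚ.≤-Reasoning

  open ≤-Reasoning

  0≤1 : 0ℚ ≤ 1ℚ
  0≤1 = nonNegative⁻¹ 1ℚ

  *-mono-≤ : ∀ {a b c d} → 0ℚ ≤ b → 0ℚ ≤ c → a ≤ b → c ≤ d → a * c ≤ b * d
  *-mono-≤ {a} {b} {c} {d} 0≤b 0≤c a≤b c≤d = ≤-trans
    (*-monoʳ-≤-nonNeg c {{nonNegative 0≤c}} a≤b)
    (*-monoˡ-≤-nonNeg b {{nonNegative 0≤b}} c≤d)

  0≤* : ∀ {a b} → 0ℚ ≤ a → 0ℚ ≤ b → 0ℚ ≤ a * b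
  0≤* {a} {b} p q = subst (_≤ a * b) (*-zeroˡ 0ℚ) (*-mono-≤ p ≤-refl p q)

  0≤+ : ∀ {a b} → 0ℚ ≤ a → 0ℚ ≤ b → 0ℚ ≤ a + b
  0≤+ p q = +-mono-≤ p q

  0<* : ∀ {a b} → 0ℚ < a → 0ℚ < b → 0ℚ < a * b
  0<* {a} {b} p q = positive⁻¹ (a * b) {{pos*pos⇒pos a {{positive p}} b {{positive q}}}}

  ι-nonneg : ∀ n → 0ℚ ≤ ι n
  ι-nonneg zero    = ≤-refl
  ι-nonneg (suc n) = subst (0ℚ ≤_) (sym (ι-suc n)) (0≤+ 0≤1 (ι-nonneg n))

  ι-mono : ∀ {m n} → m ℕ.≤ n → ι m ≤ ι n
  ι-mono {n = n} ℕ.z≤n = ι-nonneg n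
  ι-mono (ℕ.s≤s {m} {n} p) =
    subst (_≤ ι (suc n)) (sym (ι-suc m)) (subst (1ℚ + ι m ≤_) (sym (ι-suc n)) (+-monoʳ-≤ 1ℚ (ι-mono p)))

  recip-pos : ∀ n → 0ℚ < recip n
  recip-pos n = positive⁻¹ (recip n) {{normalize-pos 1 (suc n)}}

  recip-nonneg : ∀ n → 0ℚ ≤ recip n
  recip-nonneg n = <⇒≤ (recip-pos n)

  ι-+ : ∀ m n → ι (m ℕ.+ n) ≡ ι m + ι n
  ι-+ zero    n = sym (+-identityˡ (ι n))
  ι-+ (suc m) n = trans (ι-suc (m ℕ.+ n)) (trans (cong (1ℚ +_) (ι-+ m n))
    (trans (sym (+-assoc 1ℚ (ι m) (ι n))) (cong (_+ ι n) (sym (ι-suc m)))))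

  ι-* : ∀ m n → ι (m ℕ.* n) ≡ ι m * ι n
  ι-* zero    n = sym (*-zeroˡ (ι n))
  ι-* (suc m) n = trans (ι-+ n (m ℕ.* n)) (trans (cong (ι n +_) (ι-* m n))
    (trans (solve 2 (λ a b → b :+ a :* b := (con 1ℚ :+ a) :* b) refl (ι m) (ι n))
      (cong (_* ι n) (sym (ι-suc m)))))

  den≥1 : ∀ q → 1ℚ ≤ ι (↧ₙ q)
  den≥1 (mkℚ _ d _) = ι-mono {1} {suc d} (ℕ.s≤s ℕ.z≤n)

  ceil : ℚ → ℕ
  ceil q = ℤ.∣ ↥ q ∣

  ∣q∣≤ceil : ∀ q → ℚ.∣ q ∣ ≤ ι (ceil q)
  ∣q∣≤ceil q@(mkℚ a d c) = subst (_≤ ι (ceil q)) (*-identityʳ ∣ q ∣)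
    (≤-trans (*-monoˡ-≤-nonNeg ∣ q ∣ {{∣-∣-nonNeg q}} (den≥1 q)) (≤-reflexive (den* ∣ q ∣)))

  q≤∣q∣ : ∀ q → q ≤ ∣ q ∣
  q≤∣q∣ q with ≤-total 0ℚ q
  ... | inj₁ 0≤q = ≤-reflexive (sym (0≤p⇒∣p∣≡p 0≤q))
  ... | inj₂ q≤0 = ≤-trans q≤0 (0≤∣p∣ q)

  q≤ceil : ∀ q → q ≤ ι (ceil q)
  q≤ceil q = ≤-trans (q≤∣q∣ q) (∣q∣≤ceil q)

  1≤ε*den : ∀ ε → 0ℚ < ε → 1ℚ ≤ ε * ι (↧ₙ ε)
  1≤ε*den ε@(mkℚ +[1+ a ] d c) _ =
    ≤-trans (ι-mono {1} {suc a} (ℕ.s≤s ℕ.z≤n)) (≤-reflexive (sym (den* ε)))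
  1≤ε*den (mkℚ (ℤ.+ 0) d c) (*<* (ℤ.+<+ ()))
  1≤ε*den (mkℚ -[1+ a ] d c) (*<* ())

  archimedean : ∀ D ε → 0ℚ < ε → Σ[ N ∈ ℕ ] (∀ m → N ℕ.≤ m → D * recip m ≤ ε)
  archimedean D ε 0<ε = ↧ₙ ε ℕ.* ceil D , λ m N≤m →
    let D≤ : D ≤ ε * ι (suc m)
        D≤ = begin
          D                               ≤⟨ q≤ceil D ⟩
          ι (ceil D)                      ≡⟨ sym (*-identityˡ _) ⟩
          1ℚ * ι (ceil D)                 ≤⟨ *-monoʳ-≤-nonNeg (ι (ceil D)) {{nonNegative (ι-nonneg (ceil D))}} (1≤ε*den ε 0<ε) ⟩
          ε * ι (↧ₙ ε) * ι (ceil D)       ≡⟨ *-assoc ε _ _ ⟩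
          ε * (ι (↧ₙ ε) * ι (ceil D))     ≡⟨ cong (ε *_) (sym (ι-* (↧ₙ ε) (ceil D))) ⟩
          ε * ι (↧ₙ ε ℕ.* ceil D)         ≤⟨ *-monoˡ-≤-nonNeg ε {{nonNegative (<⇒≤ 0<ε)}} (ι-mono (ℕₚ.m≤n⇒m≤1+n N≤m)) ⟩
          ε * ι (suc m)                   ∎
    in begin
      D * recip m                  ≤⟨ *-monoʳ-≤-nonNeg (recip m) {{nonNegative (recip-nonneg m)}} D≤ ⟩
      ε * ι (suc m) * recip m      ≡⟨ *-assoc ε _ _ ⟩
      ε * (ι (suc m) * recip m)    ≡⟨ cong (ε *_) (ι-recip m) ⟩
      ε * 1ℚ                       ≡⟨ *-identityʳ ε ⟩
      ε                            ∎

  ∣-∣-swap : ∀ a b → ∣ a - b ∣ ≡ ∣ b - a ∣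
  ∣-∣-swap a b = trans (cong ∣_∣ (solve 2 (λ a b → a :- b := :- (b :- a)) refl a b)) (∣-p∣≡∣p∣ (b - a))

  triangle : ∀ a b c → ∣ a - c ∣ ≤ ∣ a - b ∣ + ∣ b - c ∣
  triangle a b c = ≤-trans
    (≤-reflexive (cong ∣_∣ (solve 3 (λ a b c → a :- c := (a :- b) :+ (b :- c)) refl a b c)))
    (∣p+q∣≤∣p∣+∣q∣ (a - b) (b - c))

  half : ∀ ε → ε * ½ + ε * ½ ≡ ε
  half ε = solve 1 (λ e → e :* con ½ :+ e :* con ½ := e) refl ε

  half-pos : ∀ {ε} → 0ℚ < ε → 0ℚ < ε * ½
  half-pos p = 0<* p (positive⁻¹ ½)

  cauchy-ordered : (s : ℕ → ℚ) →
    (∀ ε → 0ℚ < ε → Σ[ N ∈ ℕ ] (∀ m n → N ℕ.≤ n → n ℕ.≤ m → ∣ s m - s n ∣ ≤ ε)) → Cauchy s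
  cauchy-ordered s h ε 0<ε = N , go
    where
    N = proj₁ (h ε 0<ε)
    go : ∀ m n → N ℕ.≤ m → N ℕ.≤ n → ∣ s m - s n ∣ ≤ ε
    go m n N≤m N≤n with ℕₚ.≤-total n m
    ... | inj₁ n≤m = proj₂ (h ε 0<ε) m n N≤n n≤m
    ... | inj₂ m≤n = subst (_≤ ε) (∣-∣-swap (s n) (s m)) (proj₂ (h ε 0<ε) n m N≤m m≤n)

  mono-from-step : (s : ℕ → ℚ) → (∀ n → s n ≤ s (suc n)) → ∀ {n m} → n ℕ.≤ m → s n ≤ s m
  mono-from-step s h {n} {zero}  ℕ.z≤n = ≤-refl
  mono-from-step s h {n} {suc m} p with ℕₚ.m≤n⇒m<n∨m≡n p
  ... | inj₁ n<1+m = ≤-trans (mono-from-step s h (ℕₚ.≤-pred n<1+m)) (h m)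
  ... | inj₂ refl  = ≤-refl

  anti-from-step : (s : ℕ → ℚ) (N : ℕ) → (∀ n → N ℕ.≤ n → s (suc n) ≤ s n) →
    ∀ {n m} → N ℕ.≤ n → n ℕ.≤ m → s m ≤ s n
  anti-from-step s N h {n} {zero}  N≤n ℕ.z≤n = ≤-refl
  anti-from-step s N h {n} {suc m} N≤n p with ℕₚ.m≤n⇒m<n∨m≡n p
  ... | inj₁ n<1+m = let n≤m = ℕₚ.≤-pred n<1+m in
                     ≤-trans (h m (ℕₚ.≤-trans N≤n n≤m)) (anti-from-step s N h N≤n n≤m)
  ... | inj₂ refl  = ≤-refl

  -- An increasing sequence s whose upper companion s + g is decreasing, with g of order 1/m.
  module Tail (s g : ℕ → ℚ) (N₀ : ℕ) (D : ℚ)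
    (up   : ∀ n → s n ≤ s (suc n))
    (down : ∀ n → N₀ ℕ.≤ n → s (suc n) + g (suc n) ≤ s n + g n)
    (g≥0  : ∀ n → 0ℚ ≤ g n)
    (g≤   : ∀ n → N₀ ℕ.≤ n → g n ≤ D * recip n) where

    below : ∀ n m → N₀ ℕ.≤ n → n ℕ.≤ m → s m ≤ s n + g n
    below n m N≤n n≤m = ≤-trans
      (≤-trans (≤-reflexive (sym (+-identityʳ (s m)))) (+-monoʳ-≤ (s m) (g≥0 m)))
      (anti-from-step (λ i → s i + g i) N₀ down N≤n n≤m)

    bound : ∀ n → s n ≤ s N₀ + g N₀
    bound n with ℕₚ.≤-total N₀ n
    ... | inj₁ N₀≤n = below N₀ n ℕₚ.≤-refl N₀≤n
    ... | inj₂ n≤N₀ = ≤-trans (mono-from-step s up n≤N₀) (below N₀ N₀ ℕₚ.≤-refl ℕₚ.≤-refl)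

    gap : ∀ n m → N₀ ℕ.≤ n → n ℕ.≤ m → ∣ s m - s n ∣ ≤ g n
    gap n m N≤n n≤m = ≤-trans
      (≤-reflexive (0≤p⇒∣p∣≡p (subst (_≤ s m - s n) (+-inverseʳ (s n)) (+-monoˡ-≤ (- s n) (mono-from-step s up n≤m)))))
      (≤-trans (+-monoˡ-≤ (- s n) (below n m N≤n n≤m))
        (≤-reflexive (solve 2 (λ a b → a :+ b :- a := b) refl (s n) (g n))))

    cauchy : Cauchy s
    cauchy = cauchy-ordered s λ ε 0<ε →
      let (N₁ , h) = archimedean D ε 0<ε
      in N₀ ℕ.⊔ N₁ , λ m n N≤n n≤m →
        let N₀≤n = ℕₚ.≤-trans (ℕₚ.m≤m⊔n N₀ N₁) N≤n
            N₁≤n = ℕₚ.≤-trans (ℕₚ.m≤n⊔m N₀ N₁) N≤n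
        in ≤-trans (gap n m N₀≤n n≤m) (≤-trans (g≤ n N₀≤n) (h n N₁≤n))

  module Prefix (s : ℕ → ℚ) where

    bound : ℕ → ℕ
    bound zero    = 0
    bound (suc n) = bound n ℕ.+ ceil (s n)

    holds : ∀ n i → i ℕ.< n → ∣ s i ∣ ≤ ι (bound n)
    holds (suc n) i i<n with ℕₚ.m≤n⇒m<n∨m≡n i<n
    ... | inj₁ p    = ≤-trans (holds n i (ℕₚ.≤-pred p)) (ι-mono (ℕₚ.m≤m+n (bound n) (ceil (s n))))
    ... | inj₂ refl = ≤-trans (∣q∣≤ceil (s n)) (ι-mono (ℕₚ.m≤n+m (ceil (s n)) (bound n)))

  bounded-from : (s : ℕ → ℚ) (N P : ℕ) → (∀ i → i ℕ.≤ N → ∣ s i ∣ ≤ ι P) →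
    (∀ n → N ℕ.≤ n → ∣ s n - s N ∣ ≤ 1ℚ) → ∀ n → ∣ s n ∣ ≤ ι (suc P)
  bounded-from s N P pre near n with ℕₚ.≤-total N n
  ... | inj₁ N≤n = begin
    ∣ s n ∣                        ≡⟨ cong ∣_∣ (solve 2 (λ a b → a := (a :- b) :+ b) refl (s n) (s N)) ⟩
    ∣ (s n - s N) + s N ∣          ≤⟨ ∣p+q∣≤∣p∣+∣q∣ (s n - s N) (s N) ⟩
    ∣ s n - s N ∣ + ∣ s N ∣        ≤⟨ +-mono-≤ (near n N≤n) (pre N ℕₚ.≤-refl) ⟩
    1ℚ + ι P                       ≡⟨ sym (ι-suc P) ⟩
    ι (suc P)                      ∎
  ... | inj₂ n≤N = ≤-trans (pre n n≤N) (ι-mono (ℕₚ.n≤1+n P))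

  cauchy-bounded : (s : ℕ → ℚ) → Cauchy s → Σ[ B ∈ ℕ ] (∀ n → ∣ s n ∣ ≤ ι B)
  cauchy-bounded s c =
    let (N , near) = c 1ℚ (positive⁻¹ 1ℚ)
    in suc (Prefix.bound s (suc N)) ,
       bounded-from s N (Prefix.bound s (suc N))
         (λ i i≤N → Prefix.holds s (suc N) i (ℕ.s≤s i≤N))
         (λ n N≤n → near n N N≤n ℕₚ.≤-refl)

  abstract
    +-cauchy : ∀ {s t} → Cauchy s → Cauchy t → Cauchy (λ n → s n + t n)
    +-cauchy {s} {t} cs ct ε 0<ε =
      let (M , hs) = cs (ε * ½) (half-pos 0<ε)
          (N , ht) = ct (ε * ½) (half-pos 0<ε)
      in M ℕ.⊔ N , λ m n p q → begin
        ∣ (s m + t m) - (s n + t n) ∣      ≡⟨ cong ∣_∣ (solve 4 (λ a b c d → (a :+ b) :- (c :+ d) := (a :- c) :+ (b :- d)) refl (s m) (t m) (s n) (t n)) ⟩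
        ∣ (s m - s n) + (t m - t n) ∣      ≤⟨ ∣p+q∣≤∣p∣+∣q∣ (s m - s n) (t m - t n) ⟩
        ∣ s m - s n ∣ + ∣ t m - t n ∣      ≤⟨ +-mono-≤ (hs m n (ℕₚ.≤-trans (ℕₚ.m≤m⊔n M N) p) (ℕₚ.≤-trans (ℕₚ.m≤m⊔n M N) q))
                                                     (ht m n (ℕₚ.≤-trans (ℕₚ.m≤n⊔m M N) p) (ℕₚ.≤-trans (ℕₚ.m≤n⊔m M N) q)) ⟩
        ε * ½ + ε * ½                      ≡⟨ half ε ⟩
        ε                                  ∎

  abstract
    neg-cauchy : ∀ {s} → Cauchy s → Cauchy (λ n → - s n)
    neg-cauchy {s} cs ε 0<ε =
      let (M , hs) = cs ε 0<ε
      in M , λ m n p q → ≤-trans (≤-reflexive (trans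
        (cong ∣_∣ (solve 2 (λ a b → :- a :- :- b := b :- a) refl (s m) (s n))) (∣-∣-swap (s n) (s m)))) (hs m n p q)

  shrink : ∀ {δ ε} B → δ ≤ ε * recip B → δ * ι (suc B) ≤ ε
  shrink {δ} {ε} B h = begin
    δ * ι (suc B)              ≤⟨ *-monoʳ-≤-nonNeg (ι (suc B)) {{nonNegative (ι-nonneg (suc B))}} h ⟩
    ε * recip B * ι (suc B)    ≡⟨ *-assoc ε _ _ ⟩
    ε * (recip B * ι (suc B))  ≡⟨ cong (ε *_) (trans (*-comm (recip B) (ι (suc B))) (ι-recip B)) ⟩
    ε * 1ℚ                     ≡⟨ *-identityʳ ε ⟩
    ε                          ∎

  abstract
    *-cauchy : ∀ {s t} → Cauchy s → Cauchy t → Cauchy (λ n → s n * t n)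
    *-cauchy {s} {t} cs ct ε 0<ε =
      let (A , ha) = cauchy-bounded s cs
          (B , hb) = cauchy-bounded t ct
          (M , hs) = cs (ε * ½ * recip B) (0<* (half-pos 0<ε) (recip-pos B))
          (N , ht) = ct (ε * ½ * recip A) (0<* (half-pos 0<ε) (recip-pos A))
      in M ℕ.⊔ N , λ m n p q →
        let ds = hs m n (ℕₚ.≤-trans (ℕₚ.m≤m⊔n M N) p) (ℕₚ.≤-trans (ℕₚ.m≤m⊔n M N) q)
            dt = ht m n (ℕₚ.≤-trans (ℕₚ.m≤n⊔m M N) p) (ℕₚ.≤-trans (ℕₚ.m≤n⊔m M N) q)
        in begin
        ∣ s m * t m - s n * t n ∣                              ≡⟨ cong ∣_∣ (solve 4 (λ a b c d → a :* b :- c :* d := (a :- c) :* b :+ (b :- d) :* c) refl (s m) (t m) (s n) (t n)) ⟩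
        ∣ (s m - s n) * t m + (t m - t n) * s n ∣              ≤⟨ ∣p+q∣≤∣p∣+∣q∣ ((s m - s n) * t m) ((t m - t n) * s n) ⟩
        ∣ (s m - s n) * t m ∣ + ∣ (t m - t n) * s n ∣          ≡⟨ cong₂ _+_ (∣p*q∣≡∣p∣*∣q∣ (s m - s n) (t m)) (∣p*q∣≡∣p∣*∣q∣ (t m - t n) (s n)) ⟩
        ∣ s m - s n ∣ * ∣ t m ∣ + ∣ t m - t n ∣ * ∣ s n ∣      ≤⟨ +-mono-≤
            (*-mono-≤ (0≤∣p∣ (s m - s n)) (0≤∣p∣ (t m)) ≤-refl (≤-trans (hb m) (ι-mono (ℕₚ.n≤1+n B))))
            (*-mono-≤ (0≤∣p∣ (t m - t n)) (0≤∣p∣ (s n)) ≤-refl (≤-trans (ha n) (ι-mono (ℕₚ.n≤1+n A)))) ⟩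
        ∣ s m - s n ∣ * ι (suc B) + ∣ t m - t n ∣ * ι (suc A)  ≤⟨ +-mono-≤ (shrink {ε = ε * ½} B ds) (shrink {ε = ε * ½} A dt) ⟩
        ε * ½ + ε * ½                                          ≡⟨ half ε ⟩
        ε                                                      ∎

  0≤^ : ∀ x → 0ℚ ≤ x → ∀ i → 0ℚ ≤ x ^ i
  0≤^ x 0≤x zero    = 0≤1
  0≤^ x 0≤x (suc i) = 0≤* 0≤x (0≤^ x 0≤x i)

  ^≤1 : ∀ x → 0ℚ ≤ x → x ≤ 1ℚ → ∀ i → x ^ i ≤ 1ℚ
  ^≤1 x 0≤x x≤1 zero    = ≤-refl
  ^≤1 x 0≤x x≤1 (suc i) = subst (x * x ^ i ≤_) (*-identityˡ 1ℚ) (*-mono-≤ 0≤1 (0≤^ x 0≤x i) x≤1 (^≤1 x 0≤x x≤1 i))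

  recip-anti : ∀ m → recip (suc m) ≤ recip m
  recip-anti m = begin
    recip (suc m)                          ≡⟨ sym (trans (cong (_* recip (suc m)) (ι-recip m)) (*-identityˡ _)) ⟩
    ι (suc m) * recip m * recip (suc m)    ≤⟨ *-monoʳ-≤-nonNeg (recip (suc m)) {{nonNegative (recip-nonneg (suc m))}}
                                               (*-monoʳ-≤-nonNeg (recip m) {{nonNegative (recip-nonneg m)}} (ι-mono (ℕₚ.n≤1+n (suc m)))) ⟩
    ι (suc (suc m)) * recip m * recip (suc m) ≡⟨ solve 3 (λ a b c → a :* b :* c := b :* (a :* c)) refl (ι (suc (suc m))) (recip m) (recip (suc m)) ⟩
    recip m * (ι (suc (suc m)) * recip (suc m)) ≡⟨ trans (cong (recip m *_) (ι-recip (suc m))) (*-identityʳ _) ⟩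
    recip m                                ∎

  recip≤1 : ∀ m → recip m ≤ 1ℚ
  recip≤1 zero    = ≤-refl
  recip≤1 (suc m) = ≤-trans (recip-anti m) (recip≤1 m)

  module LogBound (n : ℕ) where
    x = 1ℚ - recip n

    0≤x : 0ℚ ≤ x
    0≤x = subst (_≤ x) (+-inverseʳ (recip n)) (+-monoˡ-≤ (- recip n) (recip≤1 n))

    x≤1 : x ≤ 1ℚ
    x≤1 = subst (x ≤_) (+-identityʳ 1ℚ) (+-monoʳ-≤ 1ℚ (neg-antimono-≤ (recip-nonneg n)))

    D = ι (suc n)

    g : ℕ → ℚ
    g m = D * (x ^ suc m * recip m)

    t≥0 : ∀ m → 0ℚ ≤ logTerm x m
    t≥0 m = 0≤* (0≤^ x 0≤x (suc m)) (recip-nonneg m)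

    1+Dx : 1ℚ + D * x ≡ D
    1+Dx = trans (solve 2 (λ d r → con 1ℚ :+ d :* (con 1ℚ :- r) := con 1ℚ :+ (d :- d :* r)) refl D (recip n))
      (trans (cong (λ z → 1ℚ + (D - z)) (ι-recip n)) (solve 1 (λ d → con 1ℚ :+ (d :- con 1ℚ) := d) refl D))

    down : ∀ m → 0 ℕ.≤ m → partialSum (logTerm x) (suc m) + g (suc m) ≤ partialSum (logTerm x) m + g m
    down m _ = begin
      S + x ^ suc m * recip m + D * (x * x ^ suc m * recip (suc m))
        ≤⟨ +-monoʳ-≤ (S + x ^ suc m * recip m) (*-monoˡ-≤-nonNeg D {{nonNegative (ι-nonneg (suc n))}}
             (*-monoˡ-≤-nonNeg (x * x ^ suc m) {{nonNegative (0≤^ x 0≤x (suc (suc m)))}} (recip-anti m))) ⟩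
      S + x ^ suc m * recip m + D * (x * x ^ suc m * recip m)
        ≡⟨ solve 5 (λ s d x y r → s :+ y :* r :+ d :* (x :* y :* r) := s :+ (con 1ℚ :+ d :* x) :* (y :* r)) refl S D x (x ^ suc m) (recip m) ⟩
      S + (1ℚ + D * x) * (x ^ suc m * recip m)
        ≡⟨ cong (λ z → S + z * (x ^ suc m * recip m)) 1+Dx ⟩
      S + D * (x ^ suc m * recip m) ∎
      where S = partialSum (logTerm x) m

    up : ∀ m → partialSum (logTerm x) m ≤ partialSum (logTerm x) (suc m)
    up m = subst (_≤ partialSum (logTerm x) (suc m)) (+-identityʳ (partialSum (logTerm x) m))
      (+-monoʳ-≤ (partialSum (logTerm x) m) (t≥0 m))

    g≥0 : ∀ m → 0ℚ ≤ g m
    g≥0 m = 0≤* (ι-nonneg (suc n)) (t≥0 m)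

    g≤ : ∀ m → 0 ℕ.≤ m → g m ≤ D * recip m
    g≤ m _ = *-monoˡ-≤-nonNeg D {{nonNegative (ι-nonneg (suc n))}}
      (subst (x ^ suc m * recip m ≤_) (*-identityˡ (recip m))
        (*-monoʳ-≤-nonNeg (recip m) {{nonNegative (recip-nonneg m)}} (^≤1 x 0≤x x≤1 (suc m))))

    open Tail (partialSum (logTerm x)) g 0 D up down g≥0 g≤ public

  abstract
    log-cauchy : ∀ n → Cauchy (partialSum (logTerm (1ℚ - recip n)))
    log-cauchy n = LogBound.cauchy n


  expTerm-nonneg : ∀ {q} → 0ℚ ≤ q → ∀ i → 0ℚ ≤ expTerm q i
  expTerm-nonneg 0≤q zero    = 0≤1
  expTerm-nonneg 0≤q (suc i) = 0≤* (expTerm-nonneg 0≤q i) (0≤* 0≤q (recip-nonneg i))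

  ∣expTerm∣≤ : ∀ {q B} → 0ℚ ≤ B → ∣ q ∣ ≤ B → ∀ i → ∣ expTerm q i ∣ ≤ expTerm B i
  ∣expTerm∣≤ 0≤B h zero = ≤-refl
  ∣expTerm∣≤ {q} {B} 0≤B h (suc i) = begin
    ∣ expTerm q i * (q * recip i) ∣          ≡⟨ ∣p*q∣≡∣p∣*∣q∣ (expTerm q i) (q * recip i) ⟩
    ∣ expTerm q i ∣ * ∣ q * recip i ∣        ≡⟨ cong (∣ expTerm q i ∣ *_) (trans (∣p*q∣≡∣p∣*∣q∣ q (recip i)) (cong (∣ q ∣ *_) (0≤p⇒∣p∣≡p (recip-nonneg i)))) ⟩
    ∣ expTerm q i ∣ * (∣ q ∣ * recip i)      ≤⟨ *-mono-≤ (expTerm-nonneg 0≤B i) (0≤* (0≤∣p∣ q) (recip-nonneg i)) (∣expTerm∣≤ 0≤B h i)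
                                                  (*-monoʳ-≤-nonNeg (recip i) {{nonNegative (recip-nonneg i)}} h) ⟩
    expTerm B i * (B * recip i)              ∎

  expTerm-step : ∀ B i → ι (suc i) * expTerm B (suc i) ≡ expTerm B i * B
  expTerm-step B i = trans
    (solve 4 (λ a t b r → a :* (t :* (b :* r)) := t :* b :* (a :* r)) refl (ι (suc i)) (expTerm B i) B (recip i))
    (trans (cong (expTerm B i * B *_) (ι-recip i)) (*-identityʳ _))

  module _ {p q B} (0≤B : 0ℚ ≤ B) (hp : ∣ p ∣ ≤ B) (hq : ∣ q ∣ ≤ B) where

    δ = ∣ p - q ∣

    mutual
      expTerm-lip′ : ∀ i → ∣ expTerm p i - expTerm q i ∣ * B ≤ δ * (ι i * expTerm B i)
      expTerm-lip′ zero = ≤-reflexive (trans (*-zeroˡ B) (sym (trans (cong (δ *_) (*-zeroˡ 1ℚ)) (*-zeroʳ δ))))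
      expTerm-lip′ (suc i) = begin
        ∣ expTerm p (suc i) - expTerm q (suc i) ∣ * B  ≤⟨ *-monoʳ-≤-nonNeg B {{nonNegative 0≤B}} (expTerm-lip i) ⟩
        δ * expTerm B i * B                            ≡⟨ *-assoc δ _ _ ⟩
        δ * (expTerm B i * B)                          ≡⟨ cong (δ *_) (sym (expTerm-step B i)) ⟩
        δ * (ι (suc i) * expTerm B (suc i))            ∎

      expTerm-lip : ∀ i → ∣ expTerm p (suc i) - expTerm q (suc i) ∣ ≤ δ * expTerm B i
      expTerm-lip i = begin
        ∣ P * (p * r) - Q * (q * r) ∣              ≡⟨ cong ∣_∣ (solve 5 (λ P Q p q r → P :* (p :* r) :- Q :* (q :* r) := (P :* (p :- q) :+ (P :- Q) :* q) :* r) refl P Q p q r) ⟩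
        ∣ (P * (p - q) + (P - Q) * q) * r ∣        ≡⟨ trans (∣p*q∣≡∣p∣*∣q∣ (P * (p - q) + (P - Q) * q) r) (cong (∣ P * (p - q) + (P - Q) * q ∣ *_) (0≤p⇒∣p∣≡p (recip-nonneg i))) ⟩
        ∣ P * (p - q) + (P - Q) * q ∣ * r          ≤⟨ r-mono (∣p+q∣≤∣p∣+∣q∣ (P * (p - q)) ((P - Q) * q)) ⟩
        (∣ P * (p - q) ∣ + ∣ (P - Q) * q ∣) * r    ≡⟨ cong (_* r) (cong₂ _+_ (∣p*q∣≡∣p∣*∣q∣ P (p - q)) (∣p*q∣≡∣p∣*∣q∣ (P - Q) q)) ⟩
        (∣ P ∣ * δ + ∣ P - Q ∣ * ∣ q ∣) * r        ≤⟨ r-mono (+-mono-≤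
            (*-monoʳ-≤-nonNeg δ {{∣-∣-nonNeg (p - q)}} (∣expTerm∣≤ 0≤B hp i))
            (≤-trans (*-monoˡ-≤-nonNeg ∣ P - Q ∣ {{∣-∣-nonNeg (P - Q)}} hq) (expTerm-lip′ i))) ⟩
        (T * δ + δ * (ι i * T)) * r                ≡⟨ solve 4 (λ T d n r → (T :* d :+ d :* (n :* T)) :* r := d :* T :* ((con 1ℚ :+ n) :* r)) refl T δ (ι i) r ⟩
        δ * T * ((1ℚ + ι i) * r)                   ≡⟨ cong (λ z → δ * T * (z * r)) (sym (ι-suc i)) ⟩
        δ * T * (ι (suc i) * r)                    ≡⟨ trans (cong (δ * T *_) (ι-recip i)) (*-identityʳ _) ⟩
        δ * T                                      ∎
        where
        P = expTerm p i
        Q = expTerm q i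
        T = expTerm B i
        r = recip i
        r-mono : ∀ {a b} → a ≤ b → a * r ≤ b * r
        r-mono = *-monoʳ-≤-nonNeg r {{nonNegative (recip-nonneg i)}}

    expSum-lip : ∀ n → ∣ partialSum (expTerm p) n - partialSum (expTerm q) n ∣ ≤ δ * partialSum (expTerm B) n
    expSum-lip zero = ≤-reflexive (sym (*-zeroʳ δ))
    expSum-lip (suc n) = ≤-trans (go n) (*-monoˡ-≤-nonNeg δ {{∣-∣-nonNeg (p - q)}}
        (subst (_≤ partialSum (expTerm B) (suc n)) (+-identityʳ _)
          (+-monoʳ-≤ (partialSum (expTerm B) n) (expTerm-nonneg 0≤B n))))
      where
      go : ∀ n → ∣ partialSum (expTerm p) (suc n) - partialSum (expTerm q) (suc n) ∣ ≤ δ * partialSum (expTerm B) n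
      go zero = ≤-reflexive (sym (*-zeroʳ δ))
      go (suc n) = begin
        ∣ (a + a′) - (b + b′) ∣              ≡⟨ cong ∣_∣ (solve 4 (λ a b c d → (a :+ b) :- (c :+ d) := (a :- c) :+ (b :- d)) refl a a′ b b′) ⟩
        ∣ (a - b) + (a′ - b′) ∣              ≤⟨ ∣p+q∣≤∣p∣+∣q∣ (a - b) (a′ - b′) ⟩
        ∣ a - b ∣ + ∣ a′ - b′ ∣              ≤⟨ +-mono-≤ (go n) (expTerm-lip n) ⟩
        δ * partialSum (expTerm B) n + δ * expTerm B n ≡⟨ sym (*-distribˡ-+ δ _ _) ⟩
        δ * partialSum (expTerm B) (suc n)   ∎
        where
        a  = partialSum (expTerm p) (suc n)
        a′ = expTerm p (suc n)
        b  = partialSum (expTerm q) (suc n)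
        b′ = expTerm q (suc n)

  expSum-tail : ∀ {q B} → 0ℚ ≤ B → ∣ q ∣ ≤ B → ∀ n m → n ℕ.≤ m →
    ∣ partialSum (expTerm q) m - partialSum (expTerm q) n ∣ ≤ partialSum (expTerm B) m - partialSum (expTerm B) n
  expSum-tail {q} {B} 0≤B h n zero ℕ.z≤n = ≤-refl
  expSum-tail {q} {B} 0≤B h n (suc m) n≤1+m with ℕₚ.m≤n⇒m<n∨m≡n n≤1+m
  ... | inj₂ refl  = ≤-reflexive (trans (cong ∣_∣ (+-inverseʳ (partialSum (expTerm q) (suc m)))) (sym (+-inverseʳ (partialSum (expTerm B) (suc m)))))
  ... | inj₁ n<1+m = begin
    ∣ (a + t) - b ∣      ≡⟨ cong ∣_∣ (shuffle a t b) ⟩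
    ∣ (a - b) + t ∣      ≤⟨ ∣p+q∣≤∣p∣+∣q∣ (a - b) t ⟩
    ∣ a - b ∣ + ∣ t ∣    ≤⟨ +-mono-≤ (expSum-tail 0≤B h n m (ℕₚ.≤-pred n<1+m)) (∣expTerm∣≤ 0≤B h m) ⟩
    (A - C) + expTerm B m ≡⟨ sym (shuffle A (expTerm B m) C) ⟩
    (A + expTerm B m) - C ∎
    where
    a = partialSum (expTerm q) m
    t = expTerm q m
    b = partialSum (expTerm q) n
    A = partialSum (expTerm B) m
    C = partialSum (expTerm B) n
    shuffle : ∀ a t b → (a + t) - b ≡ (a - b) + t
    shuffle = solve 3 (λ a t b → (a :+ t) :- b := (a :- b) :+ t) refl

  module ExpBound (B : ℕ) where
    β = ι B
    t = expTerm β
    S = partialSum t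
    N₀ = suc (B ℕ.+ B)

    t≥0 : ∀ i → 0ℚ ≤ t i
    t≥0 = expTerm-nonneg (ι-nonneg B)

    up : ∀ n → S n ≤ S (suc n)
    up n = subst (_≤ S (suc n)) (+-identityʳ _) (+-monoʳ-≤ (S n) (t≥0 n))

    -- Beyond i = 2B consecutive terms at least halve.
    halving : ∀ i → B ℕ.+ B ℕ.≤ i → t (suc i) + t (suc i) ≤ t i
    halving i 2B≤i = begin
      t i * (β * r) + t i * (β * r)  ≡⟨ solve 3 (λ t b r → t :* (b :* r) :+ t :* (b :* r) := t :* ((b :+ b) :* r)) refl (t i) β r ⟩
      t i * ((β + β) * r)            ≡⟨ cong (λ z → t i * (z * r)) (sym (ι-+ B B)) ⟩
      t i * (ι (B ℕ.+ B) * r)        ≤⟨ *-monoˡ-≤-nonNeg (t i) {{nonNegative (t≥0 i)}} (*-monoʳ-≤-nonNeg r {{nonNegative (recip-nonneg i)}} (ι-mono (ℕₚ.m≤n⇒m≤1+n 2B≤i))) ⟩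
      t i * (ι (suc i) * r)          ≡⟨ trans (cong (t i *_) (ι-recip i)) (*-identityʳ _) ⟩
      t i                            ∎
      where r = recip i

    -- tail companion: 2 tₙ bounds tₙ + tₙ₊₁ + …
    g : ℕ → ℚ
    g n = t n + t n

    g≥0 : ∀ n → 0ℚ ≤ g n
    g≥0 n = 0≤+ (t≥0 n) (t≥0 n)

    down : ∀ n → N₀ ℕ.≤ n → S (suc n) + g (suc n) ≤ S n + g n
    down n N₀≤n = begin
      S n + t n + g (suc n)   ≤⟨ +-monoʳ-≤ (S n + t n) (halving n (ℕₚ.≤-trans (ℕₚ.n≤1+n _) N₀≤n)) ⟩
      S n + t n + t n         ≡⟨ +-assoc (S n) (t n) (t n) ⟩
      S n + (t n + t n)       ∎

    scaled : ∀ n → N₀ ℕ.≤ n → ι (suc n) * g n ≤ ι (suc N₀) * g N₀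
    scaled n N₀≤n = anti-from-step (λ i → ι (suc i) * g i) N₀ step ℕₚ.≤-refl N₀≤n
      where
      step : ∀ i → N₀ ℕ.≤ i → ι (suc (suc i)) * g (suc i) ≤ ι (suc i) * g i
      step i N₀≤i = begin
        ι (suc (suc i)) * (t (suc i) + t (suc i))       ≤⟨ *-monoˡ-≤-nonNeg (ι (suc (suc i))) {{nonNegative (ι-nonneg (suc (suc i)))}} (halving i (ℕₚ.≤-trans (ℕₚ.n≤1+n _) N₀≤i)) ⟩
        ι (suc (suc i)) * t i                           ≤⟨ *-monoʳ-≤-nonNeg (t i) {{nonNegative (t≥0 i)}} (ι-mono {suc (suc i)} {suc i ℕ.+ suc i} (ℕ.s≤s (ℕₚ.m≤n+m (suc i) i))) ⟩
        ι (suc i ℕ.+ suc i) * t i                       ≡⟨ cong (_* t i) (ι-+ (suc i) (suc i)) ⟩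
        (ι (suc i) + ι (suc i)) * t i                   ≡⟨ solve 2 (λ a b → (a :+ a) :* b := a :* (b :+ b)) refl (ι (suc i)) (t i) ⟩
        ι (suc i) * (t i + t i)                         ∎

    D = ι (suc N₀) * g N₀

    g≤ : ∀ n → N₀ ℕ.≤ n → g n ≤ D * recip n
    g≤ n N₀≤n = begin
      g n                           ≡⟨ sym (trans (cong (g n *_) (ι-recip n)) (*-identityʳ _)) ⟩
      g n * (ι (suc n) * recip n)   ≡⟨ solve 3 (λ a b c → a :* (b :* c) := b :* a :* c) refl (g n) (ι (suc n)) (recip n) ⟩
      ι (suc n) * g n * recip n     ≤⟨ *-monoʳ-≤-nonNeg (recip n) {{nonNegative (recip-nonneg n)}} (scaled n N₀≤n) ⟩
      D * recip n                   ∎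

    open Tail S g N₀ D up down g≥0 g≤ public

  below-natural : (s : ℕ → ℚ) (q : ℚ) → (∀ n → s n ≤ q) → Σ[ K ∈ ℕ ] (∀ n → s n ≤ ι (suc K))
  below-natural s q h = ceil q , λ n → ≤-trans (h n) (≤-trans (q≤ceil q) (ι-mono (ℕₚ.n≤1+n (ceil q))))

  module _ (s : ℕ → ℚ) (cs : Cauchy s) (β : ℚ) (0≤β : 0ℚ ≤ β) (bd : ∀ n → ∣ s n ∣ ≤ β)
    (K : ℕ) (S≤K : ∀ n → partialSum (expTerm β) n ≤ ι (suc K))
    (cS : Cauchy (partialSum (expTerm β))) where

    private
      S E : ℕ → ℚ
      S = partialSum (expTerm β)
      E n = partialSum (expTerm (s n)) n

      estimate : ∀ ε m n → n ℕ.≤ m → ∣ S m - S n ∣ ≤ ε * ½ → ∣ s m - s n ∣ ≤ ε * ½ * recip K →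
        ∣ E m - E n ∣ ≤ ε
      estimate ε m n n≤m h₁ h₂ = begin
        ∣ E m - E n ∣
          ≤⟨ triangle (E m) (partialSum (expTerm (s m)) n) (E n) ⟩
        ∣ E m - partialSum (expTerm (s m)) n ∣ + ∣ partialSum (expTerm (s m)) n - E n ∣
          ≤⟨ +-mono-≤ (expSum-tail 0≤β (bd m) n m n≤m) (expSum-lip 0≤β (bd m) (bd n) n) ⟩
        (S m - S n) + ∣ s m - s n ∣ * S n
          ≤⟨ +-mono-≤ (≤-trans (q≤∣q∣ (S m - S n)) h₁)
               (≤-trans (*-monoˡ-≤-nonNeg ∣ s m - s n ∣ {{∣-∣-nonNeg (s m - s n)}} (S≤K n))
                 (shrink {ε = ε * ½} K h₂)) ⟩
        ε * ½ + ε * ½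
          ≡⟨ half ε ⟩
        ε ∎

    expDiagonal-cauchy : Cauchy (λ n → partialSum (expTerm (s n)) n)
    expDiagonal-cauchy = cauchy-ordered E λ ε 0<ε →
      let (M , h₁) = cS (ε * ½) (half-pos 0<ε)
          (N , h₂) = cs (ε * ½ * recip K) (0<* (half-pos 0<ε) (recip-pos K))
      in M ℕ.⊔ N , λ m n MN≤n n≤m →
        let M≤n = ℕₚ.≤-trans (ℕₚ.m≤m⊔n M N) MN≤n
            N≤n = ℕₚ.≤-trans (ℕₚ.m≤n⊔m M N) MN≤n
        in estimate ε m n n≤m
             (h₁ m n (ℕₚ.≤-trans M≤n n≤m) M≤n) (h₂ m n (ℕₚ.≤-trans N≤n n≤m) N≤n)

  abstract
    exp-cauchy : ∀ s → Cauchy s → Cauchy (λ n → partialSum (expTerm (s n)) n)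
    exp-cauchy s cs =
      let (B , bd)  = cauchy-bounded s cs
          (K , S≤K) = below-natural (partialSum (expTerm (ι B))) _ (ExpBound.bound B)
      in expDiagonal-cauchy s cs (ι B) (ι-nonneg B) bd K S≤K (ExpBound.cauchy B)

open import Data.Fin.Subset using (Subset; ∣_∣)
open import Data.Nat using (NonZero; _/_; _≡ᵇ_)
open RationalLemmas using
  (+-cauchy; neg-cauchy; *-cauchy; log-cauchy; exp-cauchy)

record ℝ : Set where
  constructor mkℝ
  field
    seq    : ℕ → ℚ
    cauchy : Cauchy seq
open ℝ public

infix  4 _≤_ _<_
infixl 6 _+_ _-_
infixl 7 _*_ _/ℕ_
infix  8 -_

_≤_ : ℝ → ℝ → Set
x ≤ y = (ε : ℚ) → 0ℚ ℚ.< ε →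
  Σ[ N ∈ ℕ ] (∀ n → N ℕ.≤ n → seq x n ℚ.≤ seq y n ℚ.+ ε)

_<_ : ℝ → ℝ → Set
x < y = Σ[ ε ∈ ℚ ] (0ℚ ℚ.< ε ×
  Σ[ N ∈ ℕ ] (∀ n → N ℕ.≤ n → seq x n ℚ.+ ε ℚ.≤ seq y n))

fromℚ : ℚ → ℝ
fromℚ q = mkℝ (λ _ → q) λ ε 0<ε → 0 , λ _ _ _ _ →
  subst (ℚ._≤ ε) (sym (cong ℚ.∣_∣ (ℚₚ.+-inverseʳ q))) (ℚₚ.<⇒≤ 0<ε)

fromℕ : ℕ → ℝ
fromℕ n = fromℚ (ι n)

0ℝ 1ℝ : ℝ
0ℝ = fromℚ 0ℚ
1ℝ = fromℚ 1ℚ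

_+_ : ℝ → ℝ → ℝ
x + y = mkℝ (λ n → seq x n ℚ.+ seq y n) (+-cauchy {seq x} {seq y} (cauchy x) (cauchy y))

-_ : ℝ → ℝ
- x = mkℝ (λ n → ℚ.- seq x n) (neg-cauchy {seq x} (cauchy x))

_-_ : ℝ → ℝ → ℝ
x - y = x + (- y)

_*_ : ℝ → ℝ → ℝ
x * y = mkℝ (λ n → seq x n ℚ.* seq y n) (*-cauchy {seq x} {seq y} (cauchy x) (cauchy y))

_/ℕ_ : ℝ → (n : ℕ) → .{{NonZero n}} → ℝ
x /ℕ n = x * fromℚ (ℤ.+ 1 ℚ./ n)

-- The n-th approximant is the n-th Taylor partial sum at the n-th approximant of x.
exp : ℝ → ℝ
exp x = mkℝ (λ n → partialSum (expTerm (seq x n)) n) (exp-cauchy (seq x) (cauchy x))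

-- ln (n+1) = −ln (1 − x) for x = 1 − 1/(n+1), summed by the Mercator series,
-- which converges since 0 ≤ x < 1.  The value ln 0 = 0 is a dummy.
ln : ℕ → ℝ
ln zero    = 0ℝ
ln (suc n) = mkℝ (partialSum (logTerm (1ℚ ℚ.- recip n))) (log-cauchy n)

-- n ^ r for n ≥ 1.
_^ℝ_ : ℕ → ℝ → ℝ
n ^ℝ r = exp (r * ln n)

-- active r: awake, and the current round is round r of the local clock.
data Status : Set where
  asleep : Status
  active : ℕ → Status
  off    : Status

record Round (k : ℕ) : Set where
  constructor mkRound
  field
    activated   : Subset k
    transmitted : Subset k

-- Most recent round first.
History : ℕ → Set
History k = List (Round k)

-- The set of stations to be activated in the next round; only sleeping members matter.
Adversary : ℕ → Set
Adversary k = History k → Subset k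

activate : Bool → Status → Status
activate true asleep = active 0
activate _    s      = s

-- Update at the end of a round; the flags say whether the round's
-- transmission was successful and whether the station transmitted.
endRound : Bool → Bool → Status → Status
endRound success transmits (active r) =
  if success ∧ transmits then off else active (suc r)
endRound _ _ s = s

-- Statuses in the round following the history, before that round's activations.
statuses : ∀ {k} → History k → Vec Status k
statuses {k} []      = replicate k asleep
statuses (mkRound A X ∷ h) =
  zipWith (endRound (∣ X ∣ ≡ᵇ 1)) X (zipWith activate A (statuses h))

-- Local round suc r belongs to the phase j = 3 + ⌊r / b⌋.
transmitProb : (b : ℕ) → .{{NonZero b}} → Status → ℝ
transmitProb b (active (suc r)) = ln (3 ℕ.+ r / b) /ℕ (3 ℕ.+ r / b)
transmitProb b _                = 0ℝ

-- Expectation of f over a random subset containing each i independently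
-- with probability pᵢ.
expectation : ∀ {k} → Vec ℝ k → (Subset k → ℝ) → ℝ
expectation []       f = f []
expectation (p ∷ ps) f =
    p * expectation ps (λ X → f (true ∷ X))
  + (1ℝ - p) * expectation ps (λ X → f (false ∷ X))

module _ (b : ℕ) .{{_ : NonZero b}} {k : ℕ} (adv : Adversary k) where

  -- Expectation of f over the history after n further rounds.
  expectAfter : ℕ → History k → (History k → ℝ) → ℝ
  expectAfter zero    h f = f h
  expectAfter (suc n) h f =
    expectation (map (transmitProb b) (zipWith activate (adv h) (statuses h)))
      (λ X → expectAfter n (mkRound (adv h) X ∷ h) f)

  Pr : ℕ → (History k → Bool) → ℝ
  Pr n D = expectAfter n [] (λ h → if D h then 1ℝ else 0ℝ)

  -- E need not be decidable (it may compare reals).  An event of the finite space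
  -- of n-round histories has probability at least p iff some decidable event
  -- contained in it does.
  PrAtLeast : ℕ → (History k → Set) → ℝ → Set
  PrAtLeast n E p =
    Σ[ D ∈ (History k → Bool) ] ((∀ h → Bool.T (D h) → E h) × (p ≤ Pr n D))

  -- For E inherited by earlier histories, the event that all finite histories of the
  -- infinite execution satisfy E is the decreasing intersection of the n-round
  -- events, so its probability is the infimum of theirs.
  WithProbability : (History k → Set) → ℝ → Set
  WithProbability E p = (n : ℕ) → PrAtLeast n E p

attempts : ∀ {k} → History k → ℕ
attempts []            = 0
attempts (mkRound _ X ∷ h) = ∣ X ∣ ℕ.+ attempts h

{-# OPTIONS --safe #-}

-- All real quantities are compared through their I-th rational approximants for large I, where Pr becomes
-- an iterated expectation over ℚ, and the statement is proved by a supermartingale bound.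
--
-- Fix a horizon T polynomial in k and let p t be the transmission probability at local age t.  For station i, a
-- union bound shows that it succeeds with probability at least p i (1 − Σ_{l ≠ i} p l), so that
-- it fails with probability at most (1 − p i) Π_{l ≠ i} (1 + 2 ε p l) when p i ≤ ε ≤ 1/2.  Hence
-- φ (i) Π_{l ≠ i} ψ (l) is a supermartingale as soon as φ pays the factors 1 − p of the future rounds
-- of i and ψ the factors 1 + 2 ε p of those of a competitor.  Only ages between R and T are used
-- for φ; since p t ≥ 2/(t + 1) there, φ drops to (R/T)² while ψ^k ≤ T, and the chance
-- that some station reaches age T is at most k R²/T.  The numbers of attempts are handled
-- by 2^attempts Π_l θ (l), where θ pays the factors 1 + p: up to age T they multiply to T^{O(b log T)}, which
-- gives O(k log² T) = O(k log² k) attempts.  The adversary never matters because all these bounds hold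
-- for any configuration of ages.
--
-- For the logarithms, the Mercator sum at 1 − 1/n grows by at most 1, and eventually by at least
-- 1/4, when n doubles.
module Submission where

open import Data.Bool using (Bool; true; false; T; if_then_else_)
open import Data.Fin using (Fin; zero; suc)
open import Data.Fin.Subset using (Subset)
import Data.Integer as ℤ
open import Data.List using ([]; _∷_)
open import Data.Nat using (ℕ; zero; suc; NonZero; _≤ᵇ_)
import Data.Nat as ℕ
import Data.Nat.DivMod as ℕₚ
import Data.Nat.Properties as ℕₚ
open import Data.Nat.Tactic.RingSolver using (solve-∀)
open import Data.Product using (Σ-syntax; _×_; _,_; proj₁; proj₂)
open import Data.Rational using (ℚ; 0ℚ; 1ℚ; ½)
import Data.Rational as ℚ
import Data.Rational.Properties as ℚₚ
open import Data.Rational.Solver using (module +-*-Solver)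
open import Data.Sum using (_⊎_; inj₁; inj₂)
import Data.Sum as Sum
open import Data.Unit using (⊤; tt)
open import Data.Vec using (Vec; []; _∷_; map; lookup; replicate; zipWith)
open import Data.Vec.Relation.Unary.All using (All; []; _∷_)
import Data.Vec.Relation.Unary.All as All
open import Data.Vec.Relation.Unary.All.Properties using (lookup⁺)
open import Function using (_∘_)
open import Relation.Binary.PropositionalEquality
  using (_≡_; refl; sym; trans; cong; cong₂; subst)
open import Relation.Nullary using (contradiction)
open import Algebra.Definitions.RawSemiring ℚ.+-*-rawSemiring using (_^_)

open import Defs hiding (_≤_; _<_; _+_; _-_; _*_; -_)

-- Powers of two and the choice of the parameters.

1+n≤2^n : ∀ n → suc n ℕ.≤ 2 ℕ.^ n
1+n≤2^n zero    = ℕₚ.≤-refl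
1+n≤2^n (suc n) = ℕₚ.+-mono-≤ (ℕₚ.m^n>0 2 n) (ℕₚ.≤-trans (1+n≤2^n n) (ℕₚ.≤-reflexive (sym (ℕₚ.+-identityʳ (2 ℕ.^ n)))))

n≤2^n : ∀ n → n ℕ.≤ 2 ℕ.^ n
n≤2^n n = ℕₚ.<⇒≤ (1+n≤2^n n)

binary-length : ∀ n → Σ[ L ∈ ℕ ] (2 ℕ.^ L ℕ.≤ suc n × suc n ℕ.< 2 ℕ.^ suc L)
binary-length zero    = 0 , ℕₚ.≤-refl , ℕₚ.≤-refl
binary-length (suc n) with binary-length n
... | L , lo , hi with ℕₚ.m≤n⇒m<n∨m≡n hi
... | inj₁ lt = L , ℕₚ.m≤n⇒m≤1+n lo , lt
... | inj₂ eq = suc L , ℕₚ.≤-reflexive (sym eq) ,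
  subst (λ z → z ℕ.< 2 ℕ.* 2 ℕ.^ suc L) (sym eq) (ℕₚ.m<m+n (2 ℕ.^ suc L) (ℕₚ.≤-trans (ℕₚ.m^n>0 2 (suc L)) (ℕₚ.m≤m+n _ 0)))

-- For the parameters chosen below, `16 * g` bounds `D / L`, `18 * g * b` bounds `n / L` and
-- `2 * M + 1` bounds `X / L`.
attemptsConstant : ℕ → ℕ → ℕ
attemptsConstant b M = 16 ℕ.* g ℕ.* (18 ℕ.* g ℕ.* b) ℕ.+ (2 ℕ.* M ℕ.+ 1)
  where g = 11 ℕ.+ b ℕ.+ M

-- With s = ⌊log₂ k⌋ + 1, the horizon 2^(8E) for E = (11 + b + M) s exceeds 2^(M s + 1) k R².
module Parameters (b M L k : ℕ) (1≤b : 1 ℕ.≤ b) (1≤k : 1 ℕ.≤ k) (k≤ : k ℕ.≤ 2 ℕ.^ suc L) where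

  open ℕₚ.≤-Reasoning

  -- The horizon is `2 ^ D`. Phase numbers before it are at most `2 ^ V`, so `V` bounds their
  -- logarithms and `n / t` bounds the transmission probability at age `t`. The factor `2 ^ 12` in
  -- `R′` makes the logarithms at least 3 from age `R` on and `R` larger than `4 k n²`. Each half of
  -- the allowed failure probability is `½ ^ X`, and `K` is the threshold for the attempts.
  g s E D V n R′ R X K : ℕ
  g  = 11 ℕ.+ b ℕ.+ M
  s  = suc L
  E  = g ℕ.* s
  D  = 8 ℕ.* E
  V  = 2 ℕ.+ D
  n  = V ℕ.* b
  R′ = 2 ℕ.^ 12 ℕ.* (k ℕ.* (n ℕ.* n))
  R  = suc R′
  X  = suc (M ℕ.* s)
  K  = D ℕ.* n ℕ.* k ℕ.+ X

  V≤ : V ℕ.≤ 2 ℕ.^ (3 ℕ.+ E)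
  V≤ = begin
    2 ℕ.+ 8 ℕ.* E          ≤⟨ ℕₚ.+-monoˡ-≤ (8 ℕ.* E) (ℕₚ.m≤m+n 2 6) ⟩
    8 ℕ.+ 8 ℕ.* E          ≡⟨ sym (ℕₚ.*-suc 8 E) ⟩
    8 ℕ.* suc E            ≤⟨ ℕₚ.*-monoʳ-≤ 8 (1+n≤2^n E) ⟩
    8 ℕ.* 2 ℕ.^ E          ≡⟨ sym (ℕₚ.^-distribˡ-+-* 2 3 E) ⟩
    2 ℕ.^ (3 ℕ.+ E)        ∎

  n≤ : n ℕ.≤ 2 ℕ.^ (3 ℕ.+ E ℕ.+ b)
  n≤ = ℕₚ.≤-trans (ℕₚ.*-mono-≤ V≤ (n≤2^n b)) (ℕₚ.≤-reflexive (sym (ℕₚ.^-distribˡ-+-* 2 (3 ℕ.+ E) b)))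

  1≤n : 1 ℕ.≤ n
  1≤n = ℕₚ.*-mono-≤ {1} {V} {1} (ℕ.s≤s ℕ.z≤n) 1≤b

  N : ℕ
  N = 3 ℕ.+ E ℕ.+ b

  R′≤ : R′ ℕ.≤ 2 ℕ.^ (12 ℕ.+ (s ℕ.+ (N ℕ.+ N)))
  R′≤ = begin
    2 ℕ.^ 12 ℕ.* (k ℕ.* (n ℕ.* n))                            ≤⟨ ℕₚ.*-monoʳ-≤ (2 ℕ.^ 12) (ℕₚ.*-mono-≤ k≤ (ℕₚ.*-mono-≤ n≤ n≤)) ⟩
    2 ℕ.^ 12 ℕ.* (2 ℕ.^ s ℕ.* (2 ℕ.^ N ℕ.* 2 ℕ.^ N))         ≡⟨ cong (λ z → 2 ℕ.^ 12 ℕ.* (2 ℕ.^ s ℕ.* z)) (sym (ℕₚ.^-distribˡ-+-* 2 N N)) ⟩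
    2 ℕ.^ 12 ℕ.* (2 ℕ.^ s ℕ.* 2 ℕ.^ (N ℕ.+ N))               ≡⟨ cong (2 ℕ.^ 12 ℕ.*_) (sym (ℕₚ.^-distribˡ-+-* 2 s (N ℕ.+ N))) ⟩
    2 ℕ.^ 12 ℕ.* 2 ℕ.^ (s ℕ.+ (N ℕ.+ N))                     ≡⟨ sym (ℕₚ.^-distribˡ-+-* 2 12 (s ℕ.+ (N ℕ.+ N))) ⟩
    2 ℕ.^ (12 ℕ.+ (s ℕ.+ (N ℕ.+ N)))                          ∎

  Q Y : ℕ
  Q = 13 ℕ.+ (s ℕ.+ (N ℕ.+ N))
  Y = s ℕ.+ (Q ℕ.+ Q)

  R≤ : R ℕ.≤ 2 ℕ.^ Q
  R≤ = ℕₚ.≤-trans (ℕₚ.+-mono-≤ (ℕₚ.m^n>0 2 (12 ℕ.+ (s ℕ.+ (N ℕ.+ N)))) R′≤)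
    (ℕₚ.≤-reflexive (cong (2 ℕ.^ (12 ℕ.+ (s ℕ.+ (N ℕ.+ N))) ℕ.+_) (sym (ℕₚ.+-identityʳ _))))

  kR²≤ : k ℕ.* (R ℕ.* R) ℕ.≤ 2 ℕ.^ Y
  kR²≤ = ℕₚ.≤-trans (ℕₚ.*-mono-≤ k≤ (ℕₚ.*-mono-≤ R≤ R≤))
    (ℕₚ.≤-reflexive (trans (cong (2 ℕ.^ s ℕ.*_) (sym (ℕₚ.^-distribˡ-+-* 2 Q Q))) (sym (ℕₚ.^-distribˡ-+-* 2 s (Q ℕ.+ Q)))))

  -- The crude bound on `V` makes `Y` grow like `4 * E`; as `D` is `8 * E`, another `4 * E` remains
  -- for `X` and the lower-order terms. The polynomial added in the first step is the exact slack.
  X+Y≤D : X ℕ.+ Y ℕ.≤ D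
  X+Y≤D = begin
    X ℕ.+ Y                                               ≤⟨ ℕₚ.m≤m+n (X ℕ.+ Y) ((41 ℕ.+ 4 ℕ.* b ℕ.+ 3 ℕ.* M) ℕ.* L ℕ.+ (2 ℕ.+ 3 ℕ.* M)) ⟩
    X ℕ.+ Y ℕ.+ ((41 ℕ.+ 4 ℕ.* b ℕ.+ 3 ℕ.* M) ℕ.* L ℕ.+ (2 ℕ.+ 3 ℕ.* M)) ≡⟨ slack M L b ⟩
    D                                                     ∎
    where
    slack : ∀ M L b → let s = suc L; E = (11 ℕ.+ b ℕ.+ M) ℕ.* s; N = 3 ℕ.+ E ℕ.+ b; Q = 13 ℕ.+ (s ℕ.+ (N ℕ.+ N)) in
      suc (M ℕ.* s) ℕ.+ (s ℕ.+ (Q ℕ.+ Q)) ℕ.+ ((41 ℕ.+ 4 ℕ.* b ℕ.+ 3 ℕ.* M) ℕ.* L ℕ.+ (2 ℕ.+ 3 ℕ.* M)) ≡ 8 ℕ.* E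
    slack = solve-∀

  -- Since `1 ≤ L`, constants are absorbed into `L`: `s ≤ 2 * L` makes `D` and `n` linear in `L`, so
  -- their product is quadratic.
  K≤ : 1 ℕ.≤ L → K ℕ.≤ attemptsConstant b M ℕ.* (k ℕ.* (L ℕ.* L))
  K≤ 1≤L = begin
    D ℕ.* n ℕ.* k ℕ.+ X
      ≤⟨ ℕₚ.+-mono-≤ (ℕₚ.*-monoˡ-≤ k (ℕₚ.*-mono-≤ D≤ (ℕₚ.*-monoˡ-≤ b V≤′))) X≤ ⟩
    16 ℕ.* g ℕ.* L ℕ.* (18 ℕ.* g ℕ.* L ℕ.* b) ℕ.* k ℕ.+ (2 ℕ.* M ℕ.+ 1) ℕ.* (k ℕ.* (L ℕ.* L))
      ≡⟨ regroup g L b k (2 ℕ.* M ℕ.+ 1) ⟩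
    attemptsConstant b M ℕ.* (k ℕ.* (L ℕ.* L)) ∎
    where
    regroup : ∀ g L b k m → 16 ℕ.* g ℕ.* L ℕ.* (18 ℕ.* g ℕ.* L ℕ.* b) ℕ.* k ℕ.+ m ℕ.* (k ℕ.* (L ℕ.* L))
      ≡ (16 ℕ.* g ℕ.* (18 ℕ.* g ℕ.* b) ℕ.+ m) ℕ.* (k ℕ.* (L ℕ.* L))
    regroup = solve-∀
    s≤2L : s ℕ.≤ 2 ℕ.* L
    s≤2L = ℕₚ.≤-trans (ℕₚ.+-monoˡ-≤ L 1≤L) (ℕₚ.≤-reflexive (cong (L ℕ.+_) (sym (ℕₚ.+-identityʳ L))))
    D≤ : D ℕ.≤ 16 ℕ.* g ℕ.* L
    D≤ = ℕₚ.≤-trans (ℕₚ.*-monoʳ-≤ 8 (ℕₚ.*-monoʳ-≤ g s≤2L)) (ℕₚ.≤-reflexive (e g L))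
      where
      e : ∀ g L → 8 ℕ.* (g ℕ.* (2 ℕ.* L)) ≡ 16 ℕ.* g ℕ.* L
      e = solve-∀
    V≤′ : V ℕ.≤ 18 ℕ.* g ℕ.* L
    V≤′ = ℕₚ.≤-trans (ℕₚ.+-mono-≤ (ℕₚ.*-monoʳ-≤ 2 (ℕₚ.*-mono-≤ {1} {g} (ℕ.s≤s ℕ.z≤n) 1≤L)) D≤) (ℕₚ.≤-reflexive (e g L))
      where
      e : ∀ g L → 2 ℕ.* (g ℕ.* L) ℕ.+ 16 ℕ.* g ℕ.* L ≡ 18 ℕ.* g ℕ.* L
      e = solve-∀
    X≤ : X ℕ.≤ (2 ℕ.* M ℕ.+ 1) ℕ.* (k ℕ.* (L ℕ.* L))
    X≤ = ℕₚ.≤-trans (ℕₚ.+-mono-≤ 1≤L (ℕₚ.*-monoʳ-≤ M s≤2L))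
      (ℕₚ.≤-trans (ℕₚ.≤-reflexive (e M L))
        (ℕₚ.*-monoʳ-≤ (2 ℕ.* M ℕ.+ 1) (ℕₚ.≤-trans (ℕₚ.≤-reflexive (sym (trans (ℕₚ.*-identityˡ (1 ℕ.* L)) (ℕₚ.*-identityˡ L))))
          (ℕₚ.*-mono-≤ 1≤k (ℕₚ.*-monoˡ-≤ L 1≤L)))))
      where
      e : ∀ M L → L ℕ.+ M ℕ.* (2 ℕ.* L) ≡ (2 ℕ.* M ℕ.+ 1) ℕ.* L
      e = solve-∀

  -- The predecessor of the horizon, so that `recip T′` is the inverse of the horizon.
  T′ : ℕ
  T′ = ℕ.pred (2 ℕ.^ D)

  suc-T′ : suc T′ ≡ 2 ℕ.^ D
  suc-T′ = ℕₚ.suc-pred (2 ℕ.^ D) {{ℕₚ.m^n≢0 2 D}}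

  phase-range : ∀ m → m ℕ.≤ T′ → 3 ℕ.+ m ℕ.≤ 2 ℕ.^ V
  phase-range m m≤T′ = begin
    3 ℕ.+ m                          ≤⟨ ℕₚ.+-monoʳ-≤ 3 m≤T′ ⟩
    2 ℕ.+ suc T′                     ≡⟨ cong (2 ℕ.+_) suc-T′ ⟩
    2 ℕ.+ 2 ℕ.^ D                    ≤⟨ ℕₚ.+-monoˡ-≤ (2 ℕ.^ D) (ℕₚ.≤-trans (ℕₚ.*-monoʳ-≤ 2 (ℕₚ.m^n>0 2 D)) (ℕₚ.m≤m+n (2 ℕ.* 2 ℕ.^ D) (2 ℕ.^ D))) ⟩
    2 ℕ.* 2 ℕ.^ D ℕ.+ 2 ℕ.^ D ℕ.+ 2 ℕ.^ D ≡⟨ e (2 ℕ.^ D) ⟩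
    2 ℕ.* (2 ℕ.* 2 ℕ.^ D)            ∎
    where
    e : ∀ t → 2 ℕ.* t ℕ.+ t ℕ.+ t ≡ 2 ℕ.* (2 ℕ.* t)
    e = solve-∀

  n≤kn² : n ℕ.≤ k ℕ.* (n ℕ.* n)
  n≤kn² = ℕₚ.≤-trans (ℕₚ.≤-reflexive (sym (trans (ℕₚ.*-identityˡ (1 ℕ.* n)) (ℕₚ.*-identityˡ n))))
    (ℕₚ.*-mono-≤ 1≤k (ℕₚ.*-monoˡ-≤ n 1≤n))

  R-large₀ : 2 ℕ.^ 12 ℕ.* b ℕ.≤ R′
  R-large₀ = ℕₚ.*-monoʳ-≤ (2 ℕ.^ 12) (ℕₚ.≤-trans (ℕₚ.m≤n*m b V) n≤kn²)

  R-large₁ : 2 ℕ.* n ℕ.≤ R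
  R-large₁ = ℕₚ.m≤n⇒m≤1+n (ℕₚ.*-mono-≤ {2} {2 ℕ.^ 12} (ℕₚ.m≤m+n 2 4094) n≤kn²)

  R-large₂ : 4 ℕ.* k ℕ.* n ℕ.* n ℕ.≤ R
  R-large₂ = ℕₚ.m≤n⇒m≤1+n (ℕₚ.≤-trans (ℕₚ.≤-reflexive (trans (ℕₚ.*-assoc (4 ℕ.* k) n n) (ℕₚ.*-assoc 4 k (n ℕ.* n))))
    (ℕₚ.*-monoˡ-≤ (k ℕ.* (n ℕ.* n)) (ℕₚ.m≤m+n 4 4092)))

-- Elementary inequalities for rationals, reciprocals and powers.

module Analysis where

  open import Data.Rational using (*≤*; _≤_; _+_; _-_; _*_; -_; ∣_∣; nonNegative)
  open import Data.Rational.Properties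
  open RationalLemmas
  open +-*-Solver using (solve; _:+_; _:*_; _:-_; _:=_; con)
  open ≤-Reasoning

  ≤-by : ∀ {a b} c → 0ℚ ≤ c → a + c ≡ b → a ≤ b
  ≤-by {a} {b} c 0≤c refl = subst (_≤ a + c) (+-identityʳ a) (+-monoʳ-≤ a 0≤c)

  p≤q+p : ∀ {a c} → 0ℚ ≤ c → a ≤ c + a
  p≤q+p {a} {c} 0≤c = ≤-by c 0≤c (+-comm a c)

  ≤⇒0≤- : ∀ {a b} → a ≤ b → 0ℚ ≤ b - a
  ≤⇒0≤- {a} {b} h = subst (_≤ b - a) (+-inverseʳ a) (+-monoˡ-≤ (- a) h)

  *-monoˡ : ∀ {a b} c → 0ℚ ≤ c → a ≤ b → c * a ≤ c * b
  *-monoˡ c 0≤c = *-monoˡ-≤-nonNeg c {{nonNegative 0≤c}}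

  *-monoʳ : ∀ {a b} c → 0ℚ ≤ c → a ≤ b → a * c ≤ b * c
  *-monoʳ c 0≤c = *-monoʳ-≤-nonNeg c {{nonNegative 0≤c}}

  -antimono : ∀ {a b c} → a ≤ b → c - b ≤ c - a
  -antimono {c = c} h = +-monoʳ-≤ c (neg-antimono-≤ h)

  2ℚ : ℚ
  2ℚ = 1ℚ + 1ℚ

  ^-+ : ∀ x m n → x ^ (m ℕ.+ n) ≡ x ^ m * x ^ n
  ^-+ x zero    n = sym (*-identityˡ _)
  ^-+ x (suc m) n = trans (cong (x *_) (^-+ x m n)) (sym (*-assoc x _ _))

  recip-mono : ∀ a c {x y} → a ℕ.* suc y ℕ.≤ c ℕ.* suc x → ι a * recip x ≤ ι c * recip y
  recip-mono a c {x} {y} h = begin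
    ι a * recip x                                    ≡⟨ sym (cancel (ι a * recip x) (ι-recip y)) ⟩
    ι a * recip x * (ι (suc y) * recip y)            ≡⟨ regroup (ι a) (recip x) (ι (suc y)) (recip y) ⟩
    ι a * ι (suc y) * (recip x * recip y)            ≤⟨ *-monoʳ (recip x * recip y) (0≤* (recip-nonneg x) (recip-nonneg y)) h′ ⟩
    ι c * ι (suc x) * (recip x * recip y)            ≡⟨ solve 4 (λ c x r s → c :* x :* (r :* s) := c :* s :* (x :* r)) refl (ι c) (ι (suc x)) (recip x) (recip y) ⟩
    ι c * recip y * (ι (suc x) * recip x)            ≡⟨ cancel (ι c * recip y) (ι-recip x) ⟩
    ι c * recip y                                    ∎
    where
    cancel : ∀ q {z} → z ≡ 1ℚ → q * z ≡ q
    cancel q refl = *-identityʳ q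
    regroup : ∀ a r y s → a * r * (y * s) ≡ a * y * (r * s)
    regroup = solve 4 (λ a r y s → a :* r :* (y :* s) := a :* y :* (r :* s)) refl
    h′ : ι a * ι (suc y) ≤ ι c * ι (suc x)
    h′ = subst₂-≤ (ι-* a (suc y)) (ι-* c (suc x)) (ι-mono h)
      where
      subst₂-≤ : ∀ {p q r s} → p ≡ q → r ≡ s → p ≤ r → q ≤ s
      subst₂-≤ refl refl le = le

  -- The telescoping step: a factor `1 + 1/t` advances the denominator from `t` to `t + 1`. The
  -- drift of `θ` and the bound on `ψ` both rest on it.
  recip-suc : ∀ r → recip r ≡ (1ℚ + recip r) * recip (suc r)
  recip-suc r = sym (trans
    (trans (cong (λ z → (z + recip r) * recip (suc r)) (sym (ι-recip r)))
      (trans (solve 3 (λ n u v → (n :* u :+ u) :* v := u :* ((con 1ℚ :+ n) :* v)) refl (ι (suc r)) (recip r) (recip (suc r)))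
        (cong (λ z → recip r * (z * recip (suc r))) (sym (ι-suc (suc r))))))
    (trans (cong (recip r *_) (ι-recip (suc r))) (*-identityʳ (recip r))))

  ^-* : ∀ x y n → (x * y) ^ n ≡ x ^ n * y ^ n
  ^-* x y zero    = sym (*-identityˡ 1ℚ)
  ^-* x y (suc n) = trans (cong (x * y *_) (^-* x y n))
    (solve 4 (λ x y a b → x :* y :* (a :* b) := x :* a :* (y :* b)) refl x y (x ^ n) (y ^ n))

  ^-mono : ∀ {x y} n → 0ℚ ≤ x → x ≤ y → x ^ n ≤ y ^ n
  ^-mono zero    0≤x h = ≤-refl
  ^-mono {x} (suc n) 0≤x h = *-mono-≤ (≤-trans 0≤x h) (0≤^ x 0≤x n) h (^-mono n 0≤x h)

  1≤^ : ∀ {x} n → 1ℚ ≤ x → 1ℚ ≤ x ^ n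
  1≤^ zero    h = ≤-refl
  1≤^ (suc n) h = *-mono-≤ (≤-trans 0≤1 h) 0≤1 h (1≤^ n h)

  ^-monoʳ : ∀ {x m n} → 1ℚ ≤ x → m ℕ.≤ n → x ^ m ≤ x ^ n
  ^-monoʳ h (ℕ.z≤n {n}) = 1≤^ n h
  ^-monoʳ h (ℕ.s≤s m≤n) = *-monoˡ _ (≤-trans 0≤1 h) (^-monoʳ h m≤n)

  bernoulli : ∀ {x} n → 0ℚ ≤ x → 1ℚ + ι n * x ≤ (1ℚ + x) ^ n
  bernoulli {x} zero    0≤x = ≤-reflexive (trans (cong (1ℚ +_) (*-zeroˡ x)) (+-identityʳ 1ℚ))
  bernoulli {x} (suc n) 0≤x = begin
    1ℚ + ι (suc n) * x        ≤⟨ ≤-by (x * (ι n * x)) (0≤* 0≤x (0≤* (ι-nonneg n) 0≤x))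
      (trans (cong (λ z → 1ℚ + z * x + x * (ι n * x)) (ι-suc n))
        (solve 2 (λ n x → con 1ℚ :+ (con 1ℚ :+ n) :* x :+ x :* (n :* x) := (con 1ℚ :+ x) :* (con 1ℚ :+ n :* x)) refl (ι n) x)) ⟩
    (1ℚ + x) * (1ℚ + ι n * x) ≤⟨ *-monoˡ (1ℚ + x) (0≤+ 0≤1 0≤x) (bernoulli n 0≤x) ⟩
    (1ℚ + x) * (1ℚ + x) ^ n   ∎

  -- The hypothesis keeps `m = 2nx` at most 1, so the cross term `x * m` of the induction step costs
  -- at most one more `x`, which the factor 2 provides.
  reverse-bernoulli : ∀ {x} n → 0ℚ ≤ x → 2ℚ * ι n * x ≤ 1ℚ → (1ℚ + x) ^ n ≤ 1ℚ + 2ℚ * ι n * x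
  reverse-bernoulli {x} zero 0≤x h = ≤-reflexive (sym (trans (cong (λ z → 1ℚ + z) (*-zeroˡ x)) (+-identityʳ 1ℚ)))
  reverse-bernoulli {x} (suc n) 0≤x h = begin
    (1ℚ + x) * (1ℚ + x) ^ n            ≤⟨ *-monoˡ (1ℚ + x) (0≤+ 0≤1 0≤x) (reverse-bernoulli n 0≤x h′) ⟩
    (1ℚ + x) * (1ℚ + m)                ≡⟨ solve 2 (λ x m → (con 1ℚ :+ x) :* (con 1ℚ :+ m) := con 1ℚ :+ x :+ m :+ x :* m) refl x m ⟩
    1ℚ + x + m + x * m                 ≤⟨ +-monoʳ-≤ (1ℚ + x + m) (*-monoˡ x 0≤x h′) ⟩
    1ℚ + x + m + x * 1ℚ                ≡⟨ trans (solve 2 (λ x n → con 1ℚ :+ x :+ con 2ℚ :* n :* x :+ x :* con 1ℚ := con 1ℚ :+ con 2ℚ :* (con 1ℚ :+ n) :* x) refl x (ι n))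
                                            (cong (λ z → 1ℚ + 2ℚ * z * x) (sym (ι-suc n))) ⟩
    1ℚ + 2ℚ * ι (suc n) * x            ∎
    where
    m = 2ℚ * ι n * x
    h′ : m ≤ 1ℚ
    h′ = ≤-trans (*-monoʳ x 0≤x (*-monoˡ 2ℚ (nonNegative⁻¹ 2ℚ) (ι-mono (ℕₚ.n≤1+n n)))) h

  -- Mercator sums and approximate logarithms.

  mercator : ℚ → ℕ → ℚ
  mercator x = partialSum (logTerm x)

  mercator-nonneg : ∀ {x} → 0ℚ ≤ x → ∀ I → 0ℚ ≤ mercator x I
  mercator-nonneg 0≤x zero    = ≤-refl
  mercator-nonneg {x} 0≤x (suc I) = 0≤+ (mercator-nonneg 0≤x I) (0≤* (0≤^ x 0≤x (suc I)) (recip-nonneg I))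

  mercator-mono : ∀ {x x′} → 0ℚ ≤ x → x ≤ x′ → ∀ I → mercator x I ≤ mercator x′ I
  mercator-mono 0≤x h zero    = ≤-refl
  mercator-mono 0≤x h (suc I) = +-mono-≤ (mercator-mono 0≤x h I)
    (*-monoʳ (recip I) (recip-nonneg I) (^-mono (suc I) 0≤x h))

  geometric : ∀ x I → (1ℚ - x) * partialSum (x ^_) I ≡ 1ℚ - x ^ I
  geometric x zero    = solve 1 (λ x → (con 1ℚ :- x) :* con 0ℚ := con 1ℚ :- con 1ℚ) refl x
  geometric x (suc I) = trans (*-distribˡ-+ (1ℚ - x) (partialSum (x ^_) I) (x ^ I))
    (trans (cong (_+ (1ℚ - x) * x ^ I) (geometric x I))
      (solve 2 (λ x y → con 1ℚ :- y :+ (con 1ℚ :- x) :* y := con 1ℚ :- x :* y) refl x (x ^ I)))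

  module _ {x h : ℚ} (0≤x : 0ℚ ≤ x) (0≤h : 0ℚ ≤ h) where

    private
      0≤x+h : 0ℚ ≤ x + h
      0≤x+h = 0≤+ 0≤x 0≤h

    -- Convexity of the power function: the increment over an interval of length `h` is at most `h`
    -- times the derivative at the right end. The lower companion uses the left end.
    ^-tangent-upper : ∀ i → (x + h) ^ suc i ≤ x ^ suc i + ι (suc i) * (h * (x + h) ^ i)
    ^-tangent-upper zero = ≤-reflexive (solve 2 (λ x h → (x :+ h) :* con 1ℚ := x :* con 1ℚ :+ con 1ℚ :* (h :* con 1ℚ)) refl x h)
    ^-tangent-upper (suc i) = begin
      (x + h) * (x + h) ^ suc i
        ≡⟨ *-distribʳ-+ ((x + h) ^ suc i) x h ⟩
      x * (x + h) ^ suc i + h * Y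
        ≤⟨ +-monoˡ-≤ (h * Y) (*-monoˡ x 0≤x (^-tangent-upper i)) ⟩
      x * (x ^ suc i + ι (suc i) * (h * (x + h) ^ i)) + h * Y
        ≤⟨ ≤-by (h * (ι (suc i) * (h * (x + h) ^ i))) (0≤* 0≤h (0≤* (ι-nonneg (suc i)) (0≤* 0≤h (0≤^ (x + h) 0≤x+h i))))
             (solve 5 (λ x h a n y → x :* (a :+ n :* (h :* y)) :+ h :* ((x :+ h) :* y) :+ h :* (n :* (h :* y))
               := x :* a :+ (con 1ℚ :+ n) :* (h :* ((x :+ h) :* y))) refl x h (x ^ suc i) (ι (suc i)) ((x + h) ^ i)) ⟩
      x * x ^ suc i + (1ℚ + ι (suc i)) * (h * Y)
        ≡⟨ cong (λ z → x * x ^ suc i + z * (h * Y)) (sym (ι-suc (suc i))) ⟩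
      x * x ^ suc i + ι (suc (suc i)) * (h * Y) ∎
      where Y = (x + h) ^ suc i

    ^-tangent-lower : ∀ i → x ^ suc i + ι (suc i) * (h * x ^ i) ≤ (x + h) ^ suc i
    ^-tangent-lower zero = ≤-reflexive (solve 2 (λ x h → x :* con 1ℚ :+ con 1ℚ :* (h :* con 1ℚ) := (x :+ h) :* con 1ℚ) refl x h)
    ^-tangent-lower (suc i) = begin
      x * X + ι (suc (suc i)) * (h * X)
        ≡⟨ cong (λ z → x * X + z * (h * X)) (ι-suc (suc i)) ⟩
      x * X + (1ℚ + ι (suc i)) * (h * X)
        ≤⟨ ≤-by (h * (ι (suc i) * (h * x ^ i))) (0≤* 0≤h (0≤* (ι-nonneg (suc i)) (0≤* 0≤h (0≤^ x 0≤x i))))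
             (solve 4 (λ x h n y → x :* (x :* y) :+ (con 1ℚ :+ n) :* (h :* (x :* y)) :+ h :* (n :* (h :* y))
               := (x :+ h) :* (x :* y :+ n :* (h :* y))) refl x h (ι (suc i)) (x ^ i)) ⟩
      (x + h) * (X + ι (suc i) * (h * x ^ i))
        ≤⟨ *-monoˡ (x + h) 0≤x+h (^-tangent-lower i) ⟩
      (x + h) * (x + h) ^ suc i ∎
      where X = x ^ suc i

    private
      divide : ∀ i y → ι (suc i) * y * recip i ≡ y
      divide i y = trans (solve 3 (λ n y r → n :* y :* r := y :* (n :* r)) refl (ι (suc i)) y (recip i))
        (trans (cong (y *_) (ι-recip i)) (*-identityʳ y))

    -- The derivative of a Mercator sum is a geometric sum: in the tangent bound of each term the
    -- exponent cancels against `recip I`.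
    mercator-upper : ∀ I → mercator (x + h) I ≤ mercator x I + h * partialSum ((x + h) ^_) I
    mercator-upper zero = ≤-reflexive (sym (trans (+-identityˡ (h * 0ℚ)) (*-zeroʳ h)))
    mercator-upper (suc I) = begin
      mercator (x + h) I + (x + h) ^ suc I * recip I
        ≤⟨ +-mono-≤ (mercator-upper I) (*-monoʳ (recip I) (recip-nonneg I) (^-tangent-upper I)) ⟩
      M + h * G + (x ^ suc I + ι (suc I) * (h * Y)) * recip I
        ≡⟨ cong (M + h * G +_) (trans (*-distribʳ-+ (recip I) (x ^ suc I) _) (cong (x ^ suc I * recip I +_) (divide I (h * Y)))) ⟩
      M + h * G + (x ^ suc I * recip I + h * Y)
        ≡⟨ solve 5 (λ m h g t y → m :+ h :* g :+ (t :+ h :* y) := m :+ t :+ h :* (g :+ y)) refl M h G (x ^ suc I * recip I) Y ⟩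
      M + x ^ suc I * recip I + h * (G + Y) ∎
      where
      M = mercator x I
      G = partialSum ((x + h) ^_) I
      Y = (x + h) ^ I

    mercator-lower : ∀ I → mercator x I + h * partialSum (x ^_) I ≤ mercator (x + h) I
    mercator-lower zero = ≤-reflexive (trans (+-identityˡ (h * 0ℚ)) (*-zeroʳ h))
    mercator-lower (suc I) = begin
      M + x ^ suc I * recip I + h * (G + Y)
        ≡⟨ solve 5 (λ m h g t y → m :+ t :+ h :* (g :+ y) := m :+ h :* g :+ (t :+ h :* y)) refl M h G (x ^ suc I * recip I) Y ⟩
      M + h * G + (x ^ suc I * recip I + h * Y)
        ≡⟨ cong (M + h * G +_) (sym (trans (*-distribʳ-+ (recip I) (x ^ suc I) _) (cong (x ^ suc I * recip I +_) (divide I (h * Y))))) ⟩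
      M + h * G + (x ^ suc I + ι (suc I) * (h * Y)) * recip I
        ≤⟨ +-mono-≤ (mercator-lower I) (*-monoʳ (recip I) (recip-nonneg I) (^-tangent-lower I)) ⟩
      mercator (x + h) I + (x + h) ^ suc I * recip I ∎
      where
      M = mercator x I
      G = partialSum (x ^_) I
      Y = x ^ I

  0≤½ : 0ℚ ≤ ½
  0≤½ = nonNegative⁻¹ ½

  0≤½^ : ∀ n → 0ℚ ≤ ½ ^ n
  0≤½^ = 0≤^ ½ 0≤½

  ½^≤1 : ∀ n → ½ ^ n ≤ 1ℚ
  ½^≤1 = ^≤1 ½ 0≤½ (≤-by ½ 0≤½ refl)

  ½^-2^ : ∀ n → ½ ^ n * ι (2 ℕ.^ n) ≡ 1ℚ
  ½^-2^ zero    = refl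
  ½^-2^ (suc n) = trans (cong (½ * ½ ^ n *_) (ι-* 2 (2 ℕ.^ n)))
    (trans (solve 2 (λ a b → con ½ :* a :* (con (ι 2) :* b) := a :* b) refl (½ ^ n) (ι (2 ℕ.^ n))) (½^-2^ n))

  ½^≤recip : ∀ {m} D → suc m ℕ.≤ 2 ℕ.^ D → ½ ^ D ≤ recip m
  ½^≤recip {m} D h = begin
    ½ ^ D                             ≡⟨ sym (trans (cong (½ ^ D *_) (ι-recip m)) (*-identityʳ (½ ^ D))) ⟩
    ½ ^ D * (ι (suc m) * recip m)     ≡⟨ sym (*-assoc (½ ^ D) (ι (suc m)) (recip m)) ⟩
    ½ ^ D * ι (suc m) * recip m       ≤⟨ *-monoʳ (recip m) (recip-nonneg m) (*-monoˡ (½ ^ D) (0≤½^ D) (ι-mono h)) ⟩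
    ½ ^ D * ι (2 ℕ.^ D) * recip m     ≡⟨ trans (cong (_* recip m) (½^-2^ D)) (*-identityˡ (recip m)) ⟩
    recip m                           ∎

  recip≤½^ : ∀ {m} D → 2 ℕ.^ D ℕ.≤ suc m → recip m ≤ ½ ^ D
  recip≤½^ {m} D h = begin
    recip m                           ≡⟨ sym (trans (cong (_* recip m) (½^-2^ D)) (*-identityˡ (recip m))) ⟩
    ½ ^ D * ι (2 ℕ.^ D) * recip m     ≤⟨ *-monoʳ (recip m) (recip-nonneg m) (*-monoˡ (½ ^ D) (0≤½^ D) (ι-mono h)) ⟩
    ½ ^ D * ι (suc m) * recip m       ≡⟨ *-assoc (½ ^ D) (ι (suc m)) (recip m) ⟩
    ½ ^ D * (ι (suc m) * recip m)     ≡⟨ trans (cong (½ ^ D *_) (ι-recip m)) (*-identityʳ (½ ^ D)) ⟩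
    ½ ^ D                             ∎

  mercator-0 : ∀ I → mercator 0ℚ I ≡ 0ℚ
  mercator-0 zero    = refl
  mercator-0 (suc I) = trans (cong₂ _+_ (mercator-0 I) (trans (cong (_* recip I) (*-zeroˡ (0ℚ ^ I))) (*-zeroˡ (recip I)))) refl

  halve : ∀ D → 1ℚ - ½ ^ suc D ≡ 1ℚ - ½ ^ D + ½ ^ suc D
  halve D = solve 1 (λ a → con 1ℚ :- con ½ :* a := con 1ℚ :- a :+ con ½ :* a) refl (½ ^ D)

  -- One doubling adds at most `h * G`. As `h` is exactly `1 - (x + h)`, the geometric sum collapses
  -- to `1 - (x + h) ^ I`, which is at most 1.
  mercator-½^-upper : ∀ D I → mercator (1ℚ - ½ ^ D) I ≤ ι D
  mercator-½^-upper zero    I = ≤-reflexive (mercator-0 I)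
  mercator-½^-upper (suc D) I = begin
    mercator (1ℚ - h) I                      ≡⟨ cong (λ z → mercator z I) (halve D) ⟩
    mercator (x + h) I                       ≤⟨ mercator-upper (≤⇒0≤- (½^≤1 D)) (0≤½^ (suc D)) I ⟩
    mercator x I + h * G                     ≡⟨ cong (mercator x I +_) (trans (cong (_* G) (trans h≡ (cong (λ z → 1ℚ - z) (halve D)))) (geometric (x + h) I)) ⟩
    mercator x I + (1ℚ - (x + h) ^ I)        ≤⟨ +-mono-≤ (mercator-½^-upper D I)
                                                 (≤-by ((x + h) ^ I) (0≤^ (x + h) (subst (0ℚ ≤_) (halve D) (≤⇒0≤- (½^≤1 (suc D)))) I)
                                                   (solve 1 (λ y → con 1ℚ :- y :+ y := con 1ℚ) refl ((x + h) ^ I))) ⟩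
    ι D + 1ℚ                                 ≡⟨ trans (+-comm (ι D) 1ℚ) (sym (ι-suc D)) ⟩
    ι (suc D)                                ∎
    where
    x = 1ℚ - ½ ^ D
    h = ½ ^ suc D
    G = partialSum ((x + h) ^_) I
    h≡ : h ≡ 1ℚ - (1ℚ - h)
    h≡ = solve 1 (λ h → h := con 1ℚ :- (con 1ℚ :- h)) refl h

  -- The product of `(1 - d) ^ I` and `(1 + d) ^ I` is at most 1, and Bernoulli makes the second
  -- factor at least 2 once `I` reaches `1/d`.
  1-½^-power : ∀ D {I} → 2 ℕ.^ D ℕ.≤ I → (1ℚ - ½ ^ D) ^ I ≤ ½
  1-½^-power D {I} h = begin
    z                        ≡⟨ solve 1 (λ z → z := con ½ :* (z :* con 2ℚ)) refl z ⟩
    ½ * (z * 2ℚ)             ≤⟨ *-monoˡ ½ 0≤½ (*-monoˡ z 0≤z 2≤) ⟩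
    ½ * (z * (1ℚ + d) ^ I)   ≡⟨ cong (½ *_) (sym (^-* (1ℚ - d) (1ℚ + d) I)) ⟩
    ½ * ((1ℚ - d) * (1ℚ + d)) ^ I
      ≤⟨ *-monoˡ ½ 0≤½ (^≤1 _ (0≤* (≤⇒0≤- (½^≤1 D)) (0≤+ 0≤1 (0≤½^ D)))
           (≤-by (d * d) (0≤* (0≤½^ D) (0≤½^ D)) (solve 1 (λ d → (con 1ℚ :- d) :* (con 1ℚ :+ d) :+ d :* d := con 1ℚ) refl d)) I) ⟩
    ½ * 1ℚ                   ≡⟨ *-identityʳ ½ ⟩
    ½                        ∎
    where
    d = ½ ^ D
    z = (1ℚ - d) ^ I
    0≤z : 0ℚ ≤ z
    0≤z = 0≤^ (1ℚ - d) (≤⇒0≤- (½^≤1 D)) I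
    2≤ : 2ℚ ≤ (1ℚ + d) ^ I
    2≤ = ≤-trans (+-monoʳ-≤ 1ℚ (≤-trans (≤-reflexive (sym (trans (*-comm _ d) (½^-2^ D))))
      (*-monoʳ d (0≤½^ D) (ι-mono h)))) (bernoulli I (0≤½^ D))

  -- Here `h` is half of `1 - x`, so one doubling adds at least `½ * (1 - x ^ I)`. This is at least
  -- 1/4 because `x ^ I` has fallen to ½.
  mercator-½^-lower : ∀ L {I} → 2 ℕ.^ L ℕ.≤ I → ι L ≤ ι 4 * mercator (1ℚ - ½ ^ L) I
  mercator-½^-lower zero    {I} _ = ≤-reflexive (sym (trans (cong (ι 4 *_) (mercator-0 I)) (*-zeroʳ (ι 4))))
  mercator-½^-lower (suc L) {I} h′ = begin
    ι (suc L)                                     ≡⟨ trans (ι-suc L) (+-comm 1ℚ (ι L)) ⟩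
    ι L + 1ℚ                                      ≤⟨ +-mono-≤ (mercator-½^-lower L 2^L≤I) (*-monoˡ (ι 4 * ½) (nonNegative⁻¹ (ι 4 * ½)) (-antimono {c = 1ℚ} (1-½^-power L 2^L≤I))) ⟩
    ι 4 * M + ι 4 * ½ * (1ℚ - x ^ I)              ≡⟨ cong (λ z → ι 4 * M + ι 4 * ½ * z) (sym (geometric x I)) ⟩
    ι 4 * M + ι 4 * ½ * ((1ℚ - x) * G)            ≡⟨ solve 3 (λ m d g → con (ι 4) :* m :+ con (ι 4) :* con ½ :* ((con 1ℚ :- (con 1ℚ :- d)) :* g)
                                                       := con (ι 4) :* (m :+ con ½ :* d :* g)) refl M (½ ^ L) G ⟩
    ι 4 * (M + h * G)                             ≤⟨ *-monoˡ (ι 4) (ι-nonneg 4) (mercator-lower (≤⇒0≤- (½^≤1 L)) (0≤½^ (suc L)) I) ⟩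
    ι 4 * mercator (x + h) I                      ≡⟨ cong (λ z → ι 4 * mercator z I) (sym (halve L)) ⟩
    ι 4 * mercator (1ℚ - h) I                     ∎
    where
    2^L≤I : 2 ℕ.^ L ℕ.≤ I
    2^L≤I = ℕₚ.≤-trans (ℕₚ.^-monoʳ-≤ 2 (ℕₚ.n≤1+n L)) h′
    x = 1ℚ - ½ ^ L
    h = ½ ^ suc L
    M = mercator x I
    G = partialSum (x ^_) I

  -- The `I`-th approximant of `ln (suc m)`; the argument is shifted by one.
  lnApprox : ℕ → ℕ → ℚ
  lnApprox I m = mercator (1ℚ - recip m) I

  lnApprox-nonneg : ∀ I m → 0ℚ ≤ lnApprox I m
  lnApprox-nonneg I m = mercator-nonneg (≤⇒0≤- (recip≤1 m)) I

  lnApprox-upper : ∀ I {m} D → suc m ℕ.≤ 2 ℕ.^ D → lnApprox I m ≤ ι D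
  lnApprox-upper I {m} D h = ≤-trans
    (mercator-mono (≤⇒0≤- (recip≤1 m)) (-antimono {c = 1ℚ} (½^≤recip D h)) I) (mercator-½^-upper D I)

  lnApprox-lower : ∀ {I m} L → 2 ℕ.^ L ℕ.≤ suc m → 2 ℕ.^ L ℕ.≤ I → ι L ≤ ι 4 * lnApprox I m
  lnApprox-lower {I} L h h′ = ≤-trans (mercator-½^-lower L h′)
    (*-monoˡ (ι 4) (ι-nonneg 4) (mercator-mono (≤⇒0≤- (½^≤1 L)) (-antimono {c = 1ℚ} (recip≤½^ L h)) I))

  -- Cauchy products and exponential sums.

  -- The Cauchy product coefficient Σ_{i ≤ n} aᵢ b_{n-i}.
  convolve : (ℕ → ℚ) → (ℕ → ℚ) → ℕ → ℚ
  convolve a b zero    = a 0 * b 0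
  convolve a b (suc n) = a 0 * b (suc n) + convolve (a ∘ suc) b n

  -- Σ_{i < n} aᵢ · B (n − i)
  triangle-sum : (ℕ → ℚ) → (ℕ → ℚ) → ℕ → ℚ
  triangle-sum a B zero    = 0ℚ
  triangle-sum a B (suc n) = a 0 * B (suc n) + triangle-sum (a ∘ suc) B n

  -- With partial sums of `b` as second argument, the triangle sum runs over `aᵢ bⱼ` with
  -- `i + j < n`; enlarging `n` adds the antidiagonal `i + j = n`.
  triangle-sum-step : ∀ a b n →
    triangle-sum a (partialSum b) (suc n) ≡ triangle-sum a (partialSum b) n + convolve a b n
  triangle-sum-step a b zero    = solve 2 (λ a b → a :* (con 0ℚ :+ b) :+ con 0ℚ := con 0ℚ :+ a :* b) refl (a 0) (b 0)
  triangle-sum-step a b (suc n) = trans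
    (cong (a 0 * (partialSum b (suc n) + b (suc n)) +_) (triangle-sum-step (a ∘ suc) b n))
    (solve 5 (λ a B b t c → a :* (B :+ b) :+ (t :+ c) := a :* B :+ t :+ (a :* b :+ c)) refl
      (a 0) (partialSum b (suc n)) (b (suc n)) (triangle-sum (a ∘ suc) (partialSum b) n) (convolve (a ∘ suc) b n))

  partialSum-shift : ∀ a n → partialSum a (suc n) ≡ a 0 + partialSum (a ∘ suc) n
  partialSum-shift a zero    = +-comm 0ℚ (a 0)
  partialSum-shift a (suc n) = trans (cong (_+ a (suc n)) (partialSum-shift a n)) (+-assoc (a 0) _ (a (suc n)))

  convolve-cong : ∀ {a a′ : ℕ → ℚ} b → (∀ i → a i ≡ a′ i) → ∀ n → convolve a b n ≡ convolve a′ b n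
  convolve-cong b h zero    = cong (_* b 0) (h 0)
  convolve-cong b h (suc n) = cong₂ _+_ (cong (_* b (suc n)) (h 0)) (convolve-cong b (h ∘ suc) n)

  module _ (x y : ℚ) where

    private
      -- The shift by `s` generalises the induction, because `convolve` recurses on a sequence
      -- stripped of its first entry.
      from : ℕ → ℕ → ℚ
      from s i = expTerm x (i ℕ.+ s)

      b : ℕ → ℚ
      b = expTerm y

    -- Both sides are Σᵢ (s + m + 1) a_{s+i} b_{m+1−i}, where on the right s + m + 1 has been split as
    -- (s + i) + (m + 1 − i) and the recurrences of a and b have been applied.
    convolve-exp-step : ∀ s m → ι (suc m ℕ.+ s) * convolve (from s) b (suc m)
      ≡ ι s * (expTerm x s * b (suc m)) + (x + y) * convolve (from s) b m
    convolve-exp-step s zero = trans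
      (cong₂ (λ u v → u * (expTerm x s * (b 0 * (y * 1ℚ)) + expTerm x s * v * b 0)) (ι-suc s) refl)
      (trans (solve 6 (λ n a b x y r → (con 1ℚ :+ n) :* (a :* (b :* (y :* con 1ℚ)) :+ a :* (x :* r) :* b)
          := n :* (a :* (b :* (y :* con 1ℚ))) :+ y :* (a :* b) :+ (con 1ℚ :+ n) :* r :* (x :* (a :* b)))
        refl (ι s) (expTerm x s) (b 0) x y (recip s))
      (trans (cong (λ z → ι s * (expTerm x s * b 1) + y * (expTerm x s * b 0) + z * (x * (expTerm x s * b 0)))
          (trans (cong (_* recip s) (sym (ι-suc s))) (ι-recip s)))
        (solve 5 (λ c a b x y → c :+ y :* (a :* b) :+ con 1ℚ :* (x :* (a :* b)) := c :+ (x :+ y) :* (a :* b))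
          refl (ι s * (expTerm x s * b 1)) (expTerm x s) (b 0) x y)))
    convolve-exp-step s (suc m) = begin-equality
      ι (2 ℕ.+ m ℕ.+ s) * (aₛ * b (2 ℕ.+ m) + W (suc m))
        ≡⟨ *-distribˡ-+ (ι (2 ℕ.+ m ℕ.+ s)) (aₛ * b (2 ℕ.+ m)) (W (suc m)) ⟩
      ι (2 ℕ.+ m ℕ.+ s) * (aₛ * b (2 ℕ.+ m)) + ι (2 ℕ.+ m ℕ.+ s) * W (suc m)
        ≡⟨ cong₂ _+_ first second ⟩
      ι s * (aₛ * b (2 ℕ.+ m)) + y * (aₛ * b (suc m)) + (x * (aₛ * b (suc m)) + (x + y) * W m)
        ≡⟨ solve 5 (λ c u x y w → c :+ y :* u :+ (x :* u :+ (x :+ y) :* w) := c :+ (x :+ y) :* (u :+ w)) refl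
             (ι s * (aₛ * b (2 ℕ.+ m))) (aₛ * b (suc m)) x y (W m) ⟩
      ι s * (aₛ * b (2 ℕ.+ m)) + (x + y) * (aₛ * b (suc m) + W m) ∎
      where
      aₛ = expTerm x s
      W = convolve (from s ∘ suc) b
      W≡ : ∀ n → W n ≡ convolve (from (suc s)) b n
      W≡ = convolve-cong b (λ i → cong (expTerm x) (sym (ℕₚ.+-suc i s)))
      first : ι (2 ℕ.+ m ℕ.+ s) * (aₛ * b (2 ℕ.+ m)) ≡ ι s * (aₛ * b (2 ℕ.+ m)) + y * (aₛ * b (suc m))
      first = trans (cong (_* (aₛ * b (2 ℕ.+ m))) (ι-+ (2 ℕ.+ m) s))
        (trans (solve 4 (λ n s a b → (n :+ s) :* (a :* b) := s :* (a :* b) :+ a :* (n :* b)) refl (ι (2 ℕ.+ m)) (ι s) aₛ (b (2 ℕ.+ m)))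
        (trans (cong (λ z → ι s * (aₛ * b (2 ℕ.+ m)) + aₛ * z) (expTerm-step y (suc m)))
          (cong (ι s * (aₛ * b (2 ℕ.+ m)) +_) (solve 3 (λ a b y → a :* (b :* y) := y :* (a :* b)) refl aₛ (b (suc m)) y))))
      second : ι (2 ℕ.+ m ℕ.+ s) * W (suc m) ≡ x * (aₛ * b (suc m)) + (x + y) * W m
      second = trans (cong₂ (λ u v → ι u * v) (sym (ℕₚ.+-suc (suc m) s)) (W≡ (suc m)))
        (trans (convolve-exp-step (suc s) m)
          (cong₂ _+_
            (trans (sym (*-assoc (ι (suc s)) (expTerm x (suc s)) (b (suc m))))
              (trans (cong (_* b (suc m)) (expTerm-step x s))
                (solve 3 (λ a b x → a :* x :* b := x :* (a :* b)) refl aₛ (b (suc m)) x)))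
            (cong ((x + y) *_) (sym (W≡ m)))))

    -- The binomial theorem. At `s = 0` the boundary term of `convolve-exp-step` vanishes, and what
    -- remains is the recurrence defining `expTerm (x + y)`.
    convolve-exp : ∀ m → convolve (expTerm x) b m ≡ expTerm (x + y) m
    convolve-exp m = trans (convolve-cong b (λ i → cong (expTerm x) (sym (ℕₚ.+-identityʳ i))) m) (go m)
      where
      go : ∀ m → convolve (from 0) b m ≡ expTerm (x + y) m
      go zero    = refl
      go (suc m) = begin-equality
        w                                            ≡⟨ sym (trans (cong (_* w) (trans (*-comm (recip m) (ι (suc m))) (ι-recip m))) (*-identityˡ w)) ⟩
        recip m * ι (suc m) * w                      ≡⟨ *-assoc (recip m) (ι (suc m)) w ⟩
        recip m * (ι (suc m) * w)                    ≡⟨ cong (recip m *_) (trans (cong (λ z → ι z * w) (sym (ℕₚ.+-identityʳ (suc m)))) (convolve-exp-step 0 m)) ⟩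
        recip m * (0ℚ * (1ℚ * b (suc m)) + (x + y) * convolve (from 0) b m)
          ≡⟨ cong (λ z → recip m * (0ℚ * (1ℚ * b (suc m)) + (x + y) * z)) (go m) ⟩
        recip m * (0ℚ * (1ℚ * b (suc m)) + (x + y) * expTerm (x + y) m)
          ≡⟨ solve 4 (λ r c z e → r :* (con 0ℚ :* c :+ z :* e) := e :* (z :* r)) refl (recip m) (1ℚ * b (suc m)) (x + y) (expTerm (x + y) m) ⟩
        expTerm (x + y) (suc m)                      ∎
        where w = convolve (from 0) b (suc m)

  expSum : ℚ → ℕ → ℚ
  expSum x = partialSum (expTerm x)

  triangle-sum-exp : ∀ x y n → triangle-sum (expTerm x) (expSum y) n ≡ expSum (x + y) n
  triangle-sum-exp x y zero    = refl
  triangle-sum-exp x y (suc n) = trans (triangle-sum-step (expTerm x) (expTerm y) n)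
    (cong₂ _+_ (triangle-sum-exp x y n) (convolve-exp x y n))

  -- For nonnegative terms, the triangle `i + j < n` lies inside the square `i, j < n`.
  triangle≤square : ∀ {a B : ℕ → ℚ} {β} n → (∀ i → 0ℚ ≤ a i) → (∀ i → i ℕ.≤ n → B i ≤ β) →
    triangle-sum a B n ≤ partialSum a n * β
  triangle≤square {β = β} zero 0≤a h = ≤-reflexive (sym (*-zeroˡ β))
  triangle≤square {a} {β = β} (suc n) 0≤a h = ≤-trans
    (+-mono-≤ (*-monoˡ (a 0) (0≤a 0) (h (suc n) ℕₚ.≤-refl))
      (triangle≤square n (0≤a ∘ suc) (λ i i≤n → h i (ℕₚ.m≤n⇒m≤1+n i≤n))))
    (≤-reflexive (trans (sym (*-distribʳ-+ β (a 0) _)) (cong (_* β) (sym (partialSum-shift a n)))))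

  -- Conversely, `i < n` and `j < m` force `i + j < n + m`, so the rectangle lies inside a larger
  -- triangle.
  square≤triangle : ∀ {a B : ℕ → ℚ} {β} n m → (∀ i → 0ℚ ≤ a i) → (∀ i → 0ℚ ≤ B i) →
    (∀ i → m ℕ.≤ i → β ≤ B i) → partialSum a n * β ≤ triangle-sum a B (n ℕ.+ m)
  square≤triangle {a} {B} {β} zero m 0≤a 0≤B h = ≤-trans (≤-reflexive (*-zeroˡ β)) (nonneg m 0≤a)
    where
    nonneg : ∀ {a : ℕ → ℚ} m → (∀ i → 0ℚ ≤ a i) → 0ℚ ≤ triangle-sum a B m
    nonneg zero    0≤a = ≤-refl
    nonneg (suc m) 0≤a = 0≤+ (0≤* (0≤a 0) (0≤B (suc m))) (nonneg m (0≤a ∘ suc))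
  square≤triangle {a} {β = β} (suc n) m 0≤a 0≤B h = ≤-trans
    (≤-reflexive (trans (cong (_* β) (partialSum-shift a n)) (*-distribʳ-+ β (a 0) _)))
    (+-mono-≤ (*-monoˡ (a 0) (0≤a 0) (h (suc n ℕ.+ m) (ℕₚ.m≤n+m m (suc n))))
      (square≤triangle n m (0≤a ∘ suc) 0≤B h))

  -- The gap is Σ_{i < n} aᵢ (b N - b (n - i)), and each of its factors is dominated by the
  -- majorants `A` and `B`. The bound `N` stays fixed while the induction shortens `n`.
  square-triangle-gap : ∀ {a A b B : ℕ → ℚ} {N} n → n ℕ.≤ N → (∀ i → ∣ a i ∣ ≤ A i) →
    (∀ i → i ℕ.≤ N → ∣ b N - b i ∣ ≤ B N - B i) →
    ∣ partialSum a n * b N - triangle-sum a b n ∣ ≤ partialSum A n * B N - triangle-sum A B n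
  square-triangle-gap {b = b} {B} {N} zero n≤N ha hb = ≤-reflexive (trans
    (cong ∣_∣ (solve 1 (λ b → con 0ℚ :* b :- con 0ℚ := con 0ℚ) refl (b N)))
    (solve 1 (λ b → con 0ℚ := con 0ℚ :* b :- con 0ℚ) refl (B N)))
  square-triangle-gap {a} {A} {b} {B} {N} (suc n) n≤N ha hb = begin
    ∣ partialSum a (suc n) * b N - (a 0 * b (suc n) + triangle-sum (a ∘ suc) b n) ∣
      ≡⟨ cong ∣_∣ (split a b) ⟩
    ∣ a 0 * (b N - b (suc n)) + (partialSum (a ∘ suc) n * b N - triangle-sum (a ∘ suc) b n) ∣
      ≤⟨ ∣p+q∣≤∣p∣+∣q∣ (a 0 * (b N - b (suc n))) _ ⟩
    ∣ a 0 * (b N - b (suc n)) ∣ + ∣ partialSum (a ∘ suc) n * b N - triangle-sum (a ∘ suc) b n ∣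
      ≤⟨ +-mono-≤
           (≤-trans (≤-reflexive (∣p*q∣≡∣p∣*∣q∣ (a 0) (b N - b (suc n))))
             (*-mono-≤ (≤-trans (0≤∣p∣ (a 0)) (ha 0)) (0≤∣p∣ (b N - b (suc n))) (ha 0) (hb (suc n) n≤N)))
           (square-triangle-gap n (ℕₚ.≤-trans (ℕₚ.n≤1+n n) n≤N) (ha ∘ suc) hb) ⟩
    A 0 * (B N - B (suc n)) + (partialSum (A ∘ suc) n * B N - triangle-sum (A ∘ suc) B n)
      ≡⟨ sym (split A B) ⟩
    partialSum A (suc n) * B N - (A 0 * B (suc n) + triangle-sum (A ∘ suc) B n) ∎
    where
    split : ∀ (a b : ℕ → ℚ) → partialSum a (suc n) * b N - (a 0 * b (suc n) + triangle-sum (a ∘ suc) b n)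
      ≡ a 0 * (b N - b (suc n)) + (partialSum (a ∘ suc) n * b N - triangle-sum (a ∘ suc) b n)
    split a b = trans (cong (λ z → z * b N - (a 0 * b (suc n) + triangle-sum (a ∘ suc) b n)) (partialSum-shift a n))
      (solve 5 (λ a s u v t → (a :+ s) :* u :- (a :* v :+ t) := a :* (u :- v) :+ (s :* u :- t)) refl
        (a 0) (partialSum (a ∘ suc) n) (b N) (b (suc n)) (triangle-sum (a ∘ suc) b n))

  expSum-mono : ∀ {q q′} → 0ℚ ≤ q → q ≤ q′ → ∀ n → expSum q n ≤ expSum q′ n
  expSum-mono 0≤q h zero    = ≤-refl
  expSum-mono {q} {q′} 0≤q h (suc n) = +-mono-≤ (expSum-mono 0≤q h n)
    (≤-trans (q≤∣q∣ (expTerm q n)) (∣expTerm∣≤ (≤-trans 0≤q h) (subst (_≤ q′) (sym (0≤p⇒∣p∣≡p 0≤q)) h) n))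

  expSum-increasing : ∀ {q} → 0ℚ ≤ q → ∀ {m n} → m ℕ.≤ n → expSum q m ≤ expSum q n
  expSum-increasing 0≤q = mono-from-step _ (λ n → ≤-by _ (expTerm-nonneg 0≤q n) refl)

  expSum-nonneg : ∀ {q} → 0ℚ ≤ q → ∀ n → 0ℚ ≤ expSum q n
  expSum-nonneg 0≤q n = expSum-increasing 0≤q {0} {n} ℕ.z≤n

  expSum-+ : ∀ {x y} → 0ℚ ≤ x → 0ℚ ≤ y → ∀ n → expSum (x + y) n ≤ expSum x n * expSum y n
  expSum-+ {x} {y} 0≤x 0≤y n = subst (_≤ expSum x n * expSum y n) (triangle-sum-exp x y n)
    (triangle≤square n (expTerm-nonneg 0≤x) (λ i i≤n → expSum-increasing 0≤y i≤n))

  -- An upper bound for e that is a power of two, so that its powers cancel against powers of ½.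
  expSum-1 : ∀ n → expSum 1ℚ n ≤ ι 4
  expSum-1 n = ≤-trans (ExpBound.bound 1 n) (≤ᵇ⇒≤ _)

  expSum-0 : ∀ n → expSum 0ℚ (suc n) ≡ 1ℚ
  expSum-0 zero    = refl
  expSum-0 (suc n) = trans (cong₂ _+_ (expSum-0 n)
    (trans (cong (expTerm 0ℚ n *_) (*-zeroˡ (recip n))) (*-zeroʳ (expTerm 0ℚ n)))) refl

  expSum-ι : ∀ N n → expSum (ι N) (suc n) ≤ ι 4 ^ N
  expSum-ι zero    n = ≤-reflexive (expSum-0 n)
  expSum-ι (suc N) n = begin
    expSum (ι (suc N)) (suc n)                  ≡⟨ cong (λ z → expSum z (suc n)) (ι-suc N) ⟩
    expSum (1ℚ + ι N) (suc n)                   ≤⟨ expSum-+ 0≤1 (ι-nonneg N) (suc n) ⟩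
    expSum 1ℚ (suc n) * expSum (ι N) (suc n)    ≤⟨ *-mono-≤ (ι-nonneg 4) (expSum-nonneg (ι-nonneg N) (suc n)) (expSum-1 (suc n)) (expSum-ι N n) ⟩
    ι 4 * ι 4 ^ N                               ∎

  ½^2-4^ : ∀ N → ½ ^ (N ℕ.+ N) * ι 4 ^ N ≡ 1ℚ
  ½^2-4^ zero    = refl
  ½^2-4^ (suc N) = trans
    (cong (λ z → ½ * ½ ^ z * (ι 4 * ι 4 ^ N)) (ℕₚ.+-suc N N))
    (trans (solve 2 (λ a b → con ½ :* (con ½ :* a) :* (con (ι 4) :* b) := a :* b) refl (½ ^ (N ℕ.+ N)) (ι 4 ^ N)) (½^2-4^ N))

  nonneg-factor : ∀ {u v} → 0ℚ ≤ u → ½ ≤ u * v → 0ℚ ≤ v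
  nonneg-factor {u} {v} 0≤u h with ≤-total 0ℚ v
  ... | inj₁ 0≤v = 0≤v
  ... | inj₂ v≤0 with ≤-trans h (≤-trans (*-monoˡ u 0≤u v≤0) (≤-reflexive (*-zeroʳ u)))
  ... | *≤* (ℤ.+≤+ ())

  -- S n (x) S n (−x) tends to exp 0 = 1 uniformly in x, and S n (x) is bounded above.
  expSum-neg-lower : ∀ N → Σ[ n₀ ∈ ℕ ] (∀ n → n₀ ℕ.≤ n → ∀ x → 0ℚ ≤ x → x ≤ ι N →
    ½ ^ suc (N ℕ.+ N) ≤ expSum (- x) n)
  expSum-neg-lower N = suc m₀ , λ { (suc n) (ℕ.s≤s m₀≤n) x 0≤x x≤N → bound n m₀≤n x 0≤x x≤N }
    where
    abstract
      eventually-near : Σ[ m₀ ∈ ℕ ] (∀ m n → m₀ ℕ.≤ m → m₀ ℕ.≤ n →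
        ∣ expSum (ι (N ℕ.+ N)) m - expSum (ι (N ℕ.+ N)) n ∣ ≤ ½)
      eventually-near = ExpBound.cauchy (N ℕ.+ N) ½ (positive⁻¹ ½)
    m₀ = proj₁ eventually-near
    near = proj₂ eventually-near
    bound : ∀ n → m₀ ℕ.≤ n → ∀ x → 0ℚ ≤ x → x ≤ ι N → ½ ^ suc (N ℕ.+ N) ≤ expSum (- x) (suc n)
    -- From `½ ≤ u * v` and `u ≤ 4 ^ N`, dividing by `4 ^ N` gives the bound on `v`.
    bound n m₀≤n x 0≤x x≤N = begin
      ½ * ½ ^ (N ℕ.+ N)                    ≤⟨ *-monoʳ _ (0≤½^ (N ℕ.+ N)) ½≤uv ⟩
      u * v * ½ ^ (N ℕ.+ N)                ≤⟨ *-monoʳ _ (0≤½^ (N ℕ.+ N)) (*-monoʳ v 0≤v u≤) ⟩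
      ι 4 ^ N * v * ½ ^ (N ℕ.+ N)          ≡⟨ solve 3 (λ a v b → a :* v :* b := b :* a :* v) refl (ι 4 ^ N) v (½ ^ (N ℕ.+ N)) ⟩
      ½ ^ (N ℕ.+ N) * ι 4 ^ N * v          ≡⟨ trans (cong (_* v) (½^2-4^ N)) (*-identityˡ v) ⟩
      v                                    ∎
      where
      k = suc n
      u = expSum x k
      v = expSum (- x) k
      w = expSum (ι N) k
      ∣x∣≤N : ∣ x ∣ ≤ ι N
      ∣x∣≤N = subst (_≤ ι N) (sym (0≤p⇒∣p∣≡p 0≤x)) x≤N
      ∣-x∣≤N : ∣ - x ∣ ≤ ι N
      ∣-x∣≤N = subst (_≤ ι N) (sym (∣-p∣≡∣p∣ x)) ∣x∣≤N
      -- The square of side `k` fits into the triangle of side `2k`. The corner cut off from `u * v`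
      -- is thus bounded by a difference of two partial sums at `2N`, which is at most ½ by the
      -- choice of `m₀`.
      square-bound : w * w ≤ expSum (ι (N ℕ.+ N)) (k ℕ.+ k)
      square-bound = subst (w * w ≤_)
        (trans (triangle-sum-exp (ι N) (ι N) (k ℕ.+ k)) (cong (λ z → expSum z (k ℕ.+ k)) (sym (ι-+ N N))))
        (square≤triangle k k (expTerm-nonneg (ι-nonneg N)) (expSum-nonneg (ι-nonneg N)) (λ i → expSum-increasing (ι-nonneg N)))
      gap : ∣ u * v - 1ℚ ∣ ≤ ½
      gap = begin
        ∣ u * v - 1ℚ ∣
          ≡⟨ cong (λ z → ∣ u * v - z ∣) (sym (trans (triangle-sum-exp x (- x) k) (trans (cong (λ z → expSum z k) (+-inverseʳ x)) (expSum-0 n)))) ⟩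
        ∣ u * v - triangle-sum (expTerm x) (expSum (- x)) k ∣
          ≤⟨ square-triangle-gap {b = expSum (- x)} {B = expSum (ι N)} k ℕₚ.≤-refl (∣expTerm∣≤ (ι-nonneg N) ∣x∣≤N) (λ i → expSum-tail (ι-nonneg N) ∣-x∣≤N i k) ⟩
        w * w - triangle-sum (expTerm (ι N)) (expSum (ι N)) k
          ≡⟨ cong (λ z → w * w - z) (trans (triangle-sum-exp (ι N) (ι N) k) (cong (λ z → expSum z k) (sym (ι-+ N N)))) ⟩
        w * w - expSum (ι (N ℕ.+ N)) k
          ≤⟨ +-monoˡ-≤ (- expSum (ι (N ℕ.+ N)) k) square-bound ⟩
        expSum (ι (N ℕ.+ N)) (k ℕ.+ k) - expSum (ι (N ℕ.+ N)) k
          ≤⟨ ≤-trans (q≤∣q∣ _) (near (k ℕ.+ k) k (ℕₚ.≤-trans m₀≤k (ℕₚ.m≤m+n k k)) m₀≤k) ⟩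
        ½ ∎
        where
        m₀≤k : m₀ ℕ.≤ k
        m₀≤k = ℕₚ.m≤n⇒m≤1+n m₀≤n
      ½≤uv : ½ ≤ u * v
      ½≤uv = begin
        ½                        ≤⟨ ≤-by (½ - ∣ u * v - 1ℚ ∣) (≤⇒0≤- gap) refl ⟩
        ½ + (½ - ∣ u * v - 1ℚ ∣) ≡⟨ solve 1 (λ z → con ½ :+ (con ½ :- z) := con 1ℚ :- z) refl ∣ u * v - 1ℚ ∣ ⟩
        1ℚ - ∣ u * v - 1ℚ ∣      ≡⟨ cong (λ z → 1ℚ - z) (∣-∣-swap (u * v) 1ℚ) ⟩
        1ℚ - ∣ 1ℚ - u * v ∣      ≤⟨ -antimono {c = 1ℚ} (q≤∣q∣ (1ℚ - u * v)) ⟩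
        1ℚ - (1ℚ - u * v)        ≡⟨ solve 1 (λ z → con 1ℚ :- (con 1ℚ :- z) := z) refl (u * v) ⟩
        u * v                    ∎
      u≤ : u ≤ ι 4 ^ N
      u≤ = ≤-trans (expSum-mono 0≤x x≤N k) (expSum-ι N n)
      0≤v : 0ℚ ≤ v
      0≤v = nonneg-factor (expSum-nonneg 0≤x k) ½≤uv

  ½^-anti : ∀ {m n} → m ℕ.≤ n → ½ ^ n ≤ ½ ^ m
  ½^-anti (ℕ.z≤n {n}) = ½^≤1 n
  ½^-anti (ℕ.s≤s h)   = *-monoˡ ½ 0≤½ (½^-anti h)

  ι-^ : ∀ a n → ι (a ℕ.^ n) ≡ ι a ^ n
  ι-^ a zero    = refl
  ι-^ a (suc n) = trans (ι-* a (a ℕ.^ n)) (cong (ι a *_) (ι-^ a n))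

open Analysis

-- Expectations and products over the stations.

module Process where

  open import Data.Rational using (_≤_; _+_; _-_; _*_; -_)
  open import Data.Rational.Properties
  open RationalLemmas
  open +-*-Solver using (solve; _:+_; _:*_; _:-_; _:=_; con)
  open ≤-Reasoning

  open import Data.Fin.Subset using (∣_∣)
  open import Data.Nat using (_≡ᵇ_)

  Prob : ℚ → Set
  Prob p = 0ℚ ≤ p × p ≤ 1ℚ

  𝔼 : ∀ {k} → Vec ℚ k → (Subset k → ℚ) → ℚ
  𝔼 []       f = f []
  𝔼 (p ∷ ps) f = p * 𝔼 ps (λ X → f (true ∷ X)) + (1ℚ - p) * 𝔼 ps (λ X → f (false ∷ X))

  𝔼-mono : ∀ {k} {ps : Vec ℚ k} {f g} → All Prob ps → (∀ X → f X ≤ g X) → 𝔼 ps f ≤ 𝔼 ps g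
  𝔼-mono [] h = h []
  𝔼-mono {ps = p ∷ ps} ((0≤p , p≤1) ∷ pr) h = +-mono-≤
    (*-monoˡ p 0≤p (𝔼-mono pr (λ X → h (true ∷ X))))
    (*-monoˡ (1ℚ - p) (≤⇒0≤- p≤1) (𝔼-mono pr (λ X → h (false ∷ X))))

  𝔼-const : ∀ {k} (ps : Vec ℚ k) c → 𝔼 ps (λ _ → c) ≡ c
  𝔼-const [] c = refl
  𝔼-const (p ∷ ps) c = trans (cong₂ (λ a b → p * a + (1ℚ - p) * b) (𝔼-const ps c) (𝔼-const ps c))
    (solve 2 (λ p c → p :* c :+ (con 1ℚ :- p) :* c := c) refl p c)

  𝔼-+ : ∀ {k} (ps : Vec ℚ k) f g → 𝔼 ps (λ X → f X + g X) ≡ 𝔼 ps f + 𝔼 ps g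
  𝔼-+ [] f g = refl
  𝔼-+ (p ∷ ps) f g = trans
    (cong₂ (λ a b → p * a + (1ℚ - p) * b) (𝔼-+ ps _ _) (𝔼-+ ps _ _))
    (solve 5 (λ p a b c d → p :* (a :+ b) :+ (con 1ℚ :- p) :* (c :+ d)
                         := p :* a :+ (con 1ℚ :- p) :* c :+ (p :* b :+ (con 1ℚ :- p) :* d))
      refl p (𝔼 ps _) (𝔼 ps _) (𝔼 ps _) (𝔼 ps _))

  𝔼-* : ∀ {k} (ps : Vec ℚ k) c f → 𝔼 ps (λ X → c * f X) ≡ c * 𝔼 ps f
  𝔼-* [] c f = refl
  𝔼-* (p ∷ ps) c f = trans
    (cong₂ (λ a b → p * a + (1ℚ - p) * b) (𝔼-* ps c _) (𝔼-* ps c _))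
    (solve 4 (λ p c a b → p :* (c :* a) :+ (con 1ℚ :- p) :* (c :* b)
                       := c :* (p :* a :+ (con 1ℚ :- p) :* b))
      refl p c (𝔼 ps _) (𝔼 ps _))

  𝔼-1- : ∀ {k} (ps : Vec ℚ k) f → 𝔼 ps (λ X → 1ℚ - f X) ≡ 1ℚ - 𝔼 ps f
  𝔼-1- [] f = refl
  𝔼-1- (p ∷ ps) f = trans
    (cong₂ (λ a b → p * a + (1ℚ - p) * b) (𝔼-1- ps _) (𝔼-1- ps _))
    (solve 3 (λ p a b → p :* (con 1ℚ :- a) :+ (con 1ℚ :- p) :* (con 1ℚ :- b)
                     := con 1ℚ :- (p :* a :+ (con 1ℚ :- p) :* b))
      refl p (𝔼 ps _) (𝔼 ps _))

  sumFin : ∀ {k} → (Fin k → ℚ) → ℚ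
  sumFin {zero}  f = 0ℚ
  sumFin {suc k} f = f zero + sumFin (λ i → f (suc i))

  sumFin-cong : ∀ {k} {f g : Fin k → ℚ} → (∀ i → f i ≡ g i) → sumFin f ≡ sumFin g
  sumFin-cong {zero}  h = refl
  sumFin-cong {suc k} h = cong₂ _+_ (h zero) (sumFin-cong (λ i → h (suc i)))

  sumFin-mono : ∀ {k} {f g : Fin k → ℚ} → (∀ i → f i ≤ g i) → sumFin f ≤ sumFin g
  sumFin-mono {zero}  h = ≤-refl
  sumFin-mono {suc k} h = +-mono-≤ (h zero) (sumFin-mono (λ i → h (suc i)))

  sumFin-const : ∀ k c → sumFin {k} (λ _ → c) ≡ ι k * c
  sumFin-const zero    c = sym (*-zeroˡ c)
  sumFin-const (suc k) c = trans (cong (c +_) (sumFin-const k c))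
    (trans (solve 2 (λ k c → c :+ k :* c := (con 1ℚ :+ k) :* c) refl (ι k) c)
      (cong (_* c) (sym (ι-suc k))))

  sumFin-nonneg : ∀ {k} {f : Fin k → ℚ} → (∀ i → 0ℚ ≤ f i) → 0ℚ ≤ sumFin f
  sumFin-nonneg {zero}  h = ≤-refl
  sumFin-nonneg {suc k} h = 0≤+ (h zero) (sumFin-nonneg (λ i → h (suc i)))

  ≤-sumFin : ∀ {k} {f : Fin k → ℚ} → (∀ i → 0ℚ ≤ f i) → ∀ i → f i ≤ sumFin f
  ≤-sumFin {f = f} h zero    = ≤-by _ (sumFin-nonneg (λ i → h (suc i))) refl
  ≤-sumFin {f = f} h (suc i) = ≤-trans (≤-sumFin (λ i → h (suc i)) i)
    (p≤q+p (h zero))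

  𝔼-sumFin : ∀ {k m} (ps : Vec ℚ k) (f : Fin m → Subset k → ℚ) →
    𝔼 ps (λ X → sumFin (λ i → f i X)) ≡ sumFin (λ i → 𝔼 ps (f i))
  𝔼-sumFin {m = zero}  ps f = 𝔼-const ps 0ℚ
  𝔼-sumFin {m = suc m} ps f = trans (𝔼-+ ps (f zero) _)
    (cong (𝔼 ps (f zero) +_) (𝔼-sumFin ps (λ i → f (suc i))))

  prod : ∀ {A : Set} {k} → (A → ℚ) → Vec A k → ℚ
  prod f []       = 1ℚ
  prod f (x ∷ xs) = f x * prod f xs

  prodAt : ∀ {A : Set} {k} → Fin k → (A → ℚ) → (A → ℚ) → Vec A k → ℚ
  prodAt zero    f g (x ∷ xs) = f x * prod g xs
  prodAt (suc i) f g (x ∷ xs) = g x * prodAt i f g xs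

  -- Independence of the stations: the expectation of a product is the product of the expectations.
  𝔼-prod : ∀ {A : Set} {k} (p : A → ℚ) (g : Bool → ℚ) (xs : Vec A k) →
    𝔼 (map p xs) (prod g) ≡ prod (λ x → p x * g true + (1ℚ - p x) * g false) xs
  𝔼-prod p g []       = refl
  𝔼-prod p g (x ∷ xs) = trans
    (cong₂ (λ a b → p x * a + (1ℚ - p x) * b) (𝔼-* (map p xs) (g true) (prod g)) (𝔼-* (map p xs) (g false) (prod g)))
    (trans
      (solve 4 (λ p a b e → p :* (a :* e) :+ (con 1ℚ :- p) :* (b :* e) := (p :* a :+ (con 1ℚ :- p) :* b) :* e)
        refl (p x) (g true) (g false) (𝔼 (map p xs) (prod g)))
      (cong ((p x * g true + (1ℚ - p x) * g false) *_) (𝔼-prod p g xs)))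

  indicator : Bool → ℚ
  indicator true  = 1ℚ
  indicator false = 0ℚ

  indicator-nonneg : ∀ x → 0ℚ ≤ indicator x
  indicator-nonneg true  = 0≤1
  indicator-nonneg false = ≤-refl

  -- only i X is 1 if X = {i} and 0 otherwise.
  only : ∀ {k} → Fin k → Subset k → ℚ
  only i = prodAt i indicator (λ x → 1ℚ - indicator x)

  𝔼-none : ∀ {A : Set} {k} (p : A → ℚ) (xs : Vec A k) →
    𝔼 (map p xs) (prod (λ x → 1ℚ - indicator x)) ≡ prod (λ x → 1ℚ - p x) xs
  𝔼-none p [] = refl
  𝔼-none p (x ∷ xs) = trans
    (cong₂ (λ a b → p x * a + (1ℚ - p x) * b)
      (𝔼-* (map p xs) (1ℚ - 1ℚ) _) (𝔼-* (map p xs) (1ℚ - 0ℚ) _))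
    (trans
      (solve 2 (λ p e → p :* (con (1ℚ - 1ℚ) :* e) :+ (con 1ℚ :- p) :* (con (1ℚ - 0ℚ) :* e) := (con 1ℚ :- p) :* e) refl (p x) (𝔼 (map p xs) _))
      (cong ((1ℚ - p x) *_) (𝔼-none p xs)))

  𝔼-only : ∀ {A : Set} {k} (p : A → ℚ) i (xs : Vec A k) →
    𝔼 (map p xs) (only i) ≡ prodAt i p (λ x → 1ℚ - p x) xs
  𝔼-only p zero    (x ∷ xs) = trans
    (cong₂ (λ a b → p x * a + (1ℚ - p x) * b)
      (𝔼-* (map p xs) 1ℚ _) (𝔼-* (map p xs) 0ℚ _))
    (trans
      (solve 2 (λ p e → p :* (con 1ℚ :* e) :+ (con 1ℚ :- p) :* (con 0ℚ :* e) := p :* e) refl (p x) (𝔼 (map p xs) _))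
      (cong (p x *_) (𝔼-none p xs)))
  𝔼-only p (suc i) (x ∷ xs) = trans
    (cong₂ (λ a b → p x * a + (1ℚ - p x) * b)
      (𝔼-* (map p xs) (1ℚ - 1ℚ) _) (𝔼-* (map p xs) (1ℚ - 0ℚ) _))
    (trans
      (solve 2 (λ p e → p :* (con (1ℚ - 1ℚ) :* e) :+ (con 1ℚ :- p) :* (con (1ℚ - 0ℚ) :* e) := (con 1ℚ :- p) :* e) refl (p x) (𝔼 (map p xs) _))
      (cong ((1ℚ - p x) *_) (𝔼-only p i xs)))

  none-cases : ∀ {k} (X : Subset k) →
    prod (λ x → 1ℚ - indicator x) X ≡ 0ℚ ⊎ (∣ X ∣ ≡ 0 × prod (λ x → 1ℚ - indicator x) X ≡ 1ℚ)
  none-cases []          = inj₂ (refl , refl)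
  none-cases (true ∷ X)  = inj₁ (*-zeroˡ (prod _ X))
  none-cases (false ∷ X) with none-cases X
  ... | inj₁ e       = inj₁ (trans (*-identityˡ _) e)
  ... | inj₂ (c , e) = inj₂ (c , trans (*-identityˡ _) e)

  only-cases : ∀ {k} i (X : Subset k) →
    only i X ≡ 0ℚ ⊎ (∣ X ∣ ≡ 1 × lookup X i ≡ true × only i X ≡ 1ℚ)
  only-cases zero (false ∷ X) = inj₁ (*-zeroˡ (prod _ X))
  only-cases zero (true ∷ X) with none-cases X
  ... | inj₁ e       = inj₁ (trans (*-identityˡ _) e)
  ... | inj₂ (c , e) = inj₂ (cong suc c , refl , trans (*-identityˡ _) e)
  only-cases (suc i) (true ∷ X) = inj₁ (*-zeroˡ (only i X))
  only-cases (suc i) (false ∷ X) with only-cases i X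
  ... | inj₁ e           = inj₁ (trans (*-identityˡ _) e)
  ... | inj₂ (c , l , e) = inj₂ (c , l , trans (*-identityˡ _) e)

  prod-nonneg : ∀ {A : Set} {k} {f : A → ℚ} {xs : Vec A k} → All (λ x → 0ℚ ≤ f x) xs → 0ℚ ≤ prod f xs
  prod-nonneg []       = 0≤1
  prod-nonneg (h ∷ hs) = 0≤* h (prod-nonneg hs)

  prodAt-nonneg : ∀ {A : Set} {k} {f g : A → ℚ} i {xs : Vec A k} →
    0ℚ ≤ f (lookup xs i) → All (λ x → 0ℚ ≤ g x) xs → 0ℚ ≤ prodAt i f g xs
  prodAt-nonneg zero    hf (_ ∷ hs) = 0≤* hf (prod-nonneg hs)
  prodAt-nonneg (suc i) hf (h ∷ hs) = 0≤* h (prodAt-nonneg i hf hs)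

  prod-mono : ∀ {A : Set} {k} {f g : A → ℚ} {xs : Vec A k} →
    All (λ x → 0ℚ ≤ f x × f x ≤ g x) xs → prod f xs ≤ prod g xs
  prod-mono []                 = ≤-refl
  prod-mono ((0≤f , f≤g) ∷ hs) =
    *-mono-≤ (≤-trans 0≤f f≤g) (prod-nonneg (All.map proj₁ hs)) f≤g (prod-mono hs)

  prodAt-mono : ∀ {A : Set} {k} i {f f′ g g′ : A → ℚ} {xs : Vec A k} →
    0ℚ ≤ f (lookup xs i) → f (lookup xs i) ≤ f′ (lookup xs i) →
    All (λ x → 0ℚ ≤ g x × g x ≤ g′ x) xs → prodAt i f g xs ≤ prodAt i f′ g′ xs
  prodAt-mono zero 0≤f f≤f′ (_ ∷ hs) =
    *-mono-≤ (≤-trans 0≤f f≤f′) (prod-nonneg (All.map proj₁ hs)) f≤f′ (prod-mono hs)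
  prodAt-mono (suc i) 0≤f f≤f′ ((0≤g , g≤g′) ∷ hs) =
    *-mono-≤ (≤-trans 0≤g g≤g′) (prodAt-nonneg i 0≤f (All.map proj₁ hs)) g≤g′ (prodAt-mono i 0≤f f≤f′ hs)

  prod-* : ∀ {A : Set} {k} (f g : A → ℚ) (xs : Vec A k) →
    prod (λ x → f x * g x) xs ≡ prod f xs * prod g xs
  prod-* f g []       = sym (*-identityˡ 1ℚ)
  prod-* f g (x ∷ xs) = trans (cong (f x * g x *_) (prod-* f g xs))
    (solve 4 (λ a b c d → a :* b :* (c :* d) := a :* c :* (b :* d)) refl (f x) (g x) (prod f xs) (prod g xs))

  prodAt-* : ∀ {A : Set} {k} i (f f′ g g′ : A → ℚ) (xs : Vec A k) →
    prodAt i (λ x → f x * f′ x) (λ x → g x * g′ x) xs ≡ prodAt i f g xs * prodAt i f′ g′ xs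
  prodAt-* zero f f′ g g′ (x ∷ xs) = trans (cong (f x * f′ x *_) (prod-* g g′ xs))
    (solve 4 (λ a b c d → a :* b :* (c :* d) := a :* c :* (b :* d)) refl (f x) (f′ x) (prod g xs) (prod g′ xs))
  prodAt-* (suc i) f f′ g g′ (x ∷ xs) = trans (cong (g x * g′ x *_) (prodAt-* i f f′ g g′ xs))
    (solve 4 (λ a b c d → a :* b :* (c :* d) := a :* c :* (b :* d)) refl (g x) (g′ x) (prodAt i f g xs) (prodAt i f′ g′ xs))

  -- Invariant of the induction over the competitors of a station: P is the probability
  -- that the station transmits alone, B the factor that pays for the loss 1 − P.
  record Pays (ε P B : ℚ) : Set where
    field
      nonneg : 0ℚ ≤ P
      small  : P ≤ ε
      large  : ½ ≤ B
      loss   : 1ℚ - P ≤ B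

  module _ {ε : ℚ} (0≤ε : 0ℚ ≤ ε) (ε≤½ : ε ≤ ½) where

    pays-alone : ∀ {p} → Prob p → p ≤ ε → Pays ε (p * 1ℚ) ((1ℚ - p) * 1ℚ)
    pays-alone {p} (0≤p , _) p≤ε = record
      { nonneg = 0≤* 0≤p 0≤1
      ; small  = subst (_≤ ε) (sym (*-identityʳ p)) p≤ε
      ; large  = subst (½ ≤_) (sym (*-identityʳ (1ℚ - p)))
          (-antimono {c = 1ℚ} (≤-trans p≤ε ε≤½))
      ; loss   = ≤-reflexive (solve 1 (λ p → con 1ℚ :- p :* con 1ℚ := (con 1ℚ :- p) :* con 1ℚ) refl p)
      }

    -- A competitor lowers the chance of a lone transmission by `a * P`, at most `a * ε`. Since `B`
    -- is at least ½, this is at most `2 * ε * a * B`, which the new factor pays for.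
    pays-competitor : ∀ {a P B} → Prob a → Pays ε P B →
      Pays ε ((1ℚ - a) * P) ((1ℚ + 2ℚ * ε * a) * B)
    pays-competitor {a} {P} {B} (0≤a , a≤1) h = record
      { nonneg = 0≤* (≤⇒0≤- a≤1) nonneg
      ; small  = ≤-trans (≤-by (a * P) (0≤* 0≤a nonneg)
          (solve 2 (λ a P → (con 1ℚ :- a) :* P :+ a :* P := P) refl a P)) small
      ; large  = ≤-trans large (≤-by (2ℚ * ε * a * B) (0≤* 0≤2εa (≤-trans 0≤½ large))
          (solve 2 (λ e B → B :+ e :* B := (con 1ℚ :+ e) :* B) refl (2ℚ * ε * a) B))
      ; loss   = begin
          1ℚ - (1ℚ - a) * P              ≡⟨ solve 2 (λ a P → con 1ℚ :- (con 1ℚ :- a) :* P := (con 1ℚ :- P) :+ a :* P) refl a P ⟩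
          (1ℚ - P) + a * P               ≤⟨ +-mono-≤ loss (*-monoˡ a 0≤a small) ⟩
          B + a * ε                      ≡⟨ cong (B +_) (solve 2 (λ a e → a :* e := con 2ℚ :* e :* a :* con ½) refl a ε) ⟩
          B + 2ℚ * ε * a * ½             ≤⟨ +-monoʳ-≤ B (*-monoˡ (2ℚ * ε * a) 0≤2εa large) ⟩
          B + 2ℚ * ε * a * B             ≡⟨ solve 2 (λ e B → B :+ e :* B := (con 1ℚ :+ e) :* B) refl (2ℚ * ε * a) B ⟩
          (1ℚ + 2ℚ * ε * a) * B          ∎
      }
      where
      open Pays h
      0≤2εa : 0ℚ ≤ 2ℚ * ε * a
      0≤2εa = 0≤* (0≤* (nonNegative⁻¹ 2ℚ) 0≤ε) 0≤a

    module _ {A : Set} (p : A → ℚ) where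

      pays-first : ∀ {k x} {xs : Vec A k} → Prob (p x) → p x ≤ ε → All (λ y → Prob (p y)) xs →
        Pays ε (p x * prod (λ y → 1ℚ - p y) xs) ((1ℚ - p x) * prod (λ y → 1ℚ + 2ℚ * ε * p y) xs)
      pays-first pr p≤ε [] = pays-alone pr p≤ε
      pays-first {x = x} {xs = y ∷ ys} pr p≤ε (q ∷ qs) =
        subst₂-Pays (swap (p x) (1ℚ - p y) _) (swap (1ℚ - p x) (1ℚ + 2ℚ * ε * p y) _)
          (pays-competitor q (pays-first pr p≤ε qs))
        where
        swap : ∀ a b c → b * (a * c) ≡ a * (b * c)
        swap = solve 3 (λ a b c → b :* (a :* c) := a :* (b :* c)) refl
        subst₂-Pays : ∀ {P P′ B B′} → P ≡ P′ → B ≡ B′ → Pays ε P B → Pays ε P′ B′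
        subst₂-Pays refl refl h = h

      pays : ∀ {k} i {xs : Vec A k} → All (λ y → Prob (p y)) xs → p (lookup xs i) ≤ ε →
        Pays ε (prodAt i p (λ y → 1ℚ - p y) xs) (prodAt i (λ y → 1ℚ - p y) (λ y → 1ℚ + 2ℚ * ε * p y) xs)
      pays zero    (q ∷ qs) p≤ε = pays-first q p≤ε qs
      pays (suc i) (q ∷ qs) p≤ε = pays-competitor q (pays i qs p≤ε)

  -- Rounds of the process and abstract potentials.

  -- The next status after a round without success. For live statuses the potentials take their
  -- largest possible next value here.
  advance : Status → Status
  advance = endRound false false

  finish : ∀ {k} → Subset k → Vec Status k → Vec Status k
  finish X = zipWith (endRound (∣ X ∣ ≡ᵇ 1)) X

  weight : ∀ {k} → Subset k → ℚ
  weight X = 2ℚ ^ ∣ X ∣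

  double : Bool → ℚ
  double true  = 2ℚ
  double false = 1ℚ

  weight-prod : ∀ {k} (X : Subset k) → weight X ≡ prod double X
  weight-prod []          = refl
  weight-prod (true ∷ X)  = cong (2ℚ *_) (weight-prod X)
  weight-prod (false ∷ X) = trans (weight-prod X) (sym (*-identityˡ _))

  module _ {f : Status → ℚ} (0≤f : ∀ s → 0ℚ ≤ f s) where

    prod-finish : ∀ {k} c (X : Subset k) {ss : Vec Status k} →
      All (λ s → ∀ c x → f (endRound c x s) ≤ f (advance s)) ss →
      prod f (zipWith (endRound c) X ss) ≤ prod (λ s → f (advance s)) ss
    prod-finish c []      []       = ≤-refl
    prod-finish c (x ∷ X) {s ∷ ss} (h ∷ hs) =
      *-mono-≤ (0≤f (advance s)) (prod-nonneg (All.universal 0≤f (zipWith (endRound c) X ss))) (h c x) (prod-finish c X hs)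

  module _ {f g : Status → ℚ} (0≤f : ∀ s → 0ℚ ≤ f s) (0≤g : ∀ s → 0ℚ ≤ g s) where

    prodAt-finish : ∀ {k} i c (X : Subset k) {ss : Vec Status k} →
      All (λ s → ∀ c x → f (endRound c x s) ≤ f (advance s)) ss →
      All (λ s → ∀ c x → g (endRound c x s) ≤ g (advance s)) ss →
      prodAt i f g (zipWith (endRound c) X ss) ≤ prodAt i (λ s → f (advance s)) (λ s → g (advance s)) ss
    prodAt-finish zero c (x ∷ X) {s ∷ ss} (h ∷ _) (_ ∷ hs) =
      *-mono-≤ (0≤f (advance s)) (prod-nonneg (All.universal 0≤g (zipWith (endRound c) X ss))) (h c x) (prod-finish 0≤g c X hs)
    prodAt-finish (suc i) c (x ∷ X) {s ∷ ss} (_ ∷ hs) (h ∷ hs′) =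
      *-mono-≤ (0≤g (advance s)) (prodAt-nonneg i (0≤f _) (All.universal 0≤g (zipWith (endRound c) X ss))) (h c x) (prodAt-finish i c X hs hs′)

  -- A lone transmission switches the observed station off, where `φ` vanishes.
  prodAt-finish-success : ∀ {k} {f g : Status → ℚ} i (X : Subset k) (ss : Vec Status k) {r} →
    f off ≡ 0ℚ → lookup X i ≡ true → lookup ss i ≡ active r →
    prodAt i f g (zipWith (endRound true) X ss) ≡ 0ℚ
  prodAt-finish-success {g = g} zero (true ∷ X) (active r ∷ ss) f-off refl refl =
    trans (cong (_* prod g (zipWith (endRound true) X ss)) f-off) (*-zeroˡ (prod g (zipWith (endRound true) X ss)))
  prodAt-finish-success {g = g} (suc i) (x ∷ X) (s ∷ ss) f-off l e =
    trans (cong (g (endRound true x s) *_) (prodAt-finish-success i X ss f-off l e)) (*-zeroʳ (g (endRound true x s)))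

  module _ {k : ℕ} (p : Status → ℚ) (adv : Adversary k) where

    after : ℕ → History k → (History k → ℚ) → ℚ
    after zero    h f = f h
    after (suc n) h f = 𝔼 (map p (zipWith activate (adv h) (statuses h)))
      (λ X → after n (mkRound (adv h) X ∷ h) f)

  probs : ∀ {k} {p : Status → ℚ} → (∀ s → Prob (p s)) → (ss : Vec Status k) → All Prob (map p ss)
  probs h []       = []
  probs h (s ∷ ss) = h s ∷ probs h ss

  after-nonneg : ∀ {k} {p : Status → ℚ} (adv : Adversary k) → (∀ s → Prob (p s)) →
    ∀ n h f → (∀ h → 0ℚ ≤ f h) → 0ℚ ≤ after p adv n h f
  after-nonneg adv pr zero    h f 0≤f = 0≤f h
  after-nonneg {p = p} adv pr (suc n) h f 0≤f = subst (_≤ after p adv (suc n) h f) (𝔼-const (map p ss) 0ℚ)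
    (𝔼-mono (probs pr ss) (λ X → after-nonneg adv pr n _ f 0≤f))
    where ss = zipWith activate (adv h) (statuses h)

  -- θ pays for transmissions; the station potential φ, discounted by ψ for each competitor,
  -- pays for the risk that the station is still active at the horizon.
  record Potentials : Set₁ where
    field
      p θ ψ φ  : Status → ℚ
      Live     : Status → Set
      ε        : ℚ
      0≤ε      : 0ℚ ≤ ε
      ε≤½      : ε ≤ ½
      p-prob   : ∀ s → Prob (p s)
      0≤θ      : ∀ s → 0ℚ ≤ θ s
      1≤ψ      : ∀ s → 1ℚ ≤ ψ s
      1≤θ      : ∀ {s} → Live s → 1ℚ ≤ θ s
      0≤φ      : ∀ s → 0ℚ ≤ φ s
      -- A sleeping station has the potentials of age zero, so the choices of the adversary leave
      -- them unchanged.
      θ-activate : ∀ x s → θ (activate x s) ≡ θ s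
      ψ-activate : ∀ x s → ψ (activate x s) ≡ ψ s
      φ-activate : ∀ x s → φ (activate x s) ≡ φ s
      live-activate : ∀ x {s} → Live s → Live (activate x s)
      -- A station that reaches the horizon ceases to be live, and its `φ` has then grown to at
      -- least 1.
      live-end : ∀ {s} → Live s → ∀ c x → Live (endRound c x s) ⊎ 1ℚ ≤ φ (endRound c x s)
      φ-off    : φ off ≡ 0ℚ
      θ-end    : ∀ {s} → Live s → ∀ c x → θ (endRound c x s) ≤ θ (advance s)
      ψ-end    : ∀ {s} → Live s → ∀ c x → ψ (endRound c x s) ≤ ψ (advance s)
      φ-end    : ∀ {s} → Live s → ∀ c x → φ (endRound c x s) ≤ φ (advance s)
      θ-drift  : ∀ {s} → Live s → (1ℚ + p s) * θ (advance s) ≤ θ s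
      ψ-drift  : ∀ {s} → Live s → (1ℚ + 2ℚ * ε * p s) * ψ (advance s) ≤ ψ s
      -- Either `φ` does not increase even without a success, or the station is old enough for its
      -- own probability to be below `ε`, and its factor `1 - p` pays for the growth of `φ`.
      φ-drift  : ∀ {s} → Live s → φ (advance s) ≤ φ s ⊎
        (p s ≤ ε × (Σ[ r ∈ ℕ ] s ≡ active r) × (1ℚ - p s) * φ (advance s) ≤ φ s)

  -- Supermartingales and the failure probability.

  module Drift (P : Potentials) where
    open Potentials P

    0≤ψ : ∀ s → 0ℚ ≤ ψ s
    0≤ψ s = ≤-trans 0≤1 (1≤ψ s)

    -- A station multiplies the expected weight by `2p + (1 - p) = 1 + p`, which is the factor that
    -- `θ-drift` pays for.
    θ-supermartingale : ∀ {k} {ss : Vec Status k} → All Live ss →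
      𝔼 (map p ss) (λ X → weight X * prod θ (finish X ss)) ≤ prod θ ss
    θ-supermartingale {ss = ss} ls = begin
      𝔼 (map p ss) (λ X → weight X * prod θ (finish X ss))
        ≤⟨ 𝔼-mono (probs p-prob ss) (λ X → ≤-trans
             (*-mono-≤ (0≤weight X) (prod-nonneg (All.universal 0≤θ (finish X ss))) ≤-refl
               (prod-finish 0≤θ (∣ X ∣ ≡ᵇ 1) X (All.map θ-end ls)))
             (≤-reflexive (trans (*-comm (weight X) Θ) (cong (Θ *_) (weight-prod X))))) ⟩
      𝔼 (map p ss) (λ X → Θ * prod double X)
        ≡⟨ 𝔼-* (map p ss) Θ (prod double) ⟩
      Θ * 𝔼 (map p ss) (prod double)
        ≡⟨ trans (cong (Θ *_) (𝔼-prod p double ss)) (*-comm Θ _) ⟩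
      prod (λ s → p s * 2ℚ + (1ℚ - p s) * 1ℚ) ss * Θ
        ≡⟨ sym (prod-* _ _ ss) ⟩
      prod (λ s → (p s * 2ℚ + (1ℚ - p s) * 1ℚ) * θ (advance s)) ss
        ≤⟨ prod-mono (All.map step ls) ⟩
      prod θ ss ∎
      where
      Θ = prod (λ s → θ (advance s)) ss
      0≤weight : ∀ X → 0ℚ ≤ weight X
      0≤weight X = subst (0ℚ ≤_) (sym (weight-prod X)) (prod-nonneg (All.universal (λ { true → nonNegative⁻¹ 2ℚ ; false → 0≤1 }) X))
      step : ∀ {s} → Live s → let m = (p s * 2ℚ + (1ℚ - p s) * 1ℚ) * θ (advance s) in 0ℚ ≤ m × m ≤ θ s
      step {s} l = subst (λ z → 0ℚ ≤ z * θ (advance s) × z * θ (advance s) ≤ θ s)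
        (solve 1 (λ p → con 1ℚ :+ p := p :* con 2ℚ :+ (con 1ℚ :- p) :* con 1ℚ) refl (p s))
        (0≤* (0≤+ 0≤1 (proj₁ (p-prob _))) (0≤θ (advance s)) , θ-drift l)

    0≤ψ-drift : ∀ {s} → Live s → 0ℚ ≤ (1ℚ + 2ℚ * ε * p s) * ψ (advance s)
    0≤ψ-drift {s} _ = 0≤* (0≤+ 0≤1 (0≤* (0≤* (nonNegative⁻¹ 2ℚ) 0≤ε) (proj₁ (p-prob _)))) (0≤ψ (advance s))

    ψ-anti : ∀ {s} → Live s → ψ (advance s) ≤ ψ s
    ψ-anti {s} l = ≤-trans
      (≤-by (2ℚ * ε * p s * ψ (advance s))
        (0≤* (0≤* (0≤* (nonNegative⁻¹ 2ℚ) 0≤ε) (proj₁ (p-prob _))) (0≤ψ (advance s)))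
        (solve 2 (λ e B → B :+ e :* B := (con 1ℚ :+ e) :* B) refl (2ℚ * ε * p s) (ψ (advance s))))
      (ψ-drift l)

    module _ {k : ℕ} (i : Fin k) {ss : Vec Status k} (ls : All Live ss) where

      private
        K = prodAt i (λ s → φ (advance s)) (λ s → ψ (advance s)) ss

        0≤K : 0ℚ ≤ K
        0≤K = prodAt-nonneg i (0≤φ _) (All.universal (λ s → 0≤ψ (advance s)) ss)

        finish≤K : ∀ X → prodAt i φ ψ (finish X ss) ≤ K
        finish≤K X = prodAt-finish 0≤φ 0≤ψ i (∣ X ∣ ≡ᵇ 1) X (All.map φ-end ls) (All.map ψ-end ls)

        finish≤ : ∀ {r} → lookup ss i ≡ active r → ∀ X →
          prodAt i φ ψ (finish X ss) ≤ K * (1ℚ - only i X)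
        finish≤ e X with only-cases i X
        ... | inj₁ o = ≤-trans (finish≤K X) (≤-reflexive
          (trans (solve 1 (λ K → K := K :* (con 1ℚ :- con 0ℚ)) refl K) (cong (λ z → K * (1ℚ - z)) (sym o))))
        ... | inj₂ (c , l , o) = ≤-reflexive (trans
          (trans (cong (λ n → prodAt i φ ψ (zipWith (endRound (n ≡ᵇ 1)) X ss)) c)
            (prodAt-finish-success i X ss φ-off l e))
          (trans (sym (*-zeroʳ K)) (cong (λ z → K * (1ℚ - z)) (sym o))))

      -- For a young station the bound `K`, which ignores successes, already suffices. For an old
      -- one the product vanishes when it transmits alone, so the expectation is `K` times the
      -- chance that it does not; `pays` splits that chance into one factor per station, matching
      -- the drifts of `φ` and `ψ`.
      φ-supermartingale : 𝔼 (map p ss) (λ X → prodAt i φ ψ (finish X ss)) ≤ prodAt i φ ψ ss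
      φ-supermartingale with φ-drift (lookup⁺ ls i)
      ... | inj₁ h = begin
        𝔼 (map p ss) (λ X → prodAt i φ ψ (finish X ss)) ≤⟨ 𝔼-mono (probs p-prob ss) finish≤K ⟩
        𝔼 (map p ss) (λ _ → K)                          ≡⟨ 𝔼-const (map p ss) K ⟩
        K                                                ≤⟨ prodAt-mono i (0≤φ _) h (All.map (λ l → 0≤ψ _ , ψ-anti l) ls) ⟩
        prodAt i φ ψ ss                                  ∎
      ... | inj₂ (p≤ε , (r , e) , h) = begin
        𝔼 (map p ss) (λ X → prodAt i φ ψ (finish X ss))
          ≤⟨ 𝔼-mono (probs p-prob ss) (finish≤ e) ⟩
        𝔼 (map p ss) (λ X → K * (1ℚ - only i X))
          ≡⟨ trans (𝔼-* (map p ss) K _) (cong (K *_) (𝔼-1- (map p ss) (only i))) ⟩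
        K * (1ℚ - 𝔼 (map p ss) (only i))
          ≡⟨ cong (λ z → K * (1ℚ - z)) (𝔼-only p i ss) ⟩
        K * (1ℚ - prodAt i p (λ s → 1ℚ - p s) ss)
          ≤⟨ *-monoˡ K 0≤K (Pays.loss (pays 0≤ε ε≤½ p i (All.universal p-prob ss) p≤ε)) ⟩
        K * prodAt i (λ s → 1ℚ - p s) (λ s → 1ℚ + 2ℚ * ε * p s) ss
          ≡⟨ trans (*-comm K _) (sym (prodAt-* i _ _ _ _ ss)) ⟩
        prodAt i (λ s → (1ℚ - p s) * φ (advance s)) (λ s → (1ℚ + 2ℚ * ε * p s) * ψ (advance s)) ss
          ≤⟨ prodAt-mono i (0≤* (≤⇒0≤- (proj₂ (p-prob _))) (0≤φ _)) h (All.map (λ l → 0≤ψ-drift l , ψ-drift l) ls) ⟩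
        prodAt i φ ψ ss ∎

    module _ (c : ℚ) (0≤c : 0ℚ ≤ c) where

      -- With `c = ½ ^ K` the first summand is at least 1 after `K` attempts as long as all stations
      -- are live; the second is at least 1 once some station reaches the horizon. Either failure
      -- thus raises the potential to 1.
      potential : ∀ {k} → ℕ → Vec Status k → ℚ
      potential a ss = c * (2ℚ ^ a * prod θ ss) + sumFin (λ i → prodAt i φ ψ ss)

      potential-activate : ∀ {k} a (A : Subset k) ss → potential a (zipWith activate A ss) ≡ potential a ss
      potential-activate a A ss = cong₂ (λ u v → c * (2ℚ ^ a * u) + v)
        (prod-activate θ-activate A ss)
        (sumFin-cong (λ i → prodAt-activate i A ss))
        where
        prod-activate : ∀ {k} {f : Status → ℚ} → (∀ x s → f (activate x s) ≡ f s) →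
          (A : Subset k) (ss : Vec Status k) → prod f (zipWith activate A ss) ≡ prod f ss
        prod-activate h []      []       = refl
        prod-activate h (x ∷ A) (s ∷ ss) = cong₂ _*_ (h x s) (prod-activate h A ss)
        prodAt-activate : ∀ {k} i (A : Subset k) ss → prodAt i φ ψ (zipWith activate A ss) ≡ prodAt i φ ψ ss
        prodAt-activate zero    (x ∷ A) (s ∷ ss) = cong₂ _*_ (φ-activate x s) (prod-activate ψ-activate A ss)
        prodAt-activate (suc i) (x ∷ A) (s ∷ ss) = cong₂ _*_ (ψ-activate x s) (prodAt-activate i A ss)

      potential-supermartingale : ∀ {k} a {ss : Vec Status k} → All Live ss →
        𝔼 (map p ss) (λ X → potential (∣ X ∣ ℕ.+ a) (finish X ss)) ≤ potential a ss
      potential-supermartingale a {ss} ls = begin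
        𝔼 ps (λ X → c * (2ℚ ^ (∣ X ∣ ℕ.+ a) * prod θ (finish X ss)) + sumFin (λ i → prodAt i φ ψ (finish X ss)))
          ≡⟨ 𝔼-+ ps _ _ ⟩
        𝔼 ps (λ X → c * (2ℚ ^ (∣ X ∣ ℕ.+ a) * prod θ (finish X ss))) + 𝔼 ps (λ X → sumFin (λ i → prodAt i φ ψ (finish X ss)))
          ≤⟨ +-mono-≤ (𝔼-mono (probs p-prob ss) (λ X → ≤-reflexive (regroup X))) (≤-reflexive (𝔼-sumFin ps (λ i X → prodAt i φ ψ (finish X ss)))) ⟩
        𝔼 ps (λ X → c * 2ℚ ^ a * (weight X * prod θ (finish X ss))) + sumFin (λ i → 𝔼 ps (λ X → prodAt i φ ψ (finish X ss)))
          ≤⟨ +-mono-≤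
               (≤-trans (≤-reflexive (𝔼-* ps (c * 2ℚ ^ a) _))
                 (*-monoˡ (c * 2ℚ ^ a) (0≤* 0≤c (0≤^ 2ℚ (nonNegative⁻¹ 2ℚ) a)) (θ-supermartingale ls)))
               (sumFin-mono (λ i → φ-supermartingale i ls)) ⟩
        c * 2ℚ ^ a * prod θ ss + sumFin (λ i → prodAt i φ ψ ss)
          ≡⟨ cong (_+ _) (*-assoc c (2ℚ ^ a) (prod θ ss)) ⟩
        potential a ss ∎
        where
        ps = map p ss
        regroup : ∀ X → c * (2ℚ ^ (∣ X ∣ ℕ.+ a) * prod θ (finish X ss)) ≡ c * 2ℚ ^ a * (weight X * prod θ (finish X ss))
        regroup X = trans (cong (λ z → c * (z * Θ)) (^-+ 2ℚ ∣ X ∣ a))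
          (solve 4 (λ c w a t → c :* (w :* a :* t) := c :* a :* (w :* t)) refl c (weight X) (2ℚ ^ a) Θ)
          where Θ = prod θ (finish X ss)

      potential-nonneg : ∀ {k} a (ss : Vec Status k) → 0ℚ ≤ potential a ss
      potential-nonneg a ss = 0≤+
        (0≤* 0≤c (0≤* (0≤^ 2ℚ (nonNegative⁻¹ 2ℚ) a) (prod-nonneg (All.universal 0≤θ ss))))
        (sumFin-nonneg (λ i → prodAt-nonneg i (0≤φ _) (All.universal 0≤ψ ss)))

      all-live-or-high : ∀ {k} c′ a (X : Subset k) {ss} → All Live ss →
        let ss′ = zipWith (endRound c′) X ss in All Live ss′ ⊎ 1ℚ ≤ potential a ss′
      all-live-or-high {k} c′ a X {ss} ls with go X ls
        where
        1≤prod : ∀ {k} (ss : Vec Status k) → 1ℚ ≤ prod ψ ss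
        1≤prod []       = ≤-refl
        1≤prod (s ∷ ss) = *-mono-≤ (0≤ψ s) 0≤1 (1≤ψ s) (1≤prod ss)
        go : ∀ {k} (X : Subset k) {ss} → All Live ss → let ss′ = zipWith (endRound c′) X ss in
          All Live ss′ ⊎ (Σ[ i ∈ Fin k ] 1ℚ ≤ prodAt i φ ψ ss′)
        go [] [] = inj₁ []
        go (x ∷ X) {s ∷ ss} (l ∷ ls) with live-end l c′ x | go X ls
        ... | inj₁ l′ | inj₁ ls′     = inj₁ (l′ ∷ ls′)
        ... | inj₁ l′ | inj₂ (i , h) = inj₂ (suc i , *-mono-≤ (0≤ψ _) 0≤1 (1≤ψ _) h)
        ... | inj₂ h  | _            = inj₂ (zero , *-mono-≤ (0≤φ _) 0≤1 h (1≤prod (zipWith (endRound c′) X ss)))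
      ... | inj₁ ls′     = inj₁ ls′
      ... | inj₂ (i , h) = inj₂ (≤-trans h (≤-trans
        (≤-sumFin (λ i → prodAt-nonneg i (0≤φ _) (All.universal 0≤ψ _)) i)
        (p≤q+p (0≤* 0≤c (0≤* (0≤^ 2ℚ (nonNegative⁻¹ 2ℚ) a)
          (prod-nonneg (All.universal 0≤θ (zipWith (endRound c′) X ss))))))))

      module _ (K : ℕ) (c-K : 1ℚ ≤ c * 2ℚ ^ K) {k : ℕ} (adv : Adversary k) where

        fewAttempts : History k → Bool
        fewAttempts h = attempts h ≤ᵇ K

        -- Markov's inequality with stopping, by induction on the remaining rounds. If a station
        -- leaves the live range, the potential is at least 1 and the left-hand side is at most 0;
        -- the same happens at the end if the attempts exceed `K`.
        few-likely : ∀ n h → All Live (statuses h) →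
          1ℚ - potential (attempts h) (statuses h) ≤ after p adv n h (λ h → indicator (fewAttempts h))
        few-likely zero h ls with attempts h ≤ᵇ K in eq
        ... | true  = ≤-by (potential (attempts h) (statuses h)) (potential-nonneg (attempts h) (statuses h))
          (solve 1 (λ w → con 1ℚ :- w :+ w := con 1ℚ) refl (potential (attempts h) (statuses h)))
        ... | false = ≤-trans (-antimono {c = 1ℚ} many) (≤-reflexive (+-inverseʳ 1ℚ))
          where
          K≤a : K ℕ.≤ attempts h
          K≤a = ℕₚ.<⇒≤ (ℕₚ.≰⇒> (λ le → subst T eq (ℕₚ.≤⇒≤ᵇ le)))
          1≤prod : ∀ {k} {ss : Vec Status k} → All Live ss → 1ℚ ≤ prod θ ss
          1≤prod []       = ≤-refl
          1≤prod {ss = s ∷ _} (l ∷ ls) = *-mono-≤ (0≤θ s) 0≤1 (1≤θ l) (1≤prod ls)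
          many : 1ℚ ≤ potential (attempts h) (statuses h)
          many = begin
            1ℚ                                                  ≤⟨ c-K ⟩
            c * 2ℚ ^ K                                          ≤⟨ *-monoˡ c 0≤c (^-monoʳ (≤-by 1ℚ 0≤1 refl) K≤a) ⟩
            c * 2ℚ ^ attempts h                                 ≡⟨ cong (c *_) (sym (*-identityʳ _)) ⟩
            c * (2ℚ ^ attempts h * 1ℚ)                          ≤⟨ *-monoˡ c 0≤c (*-monoˡ (2ℚ ^ attempts h) (0≤^ 2ℚ (nonNegative⁻¹ 2ℚ) (attempts h)) (1≤prod ls)) ⟩
            c * (2ℚ ^ attempts h * prod θ (statuses h))         ≤⟨ ≤-by _ (sumFin-nonneg (λ i → prodAt-nonneg i (0≤φ _) (All.universal 0≤ψ (statuses h)))) refl ⟩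
            potential (attempts h) (statuses h)                 ∎
        few-likely (suc n) h ls = begin
          1ℚ - potential (attempts h) (statuses h)
            ≡⟨ cong (λ z → 1ℚ - z) (sym (potential-activate (attempts h) (adv h) (statuses h))) ⟩
          1ℚ - potential (attempts h) ss
            ≤⟨ -antimono {c = 1ℚ} (potential-supermartingale (attempts h) ls′) ⟩
          1ℚ - 𝔼 (map p ss) (λ X → potential (∣ X ∣ ℕ.+ attempts h) (finish X ss))
            ≡⟨ sym (𝔼-1- (map p ss) _) ⟩
          𝔼 (map p ss) (λ X → 1ℚ - potential (∣ X ∣ ℕ.+ attempts h) (finish X ss))
            ≤⟨ 𝔼-mono (probs p-prob ss) next ⟩
          after p adv (suc n) h (λ h → indicator (fewAttempts h)) ∎
          where
          ss = zipWith activate (adv h) (statuses h)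
          ls′ : All Live ss
          ls′ = activate-live (adv h) ls
            where
            activate-live : ∀ {k} (A : Subset k) {ss} → All Live ss → All Live (zipWith activate A ss)
            activate-live []      []       = []
            activate-live (x ∷ A) (l ∷ ls) = live-activate x l ∷ activate-live A ls
          next : ∀ X → 1ℚ - potential (∣ X ∣ ℕ.+ attempts h) (finish X ss) ≤
            after p adv n (mkRound (adv h) X ∷ h) (λ h → indicator (fewAttempts h))
          next X with all-live-or-high (∣ X ∣ ≡ᵇ 1) (∣ X ∣ ℕ.+ attempts h) X ls′
          ... | inj₁ ls″ = few-likely n (mkRound (adv h) X ∷ h) ls″
          ... | inj₂ hi  = ≤-trans (-antimono {c = 1ℚ} hi) (≤-trans (≤-reflexive (+-inverseʳ 1ℚ))
            (after-nonneg adv p-prob n _ _ (λ h → indicator-nonneg (fewAttempts h))))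

  -- The concrete potentials of a station.

  transmitApprox : (b : ℕ) → .{{NonZero b}} → (ℕ → ℚ) → Status → ℚ
  -- The argument `m` of `lnApprox` stands for phase `3 + m`, whose inverse is `recip (2 + m)`.
  transmitApprox b lnApprox (active (suc r)) = lnApprox (r ℕ./ b) * recip (2 ℕ.+ r ℕ./ b)
  transmitApprox b lnApprox _                = 0ℚ

  module StationPotentials (b : ℕ) .{{_ : NonZero b}} (k V R′ T′ : ℕ) (lnApprox : ℕ → ℚ)
    (ln-nonneg : ∀ m → 0ℚ ≤ lnApprox m)
    (ln-linear : ∀ m → lnApprox m ≤ ι (3 ℕ.+ m))
    (ln-upper  : ∀ m → m ℕ.≤ T′ → lnApprox m ≤ ι V)
    (m₀ : ℕ) (ln-lower : ∀ m → m₀ ℕ.≤ m → ι 3 ≤ lnApprox m)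
    (R-large₀ : m₀ ℕ.* b ℕ.≤ R′)
    (R-large₁ : 2 ℕ.* (V ℕ.* b) ℕ.≤ suc R′)
    (R-large₂ : 4 ℕ.* k ℕ.* (V ℕ.* b) ℕ.* (V ℕ.* b) ℕ.≤ suc R′)
    where

    -- A station of local age t transmits with probability at most n / t before the horizon T₁,
    -- and with probability at least 2 / (t + 1) from age R on.  In a round where the station under
    -- observation is older than R, ε bounds its own transmission probability.
    R T₁ n : ℕ
    R  = suc R′
    T₁ = suc T′
    n  = V ℕ.* b

    p : Status → ℚ
    p = transmitApprox b lnApprox

    p-prob : ∀ s → Prob (p s)
    p-prob asleep           = ≤-refl , 0≤1
    p-prob off              = ≤-refl , 0≤1
    p-prob (active zero)    = ≤-refl , 0≤1
    p-prob (active (suc r)) = 0≤* (ln-nonneg m) (recip-nonneg (2 ℕ.+ m)) ,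
      ≤-trans (*-monoʳ (recip (2 ℕ.+ m)) (recip-nonneg (2 ℕ.+ m)) (ln-linear m)) (≤-reflexive (ι-recip (2 ℕ.+ m)))
      where m = r ℕ./ b

    -- Age `r + 1` falls into phase `3 + m` with `m = r / b`, hence `r + 1 ≤ b * (3 + m)`, and
    -- `V / (3 + m)` is at most `V b / (r + 1)`.
    p-upper : ∀ r → r ℕ.≤ T′ → p (active (suc r)) ≤ ι n * recip r
    p-upper r r≤T′ = ≤-trans
      (*-monoʳ (recip (2 ℕ.+ m)) (recip-nonneg (2 ℕ.+ m)) (ln-upper m (ℕₚ.≤-trans (ℕₚ.m/n≤m r b) r≤T′)))
      (recip-mono V n (ℕₚ.≤-trans (ℕₚ.*-monoʳ-≤ V suc-r≤) (ℕₚ.≤-reflexive (sym (ℕₚ.*-assoc V b (3 ℕ.+ m))))))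
      where
      m = r ℕ./ b
      suc-r≤ : suc r ℕ.≤ b ℕ.* (3 ℕ.+ m)
      suc-r≤ = ℕₚ.≤-trans
        (subst (λ z → suc z ℕ.≤ b ℕ.+ m ℕ.* b) (sym (ℕₚ.m≡m%n+[m/n]*n r b)) (ℕₚ.+-monoˡ-≤ (m ℕ.* b) (ℕₚ.m%n<n r b)))
        (ℕₚ.≤-trans (ℕₚ.*-monoˡ-≤ b (ℕₚ.n≤1+n (suc m)))
          (ℕₚ.≤-trans (ℕₚ.*-monoˡ-≤ b (ℕₚ.n≤1+n (suc (suc m)))) (ℕₚ.≤-reflexive (ℕₚ.*-comm (3 ℕ.+ m) b))))

    -- The crude bound `r / b ≤ r` gives `3 / (3 + r)`. Having 3 in the numerator leaves room to
    -- shift the denominator to `2 + r`.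
    p-lower : ∀ r → R′ ℕ.≤ r → ι 2 * recip (suc r) ≤ p (active (suc r))
    p-lower r R′≤r = ≤-trans
      (recip-mono 2 3 {suc r} {2 ℕ.+ r ℕ./ b} (ℕₚ.≤-trans (ℕₚ.*-monoʳ-≤ 2 (ℕₚ.+-monoʳ-≤ 3 (ℕₚ.m/n≤m r b))) 2[3+r]≤3[2+r]))
      (*-monoʳ (recip (2 ℕ.+ m)) (recip-nonneg (2 ℕ.+ m)) (ln-lower m m₀≤m))
      where
      m = r ℕ./ b
      m₀≤m : m₀ ℕ.≤ m
      m₀≤m = subst (ℕ._≤ m) (ℕₚ.m*n/n≡m m₀ b) (ℕₚ./-monoˡ-≤ b (ℕₚ.≤-trans R-large₀ R′≤r))
      2[3+r]≤3[2+r] : 2 ℕ.* (3 ℕ.+ r) ℕ.≤ 3 ℕ.* (2 ℕ.+ r)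
      2[3+r]≤3[2+r] = subst (2 ℕ.* (3 ℕ.+ r) ℕ.≤_) (expand r) (ℕₚ.m≤m+n (2 ℕ.* (3 ℕ.+ r)) r)
        where
        expand : ∀ r → 2 ℕ.* (3 ℕ.+ r) ℕ.+ r ≡ 3 ℕ.* (2 ℕ.+ r)
        expand = solve-∀

    -- `y / t` bounds `2 * ε * p` at age `t` before the horizon and is the surcharge of a competitor
    -- of that age.
    ε y : ℚ
    ε = ι n * recip R′
    y = 2ℚ * ε * ι n

    0≤ε : 0ℚ ≤ ε
    0≤ε = 0≤* (ι-nonneg n) (recip-nonneg R′)

    0≤y : 0ℚ ≤ y
    0≤y = 0≤* (0≤* (nonNegative⁻¹ 2ℚ) 0≤ε) (ι-nonneg n)

    ε≤½ : ε ≤ ½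
    ε≤½ = ≤-trans (recip-mono n 1 {R′} {1} (ℕₚ.≤-trans (ℕₚ.≤-reflexive (ℕₚ.*-comm n 2))
      (ℕₚ.≤-trans R-large₁ (ℕₚ.≤-reflexive (sym (ℕₚ.*-identityˡ R)))))) ≤-refl

    -- This is where `R ≥ 4 k n²` enters: the surcharges of `k` competitors of equal age `t` then
    -- multiply to at most `1 + 1/t`.
    2ky≤1 : 2ℚ * ι k * y ≤ 1ℚ
    2ky≤1 = begin
      2ℚ * ι k * (2ℚ * (ι n * recip R′) * ι n)     ≡⟨ solve 3 (λ k n r → con 2ℚ :* k :* (con 2ℚ :* (n :* r) :* n) := con (ι 4) :* k :* n :* n :* r) refl (ι k) (ι n) (recip R′) ⟩
      ι 4 * ι k * ι n * ι n * recip R′             ≡⟨ cong (_* recip R′) (sym (trans (ι-* (4 ℕ.* k ℕ.* n) n)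
                                                         (cong (_* ι n) (trans (ι-* (4 ℕ.* k) n) (cong (_* ι n) (ι-* 4 k)))))) ⟩
      ι (4 ℕ.* k ℕ.* n ℕ.* n) * recip R′           ≤⟨ *-monoʳ (recip R′) (recip-nonneg R′) (ι-mono R-large₂) ⟩
      ι R * recip R′                               ≡⟨ ι-recip R′ ⟩
      1ℚ                                           ∎

    -- `(T₁ / t) ^ n` is the telescoped product of `(1 + 1/t) ^ n` over the ages left before the
    -- horizon, and by Bernoulli each factor exceeds `1 + n/t`. Age zero has the value of age one
    -- because nothing is transmitted in local round 0.
    θ : Status → ℚ
    θ asleep           = ι T₁ ^ n
    θ (active zero)    = ι T₁ ^ n
    θ (active (suc r)) = (ι T₁ * recip r) ^ n
    θ off              = 1ℚ

    competition : ℕ → ℚ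
    competition zero    = 1ℚ
    competition (suc r) = 1ℚ + y * recip r

    ψ-remaining : ℕ → ℕ → ℚ
    ψ-remaining t zero    = 1ℚ
    ψ-remaining t (suc d) = competition t * ψ-remaining (suc t) d

    ψ : Status → ℚ
    ψ asleep     = ψ-remaining 0 T₁
    ψ (active t) = ψ-remaining t (T₁ ℕ.∸ t)
    ψ off        = 1ℚ

    -- Flat up to age `R`, then quadratic, and at least 1 at the horizon. The exponent 2 matches the
    -- lower bound `2 / (t + 1)` on the transmission probability.
    φ : Status → ℚ
    φ asleep     = (ι R * recip T′) ^ 2
    φ (active t) = (ι (t ℕ.⊔ R) * recip T′) ^ 2
    φ off        = 0ℚ

    Live : Status → Set
    Live (active t) = t ℕ.< T₁
    Live _          = ⊤

    0≤T/ : ∀ r → 0ℚ ≤ ι T₁ * recip r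
    0≤T/ r = 0≤* (ι-nonneg T₁) (recip-nonneg r)

    1≤T : 1ℚ ≤ ι T₁
    1≤T = ι-mono {1} {T₁} (ℕ.s≤s ℕ.z≤n)

    1≤T/ : ∀ {r} → r ℕ.≤ T′ → 1ℚ ≤ ι T₁ * recip r
    1≤T/ {r} h = ≤-trans (≤-reflexive (sym (ι-recip r))) (*-monoʳ (recip r) (recip-nonneg r) (ι-mono (ℕ.s≤s h)))

    0≤θ : ∀ s → 0ℚ ≤ θ s
    0≤θ asleep           = 0≤^ (ι T₁) (ι-nonneg T₁) n
    0≤θ (active zero)    = 0≤^ (ι T₁) (ι-nonneg T₁) n
    0≤θ (active (suc r)) = 0≤^ (ι T₁ * recip r) (0≤T/ r) n
    0≤θ off              = 0≤1

    1≤θ : ∀ {s} → Live s → 1ℚ ≤ θ s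
    1≤θ {asleep}         l = 1≤^ n 1≤T
    1≤θ {active zero}    l = 1≤^ n 1≤T
    1≤θ {active (suc r)} l = 1≤^ n (1≤T/ (ℕₚ.<⇒≤ (ℕₚ.≤-pred l)))
    1≤θ {off}            l = ≤-refl

    1≤competition : ∀ t → 1ℚ ≤ competition t
    1≤competition zero    = ≤-refl
    1≤competition (suc r) = ≤-by (y * recip r) (0≤* 0≤y (recip-nonneg r)) refl

    1≤ψ-remaining : ∀ t d → 1ℚ ≤ ψ-remaining t d
    1≤ψ-remaining t zero    = ≤-refl
    1≤ψ-remaining t (suc d) = *-mono-≤ (≤-trans 0≤1 (1≤competition t)) 0≤1 (1≤competition t) (1≤ψ-remaining (suc t) d)

    1≤ψ : ∀ s → 1ℚ ≤ ψ s
    1≤ψ asleep     = 1≤ψ-remaining 0 T₁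
    1≤ψ (active t) = 1≤ψ-remaining t (T₁ ℕ.∸ t)
    1≤ψ off        = ≤-refl

    0≤φ : ∀ s → 0ℚ ≤ φ s
    0≤φ asleep     = 0≤^ (ι R * recip T′) (0≤* (ι-nonneg R) (recip-nonneg T′)) 2
    0≤φ (active t) = 0≤^ (ι (t ℕ.⊔ R) * recip T′) (0≤* (ι-nonneg (t ℕ.⊔ R)) (recip-nonneg T′)) 2
    0≤φ off        = ≤-refl

    θ-end : ∀ {s} → Live s → ∀ c x → θ (endRound c x s) ≤ θ (advance s)
    θ-end {asleep}   l c     x     = ≤-refl
    θ-end {off}      l c     x     = ≤-refl
    θ-end {active t} l false x     = ≤-refl
    θ-end {active t} l true  false = ≤-refl
    θ-end {active t} l true  true  = 1≤^ n (1≤T/ (ℕₚ.≤-pred l))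

    ψ-end : ∀ {s} → Live s → ∀ c x → ψ (endRound c x s) ≤ ψ (advance s)
    ψ-end {asleep}   l c     x     = ≤-refl
    ψ-end {off}      l c     x     = ≤-refl
    ψ-end {active t} l false x     = ≤-refl
    ψ-end {active t} l true  false = ≤-refl
    ψ-end {active t} l true  true  = 1≤ψ (active (suc t))

    φ-end : ∀ {s} → Live s → ∀ c x → φ (endRound c x s) ≤ φ (advance s)
    φ-end {asleep}   l c     x     = ≤-refl
    φ-end {off}      l c     x     = ≤-refl
    φ-end {active t} l false x     = ≤-refl
    φ-end {active t} l true  false = ≤-refl
    φ-end {active t} l true  true  = 0≤φ (active (suc t))

    unchanged : ∀ e {f g} → f ≡ g → e ≡ 0ℚ → (1ℚ + e) * f ≤ g
    unchanged e {f} refl refl = ≤-reflexive (*-identityˡ f)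

    θ-drift : ∀ {s} → Live s → (1ℚ + p s) * θ (advance s) ≤ θ s
    θ-drift {asleep}         l = unchanged 0ℚ refl refl
    θ-drift {off}            l = unchanged 0ℚ refl refl
    θ-drift {active zero}    l = unchanged 0ℚ (cong (_^ n) (*-identityʳ (ι T₁))) refl
    θ-drift {active (suc r)} l = begin
      (1ℚ + p (active (suc r))) * (ι T₁ * recip (suc r)) ^ n
        ≤⟨ *-monoʳ _ (0≤^ _ (0≤T/ (suc r)) n) (≤-trans
             (+-monoʳ-≤ 1ℚ (p-upper r (ℕₚ.<⇒≤ (ℕₚ.≤-pred l)))) (bernoulli n (recip-nonneg r))) ⟩
      (1ℚ + recip r) ^ n * (ι T₁ * recip (suc r)) ^ n
        ≡⟨ sym (^-* (1ℚ + recip r) (ι T₁ * recip (suc r)) n) ⟩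
      ((1ℚ + recip r) * (ι T₁ * recip (suc r))) ^ n
        ≡⟨ cong (_^ n) (trans (solve 3 (λ a t b → a :* (t :* b) := t :* (a :* b)) refl (1ℚ + recip r) (ι T₁) (recip (suc r)))
             (cong (ι T₁ *_) (sym (recip-suc r)))) ⟩
      (ι T₁ * recip r) ^ n ∎

    ψ-drift : ∀ {s} → Live s → (1ℚ + 2ℚ * ε * p s) * ψ (advance s) ≤ ψ s
    ψ-drift {asleep}   l = unchanged (2ℚ * ε * 0ℚ) refl (*-zeroʳ (2ℚ * ε))
    ψ-drift {off}      l = unchanged (2ℚ * ε * 0ℚ) refl (*-zeroʳ (2ℚ * ε))
    ψ-drift {active t} l = ≤-trans
      (*-monoʳ (ψ-remaining (suc t) (T₁ ℕ.∸ suc t)) (≤-trans 0≤1 (1≤ψ-remaining (suc t) (T₁ ℕ.∸ suc t))) (factor t l))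
      (≤-reflexive (cong (ψ-remaining t) (sym (ℕₚ.+-∸-assoc 1 l))))
      where
      factor : ∀ t → t ℕ.< T₁ → 1ℚ + 2ℚ * ε * p (active t) ≤ competition t
      factor zero    l = ≤-reflexive (trans (cong (1ℚ +_) (*-zeroʳ (2ℚ * ε))) (+-identityʳ 1ℚ))
      factor (suc r) l = +-monoʳ-≤ 1ℚ (≤-trans
        (*-monoˡ (2ℚ * ε) (0≤* (nonNegative⁻¹ 2ℚ) 0≤ε) (p-upper r (ℕₚ.<⇒≤ (ℕₚ.≤-pred l))))
        (≤-reflexive (sym (*-assoc (2ℚ * ε) (ι n) (recip r)))))

    φ-flat : ∀ t → t ℕ.≤ R′ → φ (active (suc t)) ≤ φ (active t)
    φ-flat t t≤R′ = ≤-reflexive (cong (λ z → (ι z * recip T′) ^ 2)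
      (trans (ℕₚ.m≤n⇒m⊔n≡n (ℕ.s≤s t≤R′)) (sym (ℕₚ.m≤n⇒m⊔n≡n (ℕₚ.m≤n⇒m≤1+n t≤R′)))))

    -- At age `t = r + 1` the probability is at least `2 / (t + 1)`, and
    -- `(1 - 2/(t + 1)) (t + 1)² = t² - 1`.
    φ-drop : ∀ r → R′ ℕ.≤ r → (1ℚ - p (active (suc r))) * φ (active (suc (suc r))) ≤ φ (active (suc r))
    φ-drop r R′≤r = drift
      where
      R≤t : R ℕ.≤ suc r
      R≤t = ℕ.s≤s R′≤r
      t = ι (suc r)
      w = recip T′
      square-drop : (1ℚ - p (active (suc r))) * ι (suc (suc r)) ^ 2 ≤ t ^ 2
      square-drop = begin
        (1ℚ - p (active (suc r))) * ι (suc (suc r)) ^ 2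
          ≤⟨ *-monoʳ _ (0≤^ _ (ι-nonneg (suc (suc r))) 2) (-antimono {c = 1ℚ} (p-lower r R′≤r)) ⟩
        (1ℚ - ι 2 * recip (suc r)) * ι (suc (suc r)) ^ 2
          ≡⟨ solve 2 (λ s u → (con 1ℚ :- con (ι 2) :* u) :* (s :* (s :* con 1ℚ)) := s :* s :- con (ι 2) :* (s :* u) :* s) refl (ι (suc (suc r))) (recip (suc r)) ⟩
        ι (suc (suc r)) * ι (suc (suc r)) - ι 2 * (ι (suc (suc r)) * recip (suc r)) * ι (suc (suc r))
          ≡⟨ cong₂ (λ s u → s * s - ι 2 * u * s) (ι-suc (suc r)) (ι-recip (suc r)) ⟩
        (1ℚ + t) * (1ℚ + t) - ι 2 * 1ℚ * (1ℚ + t)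
          ≤⟨ ≤-by 1ℚ 0≤1 (solve 1 (λ t → (con 1ℚ :+ t) :* (con 1ℚ :+ t) :- con (ι 2) :* con 1ℚ :* (con 1ℚ :+ t) :+ con 1ℚ := t :* (t :* con 1ℚ)) refl t) ⟩
        t ^ 2 ∎
      drift : (1ℚ - p (active (suc r))) * (ι (suc (suc r) ℕ.⊔ R) * w) ^ 2 ≤ (ι (suc r ℕ.⊔ R) * w) ^ 2
      drift = begin
        (1ℚ - p (active (suc r))) * (ι (suc (suc r) ℕ.⊔ R) * w) ^ 2
          ≡⟨ cong (λ z → (1ℚ - p (active (suc r))) * (ι z * w) ^ 2) (ℕₚ.m≥n⇒m⊔n≡m (ℕₚ.m≤n⇒m≤1+n R≤t)) ⟩
        (1ℚ - p (active (suc r))) * (ι (suc (suc r)) * w) ^ 2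
          ≡⟨ trans (cong ((1ℚ - p (active (suc r))) *_) (^-* (ι (suc (suc r))) w 2)) (sym (*-assoc (1ℚ - p (active (suc r))) _ _)) ⟩
        (1ℚ - p (active (suc r))) * ι (suc (suc r)) ^ 2 * w ^ 2
          ≤⟨ *-monoʳ (w ^ 2) (0≤^ w (recip-nonneg T′) 2) square-drop ⟩
        t ^ 2 * w ^ 2
          ≡⟨ trans (sym (^-* t w 2)) (cong (λ z → (ι z * w) ^ 2) (sym (ℕₚ.m≥n⇒m⊔n≡m R≤t))) ⟩
        (ι (suc r ℕ.⊔ R) * w) ^ 2 ∎

    φ-drift : ∀ {s} → Live s → φ (advance s) ≤ φ s ⊎
      (p s ≤ ε × (Σ[ r ∈ ℕ ] s ≡ active r) × (1ℚ - p s) * φ (advance s) ≤ φ s)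
    φ-drift {asleep}         l = inj₁ ≤-refl
    φ-drift {off}            l = inj₁ ≤-refl
    φ-drift {active zero}    l = inj₁ (φ-flat zero ℕ.z≤n)
    φ-drift {active (suc r)} l = Sum.map (φ-flat (suc r))
      (λ R′≤r → ≤-trans (p-upper r (ℕₚ.<⇒≤ (ℕₚ.≤-pred l))) (recip-mono n n {r} {R′} (ℕₚ.*-monoʳ-≤ n (ℕ.s≤s R′≤r)))
        , (suc r , refl) , φ-drop r R′≤r)
      (ℕₚ.<-≤-connex r R′)

    live-end : ∀ {s} → Live s → ∀ c x → Live (endRound c x s) ⊎ 1ℚ ≤ φ (endRound c x s)
    live-end {asleep}   l c     x     = inj₁ tt
    live-end {off}      l c     x     = inj₁ tt
    live-end {active t} l true  true  = inj₁ tt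
    live-end {active t} l true  false = horizon t l
      where
      horizon : ∀ t → t ℕ.< T₁ → Live (active (suc t)) ⊎ 1ℚ ≤ φ (active (suc t))
      horizon t l = Sum.map₂ (λ { refl → 1≤^ 2 (≤-trans (≤-reflexive (sym (ι-recip t)))
        (*-monoʳ (recip t) (recip-nonneg t) (ι-mono {suc t} {suc t ℕ.⊔ R} (ℕₚ.m≤m⊔n (suc t) R)))) })
        (ℕₚ.m≤n⇒m<n∨m≡n l)
    live-end {active t} l false x     = live-end {active t} l true false

    potentials : Potentials
    potentials = record
      { p = p ; θ = θ ; ψ = ψ ; φ = φ ; Live = Live ; ε = ε
      ; 0≤ε = 0≤ε ; ε≤½ = ε≤½ ; p-prob = p-prob ; 0≤θ = 0≤θ ; 1≤ψ = 1≤ψ ; 1≤θ = λ {s} → 1≤θ {s} ; 0≤φ = 0≤φ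
      ; θ-activate = λ { true asleep → refl ; true (active _) → refl ; true off → refl ; false _ → refl }
      ; ψ-activate = λ { true asleep → refl ; true (active _) → refl ; true off → refl ; false _ → refl }
      ; φ-activate = λ { true asleep → refl ; true (active _) → refl ; true off → refl ; false _ → refl }
      ; live-activate = λ { true {asleep} l → ℕ.s≤s ℕ.z≤n ; true {active _} l → l ; true {off} l → l ; false l → l }
      ; live-end = λ {s} → live-end {s}
      ; φ-off = refl
      ; θ-end = λ {s} → θ-end {s} ; ψ-end = λ {s} → ψ-end {s} ; φ-end = λ {s} → φ-end {s}
      ; θ-drift = λ {s} → θ-drift {s} ; ψ-drift = λ {s} → ψ-drift {s} ; φ-drift = λ {s} → φ-drift {s}
      }

    -- (1 + y/(r+1))ᵏ ≤ 1 + 1/(r+1), and the product of the right-hand sides telescopes.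
    ψ-remaining^k : ∀ r d → ψ-remaining (suc r) d ^ k ≤ ι (suc r ℕ.+ d) * recip r
    ψ-remaining^k r zero = ≤-trans (≤-reflexive (1^ k))
      (≤-reflexive (sym (trans (cong (λ z → ι z * recip r) (ℕₚ.+-identityʳ (suc r))) (ι-recip r))))
      where
      1^ : ∀ k → 1ℚ ^ k ≡ 1ℚ
      1^ zero    = refl
      1^ (suc k) = trans (*-identityˡ _) (1^ k)
    ψ-remaining^k r (suc d) = begin
      ((1ℚ + x) * rest) ^ k                        ≡⟨ ^-* (1ℚ + x) rest k ⟩
      (1ℚ + x) ^ k * rest ^ k                      ≤⟨ *-mono-≤ (0≤+ 0≤1 (recip-nonneg r)) (0≤^ rest (≤-trans 0≤1 (1≤ψ-remaining (suc (suc r)) d)) k)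
                                                        (≤-trans (reverse-bernoulli k 0≤x (≤-trans 2kx≤ (recip≤1 r))) (+-monoʳ-≤ 1ℚ 2kx≤))
                                                        (ψ-remaining^k (suc r) d) ⟩
      (1ℚ + recip r) * (ι (suc (suc r) ℕ.+ d) * recip (suc r))
        ≡⟨ solve 3 (λ a t b → a :* (t :* b) := t :* (a :* b)) refl (1ℚ + recip r) (ι (suc (suc r) ℕ.+ d)) (recip (suc r)) ⟩
      ι (suc (suc r) ℕ.+ d) * ((1ℚ + recip r) * recip (suc r))
        ≡⟨ cong₂ (λ z u → ι z * u) (sym (ℕₚ.+-suc (suc r) d)) (sym (recip-suc r)) ⟩
      ι (suc r ℕ.+ suc d) * recip r                ∎
      where
      x    = y * recip r
      rest = ψ-remaining (suc (suc r)) d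
      0≤x : 0ℚ ≤ x
      0≤x = 0≤* 0≤y (recip-nonneg r)
      2kx≤ : 2ℚ * ι k * x ≤ recip r
      2kx≤ = ≤-trans (≤-reflexive (sym (*-assoc (2ℚ * ι k) y (recip r))))
        (≤-trans (*-monoʳ (recip r) (recip-nonneg r) 2ky≤1) (≤-reflexive (*-identityˡ (recip r))))

    ψ-asleep^k : ψ asleep ^ k ≤ ι T₁
    ψ-asleep^k = ≤-trans (≤-reflexive (cong (_^ k) (*-identityˡ (ψ-remaining 1 T′))))
      (≤-trans (ψ-remaining^k 0 T′) (≤-reflexive (*-identityʳ (ι T₁))))

    prod-replicate : ∀ {A : Set} (f : A → ℚ) x k → prod f (replicate k x) ≡ f x ^ k
    prod-replicate f x zero    = refl
    prod-replicate f x (suc k) = cong (f x *_) (prod-replicate f x k)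

    -- The observed station is granted an extra factor `g x`, so that the exponent becomes the `k`
    -- for which `ψ` has been bounded.
    prodAt-replicate : ∀ {A : Set} {f g : A → ℚ} {x} {k} (i : Fin k) → 0ℚ ≤ f x → 1ℚ ≤ g x →
      prodAt i f g (replicate k x) ≤ f x * g x ^ k
    prodAt-replicate {f = f} {g} {x} {suc k} zero 0≤f 1≤g = *-monoˡ (f x) 0≤f
      (≤-trans (≤-reflexive (trans (prod-replicate g x k) (sym (*-identityˡ _))))
        (*-monoʳ (g x ^ k) (0≤^ (g x) (≤-trans 0≤1 1≤g) k) 1≤g))
    prodAt-replicate {f = f} {g} {x} {suc k} (suc i) 0≤f 1≤g = ≤-trans
      (*-monoˡ (g x) (≤-trans 0≤1 1≤g) (prodAt-replicate i 0≤f 1≤g))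
      (≤-reflexive (solve 3 (λ a b c → a :* (b :* c) := b :* (a :* c)) refl (g x) (f x) (g x ^ k)))

    open Drift potentials using (potential)

    initial-potential : ∀ c 0≤c → potential c 0≤c 0 (replicate k asleep) ≤
      c * (ι T₁ ^ n) ^ k + ι k * ((ι R * recip T′) ^ 2 * ι T₁)
    initial-potential c 0≤c = +-mono-≤
      (≤-reflexive (cong (c *_) (trans (*-identityˡ _) (prod-replicate θ asleep k))))
      (≤-trans (sumFin-mono (λ i → ≤-trans (prodAt-replicate {f = φ} {ψ} {asleep} {k} i (0≤φ asleep) (1≤ψ asleep)) (*-monoˡ (φ asleep) (0≤φ asleep) ψ-asleep^k)))
        (≤-reflexive (sumFin-const k ((ι R * recip T′) ^ 2 * ι T₁))))

  -- The bound for the chosen parameters.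

  module _ (b M L k : ℕ) .{{_ : NonZero b}} (1≤b : 1 ℕ.≤ b) (1≤k : 1 ℕ.≤ k) (k≤ : k ℕ.≤ 2 ℕ.^ suc L)
      {I : ℕ} (I-large : 2 ℕ.^ 12 ℕ.≤ I) where

    open Parameters b M L k 1≤b 1≤k k≤

    ln₃ : ℕ → ℚ
    ln₃ m = lnApprox I (2 ℕ.+ m)

    ln-lower : ∀ m → 2 ℕ.^ 12 ℕ.≤ m → ι 3 ≤ ln₃ m
    -- Twelve doublings, each adding at least 1/4, make the logarithm at least 3.
    ln-lower m h = *-cancelˡ-≤-pos (ι 4) (lnApprox-lower {I} {2 ℕ.+ m} 12 (ℕₚ.m≤n⇒m≤o+n 3 h) I-large)

    open StationPotentials b k V R′ T′ ln₃ (λ m → lnApprox-nonneg I (2 ℕ.+ m))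
      (λ m → lnApprox-upper I {2 ℕ.+ m} (3 ℕ.+ m) (n≤2^n (3 ℕ.+ m)))
      (λ m m≤T′ → lnApprox-upper I {2 ℕ.+ m} V (phase-range m m≤T′))
      (2 ℕ.^ 12) ln-lower R-large₀ R-large₁ R-large₂
      using (potentials; initial-potential)
    open Drift potentials

    -- Initially the `θ` product is `2 ^ (D n k)`, and `K` exceeds that exponent by `X`. The station
    -- part is at most `k (R/T)² T = k R² / T`, which `X+Y≤D` bounds by `½ ^ X` too.
    initial≤ : potential (½ ^ K) (0≤½^ K) 0 (replicate k asleep) ≤ ½ ^ (M ℕ.* s)
    initial≤ = begin
      potential (½ ^ K) (0≤½^ K) 0 (replicate k asleep)
        ≤⟨ initial-potential (½ ^ K) (0≤½^ K) ⟩
      ½ ^ K * (ι (suc T′) ^ n) ^ k + ι k * ((ι R * recip T′) ^ 2 * ι (suc T′))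
        ≤⟨ +-mono-≤ (≤-reflexive attempts-part) stations-part ⟩
      ½ ^ X + ½ ^ X
        ≡⟨ solve 1 (λ a → con ½ :* a :+ con ½ :* a := a) refl (½ ^ (M ℕ.* s)) ⟩
      ½ ^ (M ℕ.* s) ∎
      where
      T-power : (ι (suc T′) ^ n) ^ k ≡ ι (2 ℕ.^ (D ℕ.* n ℕ.* k))
      T-power = trans (cong (λ z → (ι z ^ n) ^ k) suc-T′)
        (trans (cong (_^ k) (sym (ι-^ (2 ℕ.^ D) n)))
          (trans (sym (ι-^ ((2 ℕ.^ D) ℕ.^ n) k))
            (cong ι (trans (cong (ℕ._^ k) (ℕₚ.^-*-assoc 2 D n)) (ℕₚ.^-*-assoc 2 (D ℕ.* n) k)))))
      attempts-part : ½ ^ K * (ι (suc T′) ^ n) ^ k ≡ ½ ^ X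
      attempts-part = trans (cong₂ _*_ (^-+ ½ (D ℕ.* n ℕ.* k) X) T-power)
        (trans (solve 3 (λ a b c → a :* b :* c := a :* c :* b) refl (½ ^ (D ℕ.* n ℕ.* k)) (½ ^ X) (ι (2 ℕ.^ (D ℕ.* n ℕ.* k))))
          (trans (cong (_* ½ ^ X) (½^-2^ (D ℕ.* n ℕ.* k))) (*-identityˡ (½ ^ X))))
      stations-part : ι k * ((ι R * recip T′) ^ 2 * ι (suc T′)) ≤ ½ ^ X
      stations-part = begin
        ι k * ((ι R * recip T′) ^ 2 * ι (suc T′))
          ≡⟨ solve 4 (λ k r w t → k :* (r :* w :* (r :* w :* con 1ℚ) :* t) := k :* (r :* r) :* (w :* (t :* w))) refl (ι k) (ι R) (recip T′) (ι (suc T′)) ⟩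
        ι k * (ι R * ι R) * (recip T′ * (ι (suc T′) * recip T′))
          ≡⟨ cong₂ _*_ (sym (trans (ι-* k (R ℕ.* R)) (cong (ι k *_) (ι-* R R))))
               (trans (cong (recip T′ *_) (ι-recip T′)) (*-identityʳ (recip T′))) ⟩
        ι (k ℕ.* (R ℕ.* R)) * recip T′
          ≤⟨ *-mono-≤ (ι-nonneg (2 ℕ.^ Y)) (recip-nonneg T′) (ι-mono kR²≤)
               (≤-trans (recip≤½^ {T′} D (ℕₚ.≤-reflexive (sym suc-T′))) (½^-anti X+Y≤D)) ⟩
        ι (2 ℕ.^ Y) * ½ ^ (X ℕ.+ Y)
          ≡⟨ trans (cong (ι (2 ℕ.^ Y) *_) (^-+ ½ X Y)) (solve 3 (λ t x y → t :* (x :* y) := x :* (y :* t)) refl (ι (2 ℕ.^ Y)) (½ ^ X) (½ ^ Y)) ⟩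
        ½ ^ X * (½ ^ Y * ι (2 ℕ.^ Y))
          ≡⟨ trans (cong (½ ^ X *_) (½^-2^ Y)) (*-identityʳ (½ ^ X)) ⟩
        ½ ^ X ∎

    few-attempts-likely : ∀ (adv : Adversary k) m →
      1ℚ - ½ ^ (M ℕ.* s) ≤ after (transmitApprox b ln₃) adv m [] (λ h → indicator (attempts h ≤ᵇ K))
    few-attempts-likely adv m = ≤-trans (-antimono {c = 1ℚ} initial≤)
      (few-likely (½ ^ K) (0≤½^ K) K (≤-reflexive (sym ½^K2^K)) adv m [] (all-asleep k))
      where
      all-asleep : ∀ k → All (Potentials.Live potentials) (replicate k asleep)
      all-asleep zero    = []
      all-asleep (suc k) = tt ∷ all-asleep k
      ½^K2^K : ½ ^ K * 2ℚ ^ K ≡ 1ℚ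
      ½^K2^K = trans (cong (½ ^ K *_) (sym (ι-^ 2 K))) (½^-2^ K)

open Process

-- Transfer from the rational approximants to the reals.

open import Defs
open RationalLemmas using (ι-mono; ι-*; ι-nonneg; 0≤*; *-mono-≤; cauchy-bounded; q≤∣q∣)

𝔼-cong : ∀ {k} (ps : Vec ℚ k) {f g} → (∀ X → f X ≡ g X) → 𝔼 ps f ≡ 𝔼 ps g
𝔼-cong []       h = h []
𝔼-cong (p ∷ ps) h = cong₂ (λ u v → p ℚ.* u ℚ.+ (1ℚ ℚ.- p) ℚ.* v)
  (𝔼-cong ps (λ X → h (true ∷ X))) (𝔼-cong ps (λ X → h (false ∷ X)))

-- Sums and products of reals act on the approximants index by index, so an expectation may be
-- evaluated at a fixed index.
seq-expectation : ∀ {k} (ps : Vec ℝ k) f I →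
  seq (expectation ps f) I ≡ 𝔼 (map (λ p → seq p I) ps) (λ X → seq (f X) I)
seq-expectation []       f I = refl
seq-expectation (p ∷ ps) f I = cong₂ (λ u v → seq p I ℚ.* u ℚ.+ (1ℚ ℚ.- seq p I) ℚ.* v)
  (seq-expectation ps (λ X → f (true ∷ X)) I) (seq-expectation ps (λ X → f (false ∷ X)) I)

module _ (b : ℕ) .{{_ : NonZero b}} (I : ℕ) where

  approx : Status → ℚ
  approx = transmitApprox b (λ m → lnApprox I (2 ℕ.+ m))

  seq-transmitProb : ∀ s → seq (transmitProb b s) I ≡ approx s
  seq-transmitProb asleep           = refl
  seq-transmitProb off              = refl
  seq-transmitProb (active zero)    = refl
  seq-transmitProb (active (suc r)) = refl

  seq-expectAfter : ∀ {k} (adv : Adversary k) n h f →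
    seq (expectAfter b adv n h f) I ≡ after approx adv n h (λ h → seq (f h) I)
  seq-expectAfter adv zero    h f = refl
  seq-expectAfter adv (suc n) h f = trans
    (seq-expectation (map (transmitProb b) ss) _ I)
    (trans (cong (λ ps → 𝔼 ps (λ X → seq (expectAfter b adv n (mkRound (adv h) X ∷ h) f) I)) (seq-probs ss))
      (𝔼-cong (map approx ss) (λ X → seq-expectAfter adv n (mkRound (adv h) X ∷ h) f)))
    where
    ss = zipWith activate (adv h) (statuses h)
    seq-probs : ∀ {k} (ss : Vec Status k) → map (λ p → seq p I) (map (transmitProb b) ss) ≡ map approx ss
    seq-probs []       = refl
    seq-probs (s ∷ ss) = cong₂ _∷_ (seq-transmitProb s) (seq-probs ss)

  after-cong : ∀ {k} (adv : Adversary k) n h {f g} → (∀ h → f h ≡ g h) → after approx adv n h f ≡ after approx adv n h g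
  after-cong adv zero    h e = e h
  after-cong adv (suc n) h e = 𝔼-cong (map approx (zipWith activate (adv h) (statuses h)))
    (λ X → after-cong adv n (mkRound (adv h) X ∷ h) e)

  seq-Pr : ∀ {k} (adv : Adversary k) n D → seq (Pr b adv n D) I ≡ after approx adv n [] (λ h → indicator (D h))
  seq-Pr adv n D = trans (seq-expectAfter adv n [] _) (after-cong adv n [] (λ h → seq-indicator (D h)))
    where
    seq-indicator : ∀ x → seq (if x then 1ℝ else 0ℝ) I ≡ indicator x
    seq-indicator true  = refl
    seq-indicator false = refl

Scale : ℕ → Set
Scale k = Σ[ L ∈ ℕ ] (1 ℕ.≤ L × 2 ℕ.^ L ℕ.≤ suc k × suc k ℕ.≤ 2 ℕ.^ suc L)

scale : ∀ k → 2 ℕ.≤ suc k → Scale k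
scale k 2≤k with binary-length k
... | zero  , lo , hi = contradiction 2≤k (ℕₚ.<⇒≱ hi)
... | suc L , lo , hi = suc L , ℕ.s≤s ℕ.z≤n , lo , ℕₚ.<⇒≤ hi

≤-eventually : ∀ {x y : ℝ} I₀ → (∀ I → I₀ ℕ.≤ I → seq x I ℚ.≤ seq y I) → x ≤ y
≤-eventually I₀ h ε 0<ε = I₀ , λ I I₀≤I → ℚₚ.≤-trans (h I I₀≤I) (≤-by ε (ℚₚ.<⇒≤ 0<ε) refl)

-- The approximants satisfy `L ≤ 4 ln k` from index `2 ^ L` on; squaring this gives the factor 16.
ln-squared-lower : ∀ C′ k L → 2 ℕ.^ L ℕ.≤ suc k → ∀ {a} → a ℕ.≤ C′ ℕ.* (suc k ℕ.* (L ℕ.* L)) →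
  fromℕ a ≤ fromℕ (16 ℕ.* C′) * fromℕ (suc k) * (ln (suc k) * ln (suc k))
ln-squared-lower C′ k L lo {a} a≤ = ≤-eventually {fromℕ a} {fromℕ (16 ℕ.* C′) * fromℕ (suc k) * (ln (suc k) * ln (suc k))} (2 ℕ.^ L) bound
  where
  open +-*-Solver
  open ℚₚ.≤-Reasoning
  bound : ∀ I → 2 ℕ.^ L ℕ.≤ I →
    ι a ℚ.≤ ι (16 ℕ.* C′) ℚ.* ι (suc k) ℚ.* (lnApprox I k ℚ.* lnApprox I k)
  bound I h = begin
    ι a                                                    ≤⟨ ι-mono a≤ ⟩
    ι (C′ ℕ.* (suc k ℕ.* (L ℕ.* L)))                       ≡⟨ trans (ι-* C′ (suc k ℕ.* (L ℕ.* L))) (cong (ι C′ ℚ.*_) (trans (ι-* (suc k) (L ℕ.* L)) (cong (ι (suc k) ℚ.*_) (ι-* L L)))) ⟩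
    ι C′ ℚ.* (ι (suc k) ℚ.* (ι L ℚ.* ι L))                 ≤⟨ *-monoˡ (ι C′) (ι-nonneg C′) (*-monoˡ (ι (suc k)) (ι-nonneg (suc k))
                                                                (*-mono-≤ (0≤* (ι-nonneg 4) (lnApprox-nonneg I k)) (ι-nonneg L) L≤ L≤)) ⟩
    ι C′ ℚ.* (ι (suc k) ℚ.* (ι 4 ℚ.* l ℚ.* (ι 4 ℚ.* l)))   ≡⟨ solve 3 (λ c k l → c :* (k :* (con (ι 4) :* l :* (con (ι 4) :* l))) := con (ι 16) :* c :* k :* (l :* l)) refl (ι C′) (ι (suc k)) l ⟩
    ι 16 ℚ.* ι C′ ℚ.* ι (suc k) ℚ.* (l ℚ.* l)              ≡⟨ cong (λ z → z ℚ.* ι (suc k) ℚ.* (l ℚ.* l)) (sym (ι-* 16 C′)) ⟩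
    ι (16 ℕ.* C′) ℚ.* ι (suc k) ℚ.* (l ℚ.* l)              ∎
    where
    l = lnApprox I k
    L≤ : ι L ℚ.≤ ι 4 ℚ.* l
    L≤ = lnApprox-lower {I} {k} L lo h

-- With a natural bound `B` on `η` and `ln (suc k) ≤ suc L`, the exponent is at most
-- `N = B * suc L`, and `expSum-neg-lower` costs `2N + 1` halvings, at most `(2B + 1) * suc L`.
-- Positivity of `η` makes the exponent nonnegative from `N₁` on.
power-lower : ∀ (η : ℝ) → 0ℝ < η → Σ[ M ∈ ℕ ] (∀ k L → suc k ℕ.≤ 2 ℕ.^ suc L →
  fromℚ (½ ^ (M ℕ.* suc L)) ≤ suc k ^ℝ (- η))
power-lower η (ε , 0<ε , N₁ , η-pos) = suc (B ℕ.+ B) , bound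
  where
  B = proj₁ (cauchy-bounded (seq η) (cauchy η))
  η≤B : ∀ I → seq η I ℚ.≤ ι B
  η≤B I = ℚₚ.≤-trans (q≤∣q∣ (seq η I)) (proj₂ (cauchy-bounded (seq η) (cauchy η)) I)
  bound : ∀ k L → suc k ℕ.≤ 2 ℕ.^ suc L → fromℚ (½ ^ (suc (B ℕ.+ B) ℕ.* suc L)) ≤ suc k ^ℝ (- η)
  bound k L hi = ≤-eventually {fromℚ (½ ^ (suc (B ℕ.+ B) ℕ.* suc L))} {suc k ^ℝ (- η)} (N₁ ℕ.⊔ proj₁ (expSum-neg-lower N)) λ I I-large →
    let N₁≤I = ℕₚ.≤-trans (ℕₚ.m≤m⊔n N₁ (proj₁ (expSum-neg-lower N))) I-large
        n₀≤I = ℕₚ.≤-trans (ℕₚ.m≤n⊔m N₁ (proj₁ (expSum-neg-lower N))) I-large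
        0≤η  = ℚₚ.≤-trans (ℚₚ.<⇒≤ 0<ε) (subst (ℚ._≤ seq η I) (ℚₚ.+-identityˡ ε) (η-pos I N₁≤I))
        l    = lnApprox I k
    in begin
    ½ ^ (suc (B ℕ.+ B) ℕ.* suc L)      ≤⟨ ½^-anti exponent ⟩
    ½ ^ suc (N ℕ.+ N)                  ≤⟨ proj₂ (expSum-neg-lower N) I n₀≤I (seq η I ℚ.* l) (0≤* 0≤η (lnApprox-nonneg I k))
                                           (ℚₚ.≤-trans (*-mono-≤ (ι-nonneg B) (lnApprox-nonneg I k) (η≤B I) (lnApprox-upper I {k} (suc L) hi))
                                             (ℚₚ.≤-reflexive (sym (ι-* B (suc L))))) ⟩
    expSum (ℚ.- (seq η I ℚ.* l)) I     ≡⟨ cong (λ z → expSum z I) (ℚₚ.neg-distribˡ-* (seq η I) l) ⟩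
    expSum (ℚ.- seq η I ℚ.* l) I       ∎
    where
    open ℚₚ.≤-Reasoning
    N = B ℕ.* suc L
    exponent : suc (N ℕ.+ N) ℕ.≤ suc (B ℕ.+ B) ℕ.* suc L
    exponent = ℕ.s≤s (ℕₚ.≤-trans (ℕₚ.≤-reflexive (sym (ℕₚ.*-distribʳ-+ (suc L) B B))) (ℕₚ.m≤n+m _ L))

theorem5p3 : (η : ℝ) → 0ℝ < η →
    Σ[ b₀ ∈ ℕ ] ((b : ℕ) → .{{_ : NonZero b}} → b₀ ℕ.≤ b →
    Σ[ C ∈ ℝ ] ((k : ℕ) → 2 ℕ.≤ k → (adv : Adversary k) →
    WithProbability b adv
    (λ h → fromℕ (attempts h) ≤ C * fromℕ k * (ln k * ln k))
    (1ℝ - (k ^ℝ (- η)))))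
-- Every block length from 1 on is admissible: `b` enters through `n` and thereby the constant. The
-- 16 converts the squared binary length into the squared logarithm.
theorem5p3 η 0<η = 1 , λ b 1≤b → fromℕ (16 ℕ.* attemptsConstant b M) , λ { (suc k) 2≤k adv n → conclude b 1≤b k (scale k 2≤k) adv n }
  where
  M = proj₁ (power-lower η 0<η)

  conclude : ∀ b .{{_ : NonZero b}} → 1 ℕ.≤ b → ∀ k → Scale k → (adv : Adversary (suc k)) → ∀ n →
    PrAtLeast b adv n (λ h → fromℕ (attempts h) ≤ fromℕ (16 ℕ.* attemptsConstant b M) * fromℕ (suc k) * (ln (suc k) * ln (suc k)))
      (1ℝ - (suc k ^ℝ (- η)))
  conclude b 1≤b k (L , 1≤L , lo , hi) adv n =
    (λ h → attempts h ≤ᵇ K) ,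
    (λ h few → ln-squared-lower (attemptsConstant b M) k L lo (ℕₚ.≤-trans (ℕₚ.≤ᵇ⇒≤ (attempts h) K few) (K≤ 1≤L))) ,
    -- From `I₀` on the failure bound lies below the approximant of the required power up to `ε`;
    -- from `2 ^ 12` on the approximate logarithms support the rational estimate.
    λ ε 0<ε → let (I₀ , tiny) = proj₂ (power-lower η 0<η) k L hi ε 0<ε in
      I₀ ℕ.⊔ 2 ℕ.^ 12 , λ I I-large → begin
        1ℚ ℚ.- seq (suc k ^ℝ (- η)) I
          ≤⟨ ≤-by (seq (suc k ^ℝ (- η)) I ℚ.+ ε ℚ.- ½ ^ (M ℕ.* suc L))
               (≤⇒0≤- (tiny I (ℕₚ.≤-trans (ℕₚ.m≤m⊔n I₀ (2 ℕ.^ 12)) I-large)))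
               (solve 3 (λ y ε w → con 1ℚ :- y :+ (y :+ ε :- w) := con 1ℚ :- w :+ ε) refl
                 (seq (suc k ^ℝ (- η)) I) ε (½ ^ (M ℕ.* suc L))) ⟩
        1ℚ ℚ.- ½ ^ (M ℕ.* suc L) ℚ.+ ε
          ≤⟨ ℚₚ.+-monoˡ-≤ ε (few-attempts-likely b M L (suc k) 1≤b (ℕ.s≤s ℕ.z≤n) hi {I} (ℕₚ.≤-trans (ℕₚ.m≤n⊔m I₀ (2 ℕ.^ 12)) I-large) adv n) ⟩
        after (approx b I) adv n [] (λ h → indicator (attempts h ≤ᵇ K)) ℚ.+ ε
          ≡⟨ cong (ℚ._+ ε) (sym (seq-Pr b I adv n (λ h → attempts h ≤ᵇ K))) ⟩
        seq (Pr b adv n (λ h → attempts h ≤ᵇ K)) I ℚ.+ ε ∎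
    where
    open Parameters b M L (suc k) 1≤b (ℕ.s≤s ℕ.z≤n) hi using (K; K≤)
    open ℚₚ.≤-Reasoning
    open +-*-Solver
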